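{- For any fixed integer $r\geq 2$, $$D(n,r) = \Omega\left( \left(\frac{n}{\ln(n)}\right)^{\frac{r-1}{r}} r^n\right)\qquad\text{as } n\to\infty.$$ That is, for every integer $r\ge 2$ there exist a constant $C=C(r)>0$ and an integer $n_0=n_0(r)$ such that $D(n,r)\geq C\left(\frac{n}{\ln(n)}\right)^{\frac{r-1}{r}} r^n$ for all integers $n\ge n_0$.
   Context: A (finite) hypergraph is a pair $(V,E)$, where $V$ is a finite set of vertices and $E$ is a family (set) of subsets of $V$, called edges. It is $n$-uniform if all its edges have exactly $n$ elements. It is $r$-colorable if there exists a function $c:V\to\{1,\ldots,r\}$ such that no edge is monochromatic, i.e. the image under $c$ of every edge has at least two elements. The degree of an edge $f\in E$ is the number of edges $e\in E$, $e\neq f$, with $e\cap f\neq\emptyset$. $D(n,r)$ denotes the maximum number such that every $n$-uniform hypergraph in which all edge degrees are strictly smaller than $D(n,r)$ is $r$-colorable. The asymptotics are for fixed $r$ and $n$ tending to infinity. -}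

module Defs where

import Algebra.Definitions.RawSemiring as RawSemiring
import Data.Bool.Properties as Bool
import Data.Empty as Empty
open import Data.Fin.Base using (Fin; zero; suc)
import Data.Fin.Properties as Fin
open import Data.Fin.Subset using (Subset; inside; outside; _∈_; _∩_; ⊥) renaming (∣_∣ to size)
open import Data.Fin.Subset.Properties using (nonempty?; ∣⊥∣≡0; ∉⊥; drop-there)
open import Data.Integer.Base as ℤ using (+_)
import Data.Integer.Properties as ℤ
open import Data.List.Base using (List; []; _∷_; _++_; map; length; filter)
open import Data.List.Membership.Propositional using () renaming (_∈_ to _∈ₗ_)
open import Data.List.Membership.Propositional.Properties using (∈-++⁺ˡ; ∈-++⁺ʳ; ∈-map⁺; ∈-map⁻)
open import Data.List.Properties using (length-filter)
open import Data.List.Relation.Unary.All as All using (All; []; _∷_)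
import Data.List.Relation.Unary.All.Properties as All
open import Data.List.Relation.Unary.AllPairs using ([]; _∷_)
open import Data.List.Relation.Unary.Any using (here)
open import Data.List.Relation.Unary.Unique.Propositional using (Unique)
import Data.List.Relation.Unary.Unique.Propositional.Properties as Unique
open import Data.Nat.Base as ℕ using (ℕ; zero; suc; z≤n; s≤s)
import Data.Nat.Properties as ℕ
open import Data.Product.Base using (∃; ∃-syntax; ∃₂; _×_; _,_)
open import Data.Rational using (ℚ; 0ℚ; 1ℚ; ½; mkℚ; _+_; _*_; _-_; -_; ∣_∣; _/_; 1/_; _≤_; _<_; *<*; toℚᵘ; Positive; NonZero; positive; nonNegative; ≢-nonZero; ↥_; ↧_; +-*-rawSemiring)
open import Data.Rational.Properties
open import Data.Rational.Solver using (module +-*-Solver)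
import Data.Rational.Unnormalised.Base as ℚᵘ
import Data.Rational.Unnormalised.Properties as ℚᵘ
open import Data.Sum.Base as Sum using (_⊎_; inj₁; inj₂)
open import Data.Vec.Base using ([]; _∷_)
import Data.Vec.Properties as Vec
open import Function.Base using (_∘_)
open import Relation.Binary.PropositionalEquality
open import Relation.Nullary using (¬_; Dec; yes; no; contradiction; ¬?; _×-dec_)

open RawSemiring +-*-rawSemiring using (_^_)
open +-*-Solver using (solve; _:=_; _:+_; _:*_; _:-_; :-_)

record Hypergraph : Set where
  field
    order  : ℕ
    edges  : List (Subset order)
    unique : Unique edges

open Hypergraph public

Uniform : ℕ → Hypergraph → Set
Uniform n H = All (λ e → size e ≡ n) (edges H)

Colorable : ℕ → Hypergraph → Set
Colorable r H = ∃ λ (c : Fin (order H) → Fin r) → All (λ e → ∃₂ λ u v → u ∈ e × v ∈ e × c u ≢ c v) (edges H)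

degree : (H : Hypergraph) → Subset (order H) → ℕ
degree H f = length (filter (λ e → ¬? (Vec.≡-dec Bool._≟_ e f) ×-dec nonempty? (e ∩ f)) (edges H))

EnsuresColorable : ℕ → ℕ → ℕ → Set
EnsuresColorable n r d = ∀ H → Uniform n H → All (λ f → degree H f ℕ.< d) (edges H) → Colorable r H

-- `IsD n r d` says d = D(n,r).  Edge degrees are integers, so taking the
-- maximum over naturals rather than over reals gives the same number.
IsD : ℕ → ℕ → ℕ → Set
IsD n r d = EnsuresColorable n r d × (∀ d′ → EnsuresColorable n r d′ → d′ ℕ.≤ d)

-- From here to IsD-unique: D(n,r) is well defined for r ≥ 1.  Existence is
-- double-negated because EnsuresColorable quantifies over all hypergraphs
-- and is not known to be decidable; the witness that bounds it is the
-- complete n-uniform hypergraph on r * n vertices.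
subsets : (m n : ℕ) → List (Subset m)
subsets zero    zero    = [] ∷ []
subsets zero    (suc n) = []
subsets (suc m) zero    = map (outside ∷_) (subsets m zero)
subsets (suc m) (suc n) = map (inside ∷_) (subsets m n) ++ map (outside ∷_) (subsets m (suc n))

abstract
  subsets-size : ∀ m n → All (λ e → size e ≡ n) (subsets m n)
  subsets-size zero    zero    = refl ∷ []
  subsets-size zero    (suc n) = []
  subsets-size (suc m) zero    = All.map⁺ (subsets-size m zero)
  subsets-size (suc m) (suc n) = All.++⁺ (All.map⁺ (All.map (cong suc) (subsets-size m n)))
                                         (All.map⁺ (subsets-size m (suc n)))

  subsets-complete : ∀ {m} n (e : Subset m) → size e ≡ n → e ∈ₗ subsets m n
  subsets-complete zero [] refl = here refl
  subsets-complete zero (outside ∷ e) eq = ∈-map⁺ (outside ∷_) (subsets-complete zero e eq)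
  subsets-complete zero (inside ∷ e) ()
  subsets-complete (suc n) [] ()
  subsets-complete (suc n) (inside ∷ e) eq =
    ∈-++⁺ˡ (∈-map⁺ (inside ∷_) (subsets-complete n e (ℕ.suc-injective eq)))
  subsets-complete {suc m} (suc n) (outside ∷ e) eq =
    ∈-++⁺ʳ (map (inside ∷_) (subsets m n)) (∈-map⁺ (outside ∷_) (subsets-complete (suc n) e eq))

  subsets-unique : ∀ m n → Unique (subsets m n)
  subsets-unique zero    zero    = [] ∷ []
  subsets-unique zero    (suc n) = []
  subsets-unique (suc m) zero    = Unique.map⁺ Vec.∷-injectiveʳ (subsets-unique m zero)
  subsets-unique (suc m) (suc n) = Unique.++⁺
    (Unique.map⁺ Vec.∷-injectiveʳ (subsets-unique m n))
    (Unique.map⁺ Vec.∷-injectiveʳ (subsets-unique m (suc n)))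
    λ (p , q) → disjoint (∈-map⁻ (inside ∷_) p) (∈-map⁻ (outside ∷_) q)
    where
    disjoint : ∀ {e : Subset (suc m)} → (∃[ x ] x ∈ₗ subsets m n × e ≡ inside ∷ x) →
               (∃[ y ] y ∈ₗ subsets m (suc n) × e ≡ outside ∷ y) → Empty.⊥
    disjoint (_ , _ , refl) (_ , _ , ())

complete : ℕ → ℕ → Hypergraph
complete m n = record { order = m ; edges = subsets m n ; unique = subsets-unique m n }

total : ∀ {r} → (Fin r → ℕ) → ℕ
total {zero}  f = 0
total {suc r} f = f zero ℕ.+ total (f ∘ suc)

abstract
  lower-target : ∀ {r} (f : Fin r → ℕ) (i : Fin r) {k} → f i ≡ suc k →
    ∃[ g ] suc (total g) ≡ total f × g i ≡ k × (∀ j → j ≢ i → g j ≡ f j)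
  lower-target {suc r} f zero {k} eq =
    (λ { zero → k ; (suc j) → f (suc j) }) ,
    cong (ℕ._+ total (f ∘ suc)) (sym eq) , refl ,
    λ { zero j≢i → contradiction refl j≢i ; (suc j) _ → refl }
  lower-target {suc r} f (suc i) {k} eq with lower-target (f ∘ suc) i eq
  ... | g , sum , gi , rest =
    (λ { zero → f zero ; (suc j) → g j }) ,
    trans (sym (ℕ.+-suc (f zero) (total g))) (cong (f zero ℕ.+_) sum) , gi ,
    λ { zero _ → refl ; (suc j) j≢i → rest j (j≢i ∘ cong suc) }

  total≡0 : ∀ {r} (f : Fin r → ℕ) → total f ℕ.≤ 0 → ∀ i → f i ≡ 0
  total≡0 f h zero    = ℕ.n≤0⇒n≡0 (ℕ.m+n≤o⇒m≤o (f zero) h)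
  total≡0 f h (suc i) = total≡0 (f ∘ suc) (ℕ.m+n≤o⇒n≤o (f zero) h) i

  total-const : ∀ r n → total {r} (λ _ → n) ≡ r ℕ.* n
  total-const zero    n = refl
  total-const (suc r) n = cong (n ℕ.+_) (total-const r n)

  pigeonhole : ∀ {m r} (c : Fin m → Fin (suc r)) (f : Fin (suc r) → ℕ) → total f ℕ.≤ m →
               ∃₂ λ i (e : Subset m) → size e ≡ f i × (∀ v → v ∈ e → c v ≡ i)
  pigeonhole {zero} c f h = zero , [] , sym (total≡0 f h zero) , λ ()
  pigeonhole {suc m} c f h with f (c zero) in eq
  ... | zero  = c zero , ⊥ , trans (∣⊥∣≡0 (suc m)) (sym eq) , λ v v∈⊥ → contradiction v∈⊥ ∉⊥
  ... | suc k with lower-target f (c zero) eq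
  ...   | g , sum , gi , rest with pigeonhole (c ∘ suc) g (ℕ.s≤s⁻¹ (ℕ.≤-trans (ℕ.≤-reflexive sum) h))
  ...     | i , e , size≡ , mono with i Fin.≟ c zero
  ...       | yes refl = c zero , inside ∷ e , trans (cong suc (trans size≡ gi)) (sym eq) ,
                λ { zero _ → refl ; (suc v) v∈ → mono v (drop-there v∈) }
  ...       | no i≢ = i , outside ∷ e , trans size≡ (rest i i≢) ,
                λ { zero () ; (suc v) v∈ → mono v (drop-there v∈) }

  complete-not-colorable : ∀ n r → ¬ Colorable (suc r) (complete (suc r ℕ.* n) n)
  complete-not-colorable n r (c , good)
    with pigeonhole c (λ _ → n) (ℕ.≤-reflexive (total-const (suc r) n))
  ... | i , e , size≡ , mono with All.lookup good (subsets-complete n e size≡)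
  ...   | u , v , u∈e , v∈e , cu≢cv = cu≢cv (trans (mono u u∈e) (sym (mono v v∈e)))

  degree≤ : ∀ H f → degree H f ℕ.≤ length (edges H)
  degree≤ H f = length-filter _ (edges H)

  EnsuresColorable-bounded : ∀ n r d → EnsuresColorable n (suc r) d → d ℕ.≤ length (subsets (suc r ℕ.* n) n)
  EnsuresColorable-bounded n r d forces = ℕ.≮⇒≥ λ B<d → complete-not-colorable n r
    (forces K (subsets-size _ n) (All.universal (λ f → ℕ.≤-<-trans (degree≤ K f) B<d) (edges K)))
    where
    K : Hypergraph
    K = complete (suc r ℕ.* n) n

  EnsuresColorable-zero : ∀ n r → EnsuresColorable n (suc r) 0
  EnsuresColorable-zero n r H _ degrees = (λ _ → zero) , All.map (λ ()) degrees

  EnsuresColorable-downward : ∀ {n r d d′} → d′ ℕ.≤ d → EnsuresColorable n r d → EnsuresColorable n r d′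
  EnsuresColorable-downward d′≤d forces H u degrees = forces H u (All.map (λ lt → ℕ.<-≤-trans lt d′≤d) degrees)

  IsD-exists : ∀ n r → 0 ℕ.< r → ¬ ¬ ∃ (IsD n r)
  IsD-exists n (suc r) _ none = all (suc B) λ forces → ℕ.<-irrefl refl (EnsuresColorable-bounded n r (suc B) forces)
    where
    B : ℕ
    B = length (subsets (suc r ℕ.* n) n)
    all : ∀ d → ¬ ¬ EnsuresColorable n (suc r) d
    all zero    ¬f = ¬f (EnsuresColorable-zero n r)
    all (suc d) ¬f = all d λ f → none (d , f , λ d′ f′ → ℕ.≮⇒≥ λ d<d′ → ¬f (EnsuresColorable-downward d<d′ f′))

  IsD-unique : ∀ {n r d d′} → IsD n r d → IsD n r d′ → d ≡ d′
  IsD-unique (f , max) (f′ , max′) = ℕ.≤-antisym (max′ _ f) (max _ f′)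

fromℕℚ : ℕ → ℚ
fromℕℚ n = + n / 1

1/suc : ℕ → ℚ
1/suc n = + 1 / suc n

abstract
  toℚᵘ-/ : ∀ i n → toℚᵘ (i / suc n) ℚᵘ.≃ ℚᵘ.mkℚᵘ i n
  toℚᵘ-/ i n = toℚᵘ-fromℚᵘ (ℚᵘ.mkℚᵘ i n)

  fromℕℚ-suc : ∀ n → fromℕℚ (suc n) ≡ fromℕℚ n + 1ℚ
  fromℕℚ-suc n = toℚᵘ-injective (begin
    toℚᵘ (+ suc n / 1)              ≈⟨ toℚᵘ-/ (+ suc n) 0 ⟩
    ℚᵘ.mkℚᵘ (+ suc n) 0             ≈⟨ ℚᵘ.*≡* (cong (ℤ._* + 1) (trans (cong +_ (ℕ.+-comm 1 n)) (cong (ℤ._+ + 1) (sym (ℤ.*-identityʳ (+ n)))))) ⟩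
    ℚᵘ.mkℚᵘ (+ n) 0 ℚᵘ.+ ℚᵘ.1ℚᵘ     ≈⟨ ℚᵘ.+-congˡ ℚᵘ.1ℚᵘ (toℚᵘ-/ (+ n) 0) ⟨
    toℚᵘ (fromℕℚ n) ℚᵘ.+ ℚᵘ.1ℚᵘ     ≈⟨ toℚᵘ-homo-+ (fromℕℚ n) 1ℚ ⟨
    toℚᵘ (fromℕℚ n + 1ℚ)            ∎)
    where open ℚᵘ.≃-Reasoning

  1/suc-* : ∀ a b → 1/suc a * 1/suc b ≡ 1/suc (b ℕ.+ a ℕ.* suc b)
  1/suc-* a b = toℚᵘ-injective (begin
    toℚᵘ (1/suc a * 1/suc b)                     ≈⟨ toℚᵘ-homo-* (1/suc a) (1/suc b) ⟩
    toℚᵘ (1/suc a) ℚᵘ.* toℚᵘ (1/suc b)           ≈⟨ ℚᵘ.*-cong (toℚᵘ-/ (+ 1) a) (toℚᵘ-/ (+ 1) b) ⟩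
    ℚᵘ.mkℚᵘ (+ 1) a ℚᵘ.* ℚᵘ.mkℚᵘ (+ 1) b         ≈⟨ toℚᵘ-/ (+ 1) (b ℕ.+ a ℕ.* suc b) ⟨
    toℚᵘ (1/suc (b ℕ.+ a ℕ.* suc b))             ∎)
    where open ℚᵘ.≃-Reasoning

  1/suc-inverse : ∀ n → fromℕℚ (suc n) * 1/suc n ≡ 1ℚ
  1/suc-inverse n = toℚᵘ-injective (begin
    toℚᵘ (fromℕℚ (suc n) * 1/suc n)              ≈⟨ toℚᵘ-homo-* (fromℕℚ (suc n)) (1/suc n) ⟩
    toℚᵘ (fromℕℚ (suc n)) ℚᵘ.* toℚᵘ (1/suc n)    ≈⟨ ℚᵘ.*-cong (toℚᵘ-/ (+ suc n) 0) (toℚᵘ-/ (+ 1) n) ⟩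
    ℚᵘ.mkℚᵘ (+ suc n) 0 ℚᵘ.* ℚᵘ.mkℚᵘ (+ 1) n     ≈⟨ ℚᵘ.*-inverseʳ (ℚᵘ.mkℚᵘ (+ suc n) 0) ⟩
    ℚᵘ.1ℚᵘ                                       ∎)
    where open ℚᵘ.≃-Reasoning

  1/suc-antimono : ∀ {a b} → b ℕ.≤ a → 1/suc a ≤ 1/suc b
  1/suc-antimono {a} {b} b≤a = toℚᵘ-cancel-≤ (begin
    toℚᵘ (1/suc a)   ≃⟨ toℚᵘ-/ (+ 1) a ⟩
    ℚᵘ.mkℚᵘ (+ 1) a  ≤⟨ ℚᵘ.*≤* (ℤ.*-monoˡ-≤-nonNeg (+ 1) (ℤ.+≤+ (s≤s b≤a))) ⟩
    ℚᵘ.mkℚᵘ (+ 1) b  ≃⟨ toℚᵘ-/ (+ 1) b ⟨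
    toℚᵘ (1/suc b)   ∎)
    where open ℚᵘ.≤-Reasoning

  0<1/suc : ∀ n → 0ℚ < 1/suc n
  0<1/suc n = positive⁻¹ (1/suc n) {{normalize-pos 1 (suc n)}}

  0≤1/suc : ∀ n → 0ℚ ≤ 1/suc n
  0≤1/suc n = <⇒≤ (0<1/suc n)

  0<1ℚ : 0ℚ < 1ℚ
  0<1ℚ = *<* (ℤ.+<+ (s≤s z≤n))

  0<½ : 0ℚ < ½
  0<½ = *<* (ℤ.+<+ (s≤s z≤n))

  archimedean : ∀ {ε} → 0ℚ < ε → ∃[ n ] 1/suc n ≤ ε
  archimedean {ε@(mkℚ (+ suc k) d _)} (*<* _) = d , toℚᵘ-cancel-≤ (begin
    toℚᵘ (1/suc d)        ≃⟨ toℚᵘ-/ (+ 1) d ⟩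
    ℚᵘ.mkℚᵘ (+ 1) d       ≤⟨ ℚᵘ.*≤* (ℤ.*-monoʳ-≤-nonNeg (+ suc d) (ℤ.+≤+ (s≤s (z≤n {k})))) ⟩
    ℚᵘ.mkℚᵘ (+ suc k) d   ∎)
    where open ℚᵘ.≤-Reasoning
  archimedean {mkℚ (+ 0) _ _} (*<* (ℤ.+<+ ()))
  archimedean {mkℚ ℤ.-[1+ _ ] _ _} (*<* ())

  *-pos : ∀ {p q} → 0ℚ < p → 0ℚ < q → 0ℚ < p * q
  *-pos {p} {q} 0<p 0<q = positive⁻¹ (p * q) {{pos*pos⇒pos p {{positive 0<p}} q {{positive 0<q}}}}

  *-nonNeg : ∀ {p q} → 0ℚ ≤ p → 0ℚ ≤ q → 0ℚ ≤ p * q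
  *-nonNeg {p} {q} 0≤p 0≤q = nonNegative⁻¹ (p * q) {{nonNeg*nonNeg⇒nonNeg p {{nonNegative 0≤p}} q {{nonNegative 0≤q}}}}

  +-nonNeg : ∀ {p q} → 0ℚ ≤ p → 0ℚ ≤ q → 0ℚ ≤ p + q
  +-nonNeg 0≤p 0≤q = +-mono-≤ 0≤p 0≤q

  *-mono-≤ : ∀ {p q r s} → 0ℚ ≤ r → 0ℚ ≤ q → p ≤ q → r ≤ s → p * r ≤ q * s
  *-mono-≤ {p} {q} {r} {s} 0≤r 0≤q p≤q r≤s = ≤-trans
    (*-monoʳ-≤-nonNeg r {{nonNegative 0≤r}} p≤q) (*-monoˡ-≤-nonNeg q {{nonNegative 0≤q}} r≤s)

  ∣-∣-≤ : ∀ {p q ε} → p ≤ q + ε → q ≤ p + ε → ∣ p - q ∣ ≤ ε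
  ∣-∣-≤ {p} {q} {ε} h₁ h₂ with ∣p∣≡p∨∣p∣≡-p (p - q)
  ... | inj₁ e rewrite e = ≤-trans (+-monoˡ-≤ (- q) h₁) (≤-reflexive
          (solve 2 (λ q ε → (q :+ ε) :- q := ε) refl q ε))
  ... | inj₂ e rewrite e = ≤-trans (≤-reflexive (solve 2 (λ p q → :- (p :- q) := q :- p) refl p q))
          (≤-trans (+-monoˡ-≤ (- p) h₂) (≤-reflexive (solve 2 (λ p ε → (p :+ ε) :- p := ε) refl p ε)))

  p≤∣p∣ : ∀ p → p ≤ ∣ p ∣
  p≤∣p∣ p with ∣p∣≡p∨∣p∣≡-p p
  ... | inj₁ e = ≤-reflexive (sym e)
  ... | inj₂ e = ≤-trans p≤0 (0≤∣p∣ p)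
    where
    p≤0 : p ≤ 0ℚ
    p≤0 = ≤-trans (≤-reflexive (trans (solve 1 (λ p → p := :- (:- p)) refl p) (cong -_ (sym e))))
                  (neg-antimono-≤ (0≤∣p∣ p))

  ≤-∣-∣ : ∀ {p q ε} → ∣ p - q ∣ ≤ ε → p ≤ q + ε
  ≤-∣-∣ {p} {q} {ε} h = ≤-trans
    (≤-reflexive (solve 2 (λ p q → p := q :+ (p :- q)) refl p q))
    (+-monoʳ-≤ q (≤-trans (p≤∣p∣ (p - q)) h))

  halve : ∀ {ε} → 0ℚ < ε → ∃[ δ ] 0ℚ < δ × δ + δ ≡ ε
  halve {ε} 0<ε = ½ * ε , *-pos 0<½ 0<ε , trans (sym (*-distribʳ-+ ε ½ ½)) (*-identityˡ ε)

  ≡-+-difference : ∀ a b → a ≡ b + (a - b)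
  ≡-+-difference = solve 2 (λ a b → a := b :+ (a :- b)) refl

  product-difference : ∀ a b c d → a * c - b * d ≡ a * (c - d) + (a - b) * d
  product-difference = solve 4 (λ a b c d → a :* c :- b :* d := a :* (c :- d) :+ (a :- b) :* d) refl

  regroupˡ : ∀ a b c → a * (b * c) ≡ b * (a * c)
  regroupˡ = solve 3 (λ a b c → a :* (b :* c) := b :* (a :* c)) refl

  *-assoc-comm : ∀ a b c → a * b * c ≡ a * (c * b)
  *-assoc-comm = solve 3 (λ a b c → a :* b :* c := a :* (c :* b)) refl

  rotate : ∀ r a s → r * (a * s) ≡ (a * r) * s
  rotate = solve 3 (λ r a s → r :* (a :* s) := (a :* r) :* s) refl

  recip-difference : ∀ a b a′ b′ → (b * b′) * a′ - (a * a′) * b′ ≡ (b - a) * (a′ * b′)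
  recip-difference = solve 4 (λ a b a′ b′ → (b :* b′) :* a′ :- (a :* a′) :* b′ := (b :- a) :* (a′ :* b′)) refl

  square-cancel : ∀ e c c′ → e * (c * c) * (c′ * c′) ≡ e * ((c * c′) * (c * c′))
  square-cancel = solve 3 (λ e c c′ → e :* (c :* c) :* (c′ :* c′) := e :* ((c :* c′) :* (c :* c′))) refl

IsCauchy : (ℕ → ℚ) → Set
IsCauchy s = ∀ ε → 0ℚ < ε → ∃[ N ] ∀ m n → N ℕ.≤ m → N ℕ.≤ n → ∣ s m - s n ∣ ≤ ε

-- Real numbers as Cauchy sequences of rationals; equality of reals is
-- two-sided _≤ℝ_, never _≡_.
record ℝ : Set where
  field
    seq    : ℕ → ℚ
    cauchy : IsCauchy seq

open ℝ public

infix 4 _≤ℝ_ _<ℝ_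

_≤ℝ_ : ℝ → ℝ → Set
x ≤ℝ y = ∀ ε → 0ℚ < ε → ∃[ N ] ∀ n → N ℕ.≤ n → seq x n ≤ seq y n + ε

_<ℝ_ : ℝ → ℝ → Set
x <ℝ y = ∃[ ε ] 0ℚ < ε × ∃[ N ] ∀ n → N ℕ.≤ n → seq x n + ε ≤ seq y n

fromℚ : ℚ → ℝ
fromℚ q = record
  { seq    = λ _ → q
  ; cauchy = λ ε 0<ε → 0 , λ _ _ _ _ → ≤-trans (≤-reflexive (cong ∣_∣ (+-inverseʳ q))) (<⇒≤ 0<ε)
  }

fromℕ : ℕ → ℝ
fromℕ n = fromℚ (fromℕℚ n)

0ℝ 1ℝ : ℝ
0ℝ = fromℚ 0ℚ
1ℝ = fromℚ 1ℚ

abstract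
  bounded : ∀ x → ∃[ B ] 0ℚ < B × ∃[ N ] ∀ n → N ℕ.≤ n → ∣ seq x n ∣ ≤ B
  bounded x with cauchy x 1ℚ 0<1ℚ
  ... | N , close = ∣ seq x N ∣ + 1ℚ , +-mono-≤-< (0≤∣p∣ (seq x N)) 0<1ℚ , N , λ n N≤n → begin
    ∣ seq x n ∣                          ≡⟨ cong ∣_∣ (≡-+-difference (seq x n) (seq x N)) ⟩
    ∣ seq x N + (seq x n - seq x N) ∣    ≤⟨ ∣p+q∣≤∣p∣+∣q∣ (seq x N) _ ⟩
    ∣ seq x N ∣ + ∣ seq x n - seq x N ∣  ≤⟨ +-monoʳ-≤ ∣ seq x N ∣ (close n N N≤n ℕ.≤-refl) ⟩
    ∣ seq x N ∣ + 1ℚ                     ∎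
    where open ≤-Reasoning

  pos-inverse : ∀ {p} → 0ℚ < p → ∃[ q ] 0ℚ < q × p * q ≡ 1ℚ
  pos-inverse {p} 0<p = (1/ p) , positive⁻¹ (1/ p) {{1/pos⇒pos p}} , *-inverseʳ p
    where instance
      p⁺ : Positive p
      p⁺ = positive 0<p
      p≢0 : NonZero p
      p≢0 = pos⇒nonZero p

  product-close : ∀ {xm xn ym yn ε} B C δ B′ C′ → 0ℚ < B → 0ℚ < δ → 0ℚ < C′ →
                  B * B′ ≡ 1ℚ → C * C′ ≡ 1ℚ → ∣ xm ∣ ≤ B → ∣ yn ∣ ≤ C →
                  ∣ xm - xn ∣ ≤ δ * C′ → ∣ ym - yn ∣ ≤ δ * B′ → δ + δ ≡ ε →
                  ∣ xm * ym - xn * yn ∣ ≤ ε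
  product-close {xm} {xn} {ym} {yn} {ε} B C δ B′ C′ 0<B 0<δ 0<C′ BB′ CC′ xB yC xε yε δ+δ≡ε = begin
    ∣ xm * ym - xn * yn ∣
      ≡⟨ cong ∣_∣ (product-difference xm xn ym yn) ⟩
    ∣ xm * (ym - yn) + (xm - xn) * yn ∣
      ≤⟨ ∣p+q∣≤∣p∣+∣q∣ (xm * (ym - yn)) ((xm - xn) * yn) ⟩
    ∣ xm * (ym - yn) ∣ + ∣ (xm - xn) * yn ∣
      ≡⟨ cong₂ _+_ (∣p*q∣≡∣p∣*∣q∣ xm (ym - yn)) (∣p*q∣≡∣p∣*∣q∣ (xm - xn) yn) ⟩
    ∣ xm ∣ * ∣ ym - yn ∣ + ∣ xm - xn ∣ * ∣ yn ∣
      ≤⟨ +-mono-≤ (*-mono-≤ (0≤∣p∣ (ym - yn)) (<⇒≤ 0<B) xB yε)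
                  (*-mono-≤ (0≤∣p∣ yn) (<⇒≤ (*-pos 0<δ 0<C′)) xε yC) ⟩
    B * (δ * B′) + δ * C′ * C
      ≡⟨ cong₂ _+_ (regroupˡ B δ B′) (*-assoc-comm δ C′ C) ⟩
    δ * (B * B′) + δ * (C * C′)
      ≡⟨ cong₂ (λ s t → δ * s + δ * t) BB′ CC′ ⟩
    δ * 1ℚ + δ * 1ℚ
      ≡⟨ cong₂ _+_ (*-identityʳ δ) (*-identityʳ δ) ⟩
    δ + δ
      ≡⟨ δ+δ≡ε ⟩
    ε ∎
    where open ≤-Reasoning

infixl 7 _*ℝ_
_*ℝ_ : ℝ → ℝ → ℝ
x *ℝ y = record { seq = λ n → seq x n * seq y n ; cauchy = *-cauchy }
  where
  *-cauchy : IsCauchy (λ n → seq x n * seq y n)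
  *-cauchy ε 0<ε with bounded x | bounded y | halve 0<ε
  ... | B , 0<B , N₁ , xB | C , 0<C , N₂ , yC | δ , 0<δ , δ+δ≡ε
    with pos-inverse 0<B | pos-inverse 0<C
  ... | B′ , 0<B′ , BB′ | C′ , 0<C′ , CC′
    with cauchy x (δ * C′) (*-pos 0<δ 0<C′) | cauchy y (δ * B′) (*-pos 0<δ 0<B′)
  ... | N₃ , xε | N₄ , yε = (N₁ ℕ.⊔ N₂) ℕ.⊔ (N₃ ℕ.⊔ N₄) , λ m n N≤m N≤n →
    let
      N₁≤m = ℕ.m⊔n≤o⇒m≤o N₁ N₂ (ℕ.m⊔n≤o⇒m≤o (N₁ ℕ.⊔ N₂) (N₃ ℕ.⊔ N₄) N≤m)
      N₂≤n = ℕ.m⊔n≤o⇒n≤o N₁ N₂ (ℕ.m⊔n≤o⇒m≤o (N₁ ℕ.⊔ N₂) (N₃ ℕ.⊔ N₄) N≤n)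
      3m = ℕ.m⊔n≤o⇒n≤o (N₁ ℕ.⊔ N₂) (N₃ ℕ.⊔ N₄) N≤m
      3n = ℕ.m⊔n≤o⇒n≤o (N₁ ℕ.⊔ N₂) (N₃ ℕ.⊔ N₄) N≤n
    in product-close B C δ B′ C′ 0<B 0<δ 0<C′ BB′ CC′
      (xB m N₁≤m) (yC n N₂≤n)
      (xε m n (ℕ.m⊔n≤o⇒m≤o N₃ N₄ 3m) (ℕ.m⊔n≤o⇒m≤o N₃ N₄ 3n))
      (yε m n (ℕ.m⊔n≤o⇒n≤o N₃ N₄ 3m) (ℕ.m⊔n≤o⇒n≤o N₃ N₄ 3n))
      δ+δ≡ε

infixr 8 _^ℝ_
_^ℝ_ : ℝ → ℕ → ℝ
x ^ℝ zero  = 1ℝ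
x ^ℝ suc n = x *ℝ x ^ℝ n

-- Total on ℚ, with recip 0 = 0, so that it can be applied termwise.
recip : ℚ → ℚ
recip q with q ≟ 0ℚ
... | yes _   = 0ℚ
... | no  q≢0 = (1/ q) {{≢-nonZero q≢0}}

abstract
  recip-inverse : ∀ {q} → 0ℚ < q → q * recip q ≡ 1ℚ
  recip-inverse {q} 0<q with q ≟ 0ℚ
  ... | yes q≡0 = contradiction (sym q≡0) (<⇒≢ 0<q)
  ... | no  q≢0 = *-inverseʳ q {{≢-nonZero q≢0}}

  recip-pos : ∀ {q} → 0ℚ < q → 0ℚ ≤ recip q
  recip-pos {q} 0<q with q ≟ 0ℚ
  ... | yes q≡0 = ≤-refl
  ... | no  q≢0 = <⇒≤ (positive⁻¹ _ {{1/pos⇒pos q {{positive 0<q}}}})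

  recip-antimono : ∀ {c a} → 0ℚ < c → c ≤ a → recip a ≤ recip c
  recip-antimono {c} {a} 0<c c≤a = begin
    recip a                   ≡⟨ *-identityʳ (recip a) ⟨
    recip a * 1ℚ              ≡⟨ cong (recip a *_) (recip-inverse 0<c) ⟨
    recip a * (c * recip c)   ≤⟨ *-monoˡ-≤-nonNeg (recip a) {{nonNegative (recip-pos 0<a)}}
                                   (*-monoʳ-≤-nonNeg (recip c) {{nonNegative (recip-pos 0<c)}} c≤a) ⟩
    recip a * (a * recip c)   ≡⟨ rotate (recip a) a (recip c) ⟩
    (a * recip a) * recip c   ≡⟨ cong (_* recip c) (recip-inverse 0<a) ⟩
    1ℚ * recip c              ≡⟨ *-identityˡ (recip c) ⟩
    recip c                   ∎
    where
    open ≤-Reasoning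
    0<a : 0ℚ < a
    0<a = <-≤-trans 0<c c≤a

-- The terms do not depend on the positivity proof, only their Cauchy
-- property does.
inverse : (x : ℝ) → 0ℝ <ℝ x → ℝ
inverse x (c , 0<c , N₀ , x≥) = record { seq = λ n → recip (seq x n) ; cauchy = inverse-cauchy }
  where
  x≥c : ∀ n → N₀ ℕ.≤ n → c ≤ seq x n
  x≥c n N₀≤n = ≤-trans (≤-reflexive (sym (+-identityˡ c))) (x≥ n N₀≤n)

  inverse-cauchy : IsCauchy (λ n → recip (seq x n))
  inverse-cauchy ε 0<ε with cauchy x (ε * (c * c)) (*-pos 0<ε (*-pos 0<c 0<c))
  ... | N , close = N₀ ℕ.⊔ N , λ m n N≤m N≤n →
    let
      a = seq x m ; b = seq x n ; a′ = recip a ; b′ = recip b ; c′ = recip c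
      c≤a = x≥c m (ℕ.m⊔n≤o⇒m≤o N₀ N N≤m)
      c≤b = x≥c n (ℕ.m⊔n≤o⇒m≤o N₀ N N≤n)
      aa′ = recip-inverse (<-≤-trans 0<c c≤a)
      bb′ = recip-inverse (<-≤-trans 0<c c≤b)
      cc′ = recip-inverse 0<c
      0≤a′ = recip-pos (<-≤-trans 0<c c≤a)
      0≤b′ = recip-pos (<-≤-trans 0<c c≤b)
      0≤c′ = recip-pos 0<c
    in begin
    ∣ a′ - b′ ∣
      ≡⟨ cong ∣_∣ (cong₂ _-_ (*-identityˡ a′) (*-identityˡ b′)) ⟨
    ∣ 1ℚ * a′ - 1ℚ * b′ ∣
      ≡⟨ cong ∣_∣ (cong₂ (λ s t → s * a′ - t * b′) bb′ aa′) ⟨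
    ∣ (b * b′) * a′ - (a * a′) * b′ ∣
      ≡⟨ cong ∣_∣ (recip-difference a b a′ b′) ⟩
    ∣ (b - a) * (a′ * b′) ∣
      ≡⟨ ∣p*q∣≡∣p∣*∣q∣ (b - a) (a′ * b′) ⟩
    ∣ b - a ∣ * ∣ a′ * b′ ∣
      ≡⟨ cong (∣ b - a ∣ *_) (0≤p⇒∣p∣≡p (*-nonNeg 0≤a′ 0≤b′)) ⟩
    ∣ b - a ∣ * (a′ * b′)
      ≤⟨ *-mono-≤ (*-nonNeg 0≤a′ 0≤b′) (<⇒≤ (*-pos 0<ε (*-pos 0<c 0<c)))
           (close n m (ℕ.m⊔n≤o⇒n≤o N₀ N N≤n) (ℕ.m⊔n≤o⇒n≤o N₀ N N≤m))
           (*-mono-≤ 0≤b′ 0≤c′ (recip-antimono 0<c c≤a) (recip-antimono 0<c c≤b)) ⟩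
    ε * (c * c) * (c′ * c′)
      ≡⟨ square-cancel ε c c′ ⟩
    ε * ((c * c′) * (c * c′))
      ≡⟨ cong (λ s → ε * (s * s)) cc′ ⟩
    ε * (1ℚ * 1ℚ)
      ≡⟨ trans (cong (ε *_) (*-identityˡ 1ℚ)) (*-identityʳ ε) ⟩
    ε ∎
    where open ≤-Reasoning

-- The largest j ≤ b with P j, or 0 if there is none.
largest≤ : {P : ℕ → Set} → (∀ j → Dec (P j)) → ℕ → ℕ
largest≤ P? zero = zero
largest≤ P? (suc b) with P? (suc b)
... | yes _ = suc b
... | no  _ = largest≤ P? b

abstract
  largest≤-upper : ∀ {P : ℕ → Set} (P? : ∀ j → Dec (P j)) b →
                   ¬ P (suc b) → ¬ P (suc (largest≤ P? b))
  largest≤-upper P? zero    ¬p = ¬p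
  largest≤-upper P? (suc b) ¬p with P? (suc b)
  ... | yes _  = ¬p
  ... | no  ¬q = largest≤-upper P? b ¬q

  largest≤-holds : ∀ {P : ℕ → Set} (P? : ∀ j → Dec (P j)) b →
                   largest≤ P? b ≡ 0 ⊎ P (largest≤ P? b)
  largest≤-holds P? zero = inj₁ refl
  largest≤-holds P? (suc b) with P? (suc b)
  ... | yes p = inj₂ p
  ... | no  _ = largest≤-holds P? b

  largest≤-upper′ : ∀ (P : ℕ → Set) (P? : ∀ j → Dec (P j)) b j → j ≡ largest≤ P? b →
                    ¬ P (suc b) → ¬ P (suc j)
  largest≤-upper′ P P? b j refl = largest≤-upper P? b

  largest≤-holds′ : ∀ (P : ℕ → Set) (P? : ∀ j → Dec (P j)) b j → j ≡ largest≤ P? b →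
                    j ≡ 0 ⊎ P j
  largest≤-holds′ P P? b j refl = largest≤-holds P? b

  ^-nonNeg : ∀ {p} n → 0ℚ ≤ p → 0ℚ ≤ p ^ n
  ^-nonNeg zero    0≤p = <⇒≤ 0<1ℚ
  ^-nonNeg (suc n) 0≤p = *-nonNeg 0≤p (^-nonNeg n 0≤p)

  ^-pos : ∀ {p} n → 0ℚ < p → 0ℚ < p ^ n
  ^-pos zero    0<p = 0<1ℚ
  ^-pos (suc n) 0<p = *-pos 0<p (^-pos n 0<p)

  ^-mono : ∀ {p q} n → 0ℚ ≤ p → p ≤ q → p ^ n ≤ q ^ n
  ^-mono zero    0≤p p≤q = ≤-refl
  ^-mono (suc n) 0≤p p≤q = *-mono-≤ (^-nonNeg n 0≤p) (≤-trans 0≤p p≤q) p≤q (^-mono n 0≤p p≤q)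

  p≤p+q : ∀ p {q} → 0ℚ ≤ q → p ≤ p + q
  p≤p+q p 0≤q = ≤-trans (≤-reflexive (sym (+-identityʳ p))) (+-monoʳ-≤ p 0≤q)

  ^-superadditive : ∀ {p q} n → 0ℚ ≤ p → 0ℚ ≤ q → p ^ suc n + q ^ suc n ≤ (p + q) ^ suc n
  ^-superadditive {p} {q} n 0≤p 0≤q = begin
    p * p ^ n + q * q ^ n               ≤⟨ +-mono-≤
                                             (*-monoˡ-≤-nonNeg p {{nonNegative 0≤p}} (^-mono n 0≤p (p≤p+q p 0≤q)))
                                             (*-monoˡ-≤-nonNeg q {{nonNegative 0≤q}} (^-mono n 0≤q
                                               (≤-trans (p≤p+q q 0≤p) (≤-reflexive (+-comm q p))))) ⟩
    p * (p + q) ^ n + q * (p + q) ^ n   ≡⟨ *-distribʳ-+ ((p + q) ^ n) p q ⟨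
    (p + q) * (p + q) ^ n               ∎
    where open ≤-Reasoning

  1≤^ : ∀ {p} n → 1ℚ ≤ p → 1ℚ ≤ p ^ n
  1≤^ zero    1≤p = ≤-refl
  1≤^ {p} (suc n) 1≤p = ≤-trans (≤-reflexive (sym (*-identityˡ 1ℚ)))
    (*-mono-≤ (<⇒≤ 0<1ℚ) (≤-trans (<⇒≤ 0<1ℚ) 1≤p) 1≤p (1≤^ n 1≤p))

  p≤p^suc : ∀ {p} n → 1ℚ ≤ p → p ≤ p ^ suc n
  p≤p^suc {p} n 1≤p = ≤-trans (≤-reflexive (sym (*-identityʳ p)))
    (*-monoˡ-≤-nonNeg p {{nonNegative (≤-trans (<⇒≤ 0<1ℚ) 1≤p)}} (1≤^ n 1≤p))

  fromℕℚ-nonNeg : ∀ n → 0ℚ ≤ fromℕℚ n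
  fromℕℚ-nonNeg n = nonNegative⁻¹ (fromℕℚ n) {{normalize-nonNeg n 1}}

  fromℕℚ-* : ∀ m n → fromℕℚ (m ℕ.* n) ≡ fromℕℚ m * fromℕℚ n
  fromℕℚ-* m n = toℚᵘ-injective (begin
    toℚᵘ (fromℕℚ (m ℕ.* n))                 ≈⟨ toℚᵘ-/ (+ (m ℕ.* n)) 0 ⟩
    ℚᵘ.mkℚᵘ (+ (m ℕ.* n)) 0                 ≈⟨ ℚᵘ.*≡* (cong (ℤ._* + 1) (ℤ.pos-* m n)) ⟩
    ℚᵘ.mkℚᵘ (+ m) 0 ℚᵘ.* ℚᵘ.mkℚᵘ (+ n) 0    ≈⟨ ℚᵘ.*-cong (toℚᵘ-/ (+ m) 0) (toℚᵘ-/ (+ n) 0) ⟨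
    toℚᵘ (fromℕℚ m) ℚᵘ.* toℚᵘ (fromℕℚ n)    ≈⟨ toℚᵘ-homo-* (fromℕℚ m) (fromℕℚ n) ⟨
    toℚᵘ (fromℕℚ m * fromℕℚ n)              ∎)
    where open ℚᵘ.≃-Reasoning

  i≤+∣i∣ : ∀ i → i ℤ.≤ + ℤ.∣ i ∣
  i≤+∣i∣ (+ n)      = ℤ.≤-refl
  i≤+∣i∣ ℤ.-[1+ n ] = ℤ.-≤+

  below-∣↥∣ : ∀ q → q < fromℕℚ (suc ℤ.∣ ↥ q ∣)
  below-∣↥∣ q@record{} = toℚᵘ-cancel-< (begin-strict
    toℚᵘ q                           <⟨ ℚᵘ.*<* num< ⟩
    ℚᵘ.mkℚᵘ (+ suc ℤ.∣ ↥ q ∣) 0      ≃⟨ toℚᵘ-/ (+ suc ℤ.∣ ↥ q ∣) 0 ⟨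
    toℚᵘ (fromℕℚ (suc ℤ.∣ ↥ q ∣))    ∎)
    where
    open ℚᵘ.≤-Reasoning
    num< : ↥ q ℤ.* + 1 ℤ.< + suc ℤ.∣ ↥ q ∣ ℤ.* ↧ q
    num< = ℤ.<-≤-trans
      (ℤ.≤-<-trans (ℤ.≤-trans (ℤ.≤-reflexive (ℤ.*-identityʳ (↥ q))) (i≤+∣i∣ (↥ q)))
        (ℤ.<-≤-trans (ℤ.+<+ ℕ.≤-refl) (ℤ.≤-reflexive (sym (ℤ.*-identityʳ (+ suc ℤ.∣ ↥ q ∣))))))
      (ℤ.*-monoˡ-≤-nonNeg (+ suc ℤ.∣ ↥ q ∣) (ℤ.+≤+ (s≤s z≤n)))

  root-grid-close : ∀ r {a b s t g h ε} → 0ℚ ≤ t → 0ℚ ≤ g → 0ℚ < h →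
    s ≡ 0ℚ ⊎ s ^ suc r ≤ a → b < (t + g) ^ suc r → a ≤ b + h ^ suc r →
    g ≤ h → h + h ≡ ε → s ≤ t + ε
  root-grid-close r {a} {b} {s} {t} {g} {h} {ε} 0≤t 0≤g 0<h lower upper a≤b g≤h h+h≡ε with s ≤? t + ε
  ... | yes s≤t+ε = s≤t+ε
  ... | no  s≰t+ε = contradiction a<a (<-irrefl refl)
    where
    t+g≥0 : 0ℚ ≤ t + g
    t+g≥0 = +-nonNeg 0≤t 0≤g
    t+g+h≤t+ε : t + g + h ≤ t + ε
    t+g+h≤t+ε = ≤-trans (≤-reflexive (+-assoc t g h))
      (+-monoʳ-≤ t (≤-trans (+-monoˡ-≤ h g≤h) (≤-reflexive h+h≡ε)))
    t+g+h≤s : t + g + h ≤ s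
    t+g+h≤s = ≤-trans t+g+h≤t+ε (<⇒≤ (≰⇒> s≰t+ε))
    0<s : 0ℚ < s
    0<s = <-≤-trans (+-mono-≤-< t+g≥0 0<h) t+g+h≤s
    s^≤a : s ≡ 0ℚ ⊎ s ^ suc r ≤ a → s ^ suc r ≤ a
    s^≤a (inj₁ s≡0) = contradiction (sym s≡0) (<⇒≢ 0<s)
    s^≤a (inj₂ p)   = p
    open ≤-Reasoning
    a<a : a < a
    a<a = begin-strict
      a                             ≤⟨ a≤b ⟩
      b + h ^ suc r                 <⟨ +-monoˡ-< (h ^ suc r) upper ⟩
      (t + g) ^ suc r + h ^ suc r   ≤⟨ ^-superadditive r t+g≥0 (<⇒≤ 0<h) ⟩
      (t + g + h) ^ suc r           ≤⟨ ^-mono (suc r) (+-nonNeg t+g≥0 (<⇒≤ 0<h)) t+g+h≤s ⟩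
      s ^ suc r                     ≤⟨ s^≤a lower ⟩
      a                             ∎

rootBelow? : ∀ r a k j → Dec ((fromℕℚ j * 1/suc k) ^ r ≤ a)
rootBelow? r a k j = (fromℕℚ j * 1/suc k) ^ r ≤? a

-- For r ≥ 1 and a ≥ 0, the largest j with (j / (k+1)) ^ r ≤ a.  The search
-- bound is harmless: (|numerator a| + 1) ^ r already exceeds a.
rootNumerator : ℕ → ℚ → ℕ → ℕ
rootNumerator r a k = largest≤ (rootBelow? r a k) (suc ℤ.∣ ↥ a ∣ ℕ.* suc k)

abstract
  grid-zero : ∀ {x} y → x ≡ 0ℚ → x * y ≡ 0ℚ
  grid-zero y x≡0 = trans (cong (_* y) x≡0) (*-zeroˡ y)

  grid-suc : ∀ {x x′} y → x′ ≡ x + 1ℚ → x′ * y ≡ x * y + y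
  grid-suc {x} {x′} y e = trans (cong (_* y) e)
    (trans (*-distribʳ-+ y x 1ℚ) (cong (_+_ (x * y)) (*-identityˡ y)))

  grid-* : ∀ {x y z w} → w ≡ x * y → y * z ≡ 1ℚ → w * z ≡ x
  grid-* {x} {y} {z} e f = trans (cong (_* z) e)
    (trans (*-assoc x y z) (trans (cong (_*_ x) f) (*-identityʳ x)))

  rootApprox-nonNeg : ∀ r a k → 0ℚ ≤ fromℕℚ (rootNumerator r a k) * 1/suc k
  rootApprox-nonNeg r a k = *-nonNeg {fromℕℚ (rootNumerator r a k)} {1/suc k} (fromℕℚ-nonNeg (rootNumerator r a k)) (0≤1/suc k)

  rootApprox-lower : ∀ r a k → fromℕℚ (rootNumerator r a k) * 1/suc k ≡ 0ℚ ⊎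
                               (fromℕℚ (rootNumerator r a k) * 1/suc k) ^ r ≤ a
  rootApprox-lower r a k = Sum.map₁ (λ e → grid-zero {fromℕℚ (rootNumerator r a k)} (1/suc k) (cong fromℕℚ e))
    (largest≤-holds′ (λ j → (fromℕℚ j * 1/suc k) ^ r ≤ a) (rootBelow? r a k)
      (suc ℤ.∣ ↥ a ∣ ℕ.* suc k) (rootNumerator r a k) refl)

  large-power : ∀ {a M x w y z} r → a < M → 1ℚ ≤ M → 0ℚ ≤ M → 0ℚ ≤ z →
                x ≡ w + 1ℚ → w ≡ M * y → y * z ≡ 1ℚ → ¬ (x * z) ^ suc r ≤ a
  large-power {a} {M} {x} {w} {y} {z} r a<M 1≤M 0≤M 0≤z e₁ e₂ e₃ le = <-irrefl refl (<-≤-trans a<M (begin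
    M                  ≤⟨ p≤p^suc r 1≤M ⟩
    M ^ suc r          ≤⟨ ^-mono (suc r) 0≤M (p≤p+q M 0≤z) ⟩
    (M + z) ^ suc r    ≡⟨ cong (_^ suc r) (trans (grid-suc {w} {x} z e₁) (cong (_+ z) (grid-* {M} {y} {z} {w} e₂ e₃))) ⟨
    (x * z) ^ suc r    ≤⟨ le ⟩
    a                  ∎))
    where open ≤-Reasoning

  1≤fromℕℚ-suc : ∀ n → 1ℚ ≤ fromℕℚ (suc n)
  1≤fromℕℚ-suc n = ≤-trans (+-monoˡ-≤ 1ℚ (fromℕℚ-nonNeg n)) (≤-reflexive (sym (fromℕℚ-suc n)))

  rootBound : ∀ r a k → ¬ (fromℕℚ (suc (suc ℤ.∣ ↥ a ∣ ℕ.* suc k)) * 1/suc k) ^ suc r ≤ a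
  rootBound r a k = large-power
    {a} {fromℕℚ (suc ℤ.∣ ↥ a ∣)} {fromℕℚ (suc (suc ℤ.∣ ↥ a ∣ ℕ.* suc k))}
    {fromℕℚ (suc ℤ.∣ ↥ a ∣ ℕ.* suc k)} {fromℕℚ (suc k)} {1/suc k} r (below-∣↥∣ a) (1≤fromℕℚ-suc ℤ.∣ ↥ a ∣)
    (fromℕℚ-nonNeg (suc ℤ.∣ ↥ a ∣)) (0≤1/suc k)
    (fromℕℚ-suc (suc ℤ.∣ ↥ a ∣ ℕ.* suc k)) (fromℕℚ-* (suc ℤ.∣ ↥ a ∣) (suc k)) (1/suc-inverse k)

  rootApprox-upper : ∀ r a k → a < (fromℕℚ (rootNumerator (suc r) a k) * 1/suc k + 1/suc k) ^ suc r
  rootApprox-upper r a k = subst (λ q → a < q ^ suc r)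
    (grid-suc {fromℕℚ (rootNumerator (suc r) a k)} {fromℕℚ (suc (rootNumerator (suc r) a k))} (1/suc k) (fromℕℚ-suc (rootNumerator (suc r) a k)))
    (≰⇒> {(fromℕℚ (suc (rootNumerator (suc r) a k)) * 1/suc k) ^ suc r} {a} (largest≤-upper′ (λ j → (fromℕℚ j * 1/suc k) ^ suc r ≤ a) (rootBelow? (suc r) a k)
      (suc ℤ.∣ ↥ a ∣ ℕ.* suc k) (rootNumerator (suc r) a k) refl (rootBound r a k)))

  root-cauchy : ∀ r {a s : ℕ → ℚ} → IsCauchy a → (∀ k → 0ℚ ≤ s k) →
                (∀ k → s k ≡ 0ℚ ⊎ s k ^ suc r ≤ a k) → (∀ k → a k < (s k + 1/suc k) ^ suc r) → IsCauchy s
  root-cauchy r {a} {s} a-cauchy s≥0 lower upper ε 0<ε with halve 0<ε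
  ... | h , 0<h , h+h≡ε with a-cauchy (h ^ suc r) (^-pos (suc r) 0<h) | archimedean 0<h
  ... | N₁ , close | N₂ , 1/N₂≤h = N₁ ℕ.⊔ N₂ , λ m n N≤m N≤n →
      ∣-∣-≤ (step m n N≤m N≤n) (step n m N≤n N≤m)
    where
    step : ∀ m n → N₁ ℕ.⊔ N₂ ℕ.≤ m → N₁ ℕ.⊔ N₂ ℕ.≤ n → s m ≤ s n + ε
    step m n N≤m N≤n = root-grid-close r (s≥0 n) (0≤1/suc n) 0<h (lower m) (upper n)
      (≤-∣-∣ (close m n (ℕ.m⊔n≤o⇒m≤o N₁ N₂ N≤m) (ℕ.m⊔n≤o⇒m≤o N₁ N₂ N≤n)))
      (≤-trans (1/suc-antimono (ℕ.m⊔n≤o⇒n≤o N₁ N₂ N≤n)) 1/N₂≤h) h+h≡ε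

-- root r x is the r-th root of x for r ≥ 1 and x ≥ 0: its k-th term is the
-- largest multiple of 1/(k+1) whose r-th power is at most the k-th term of x.
-- Negative x give 0, and root 0 is a dummy value.
root : ℕ → ℝ → ℝ
root zero    x = 0ℝ
root (suc r) x = record
  { seq    = λ k → fromℕℚ (rootNumerator (suc r) (seq x k) k) * 1/suc k
  ; cauchy = root-cauchy r {seq x} {λ k → fromℕℚ (rootNumerator (suc r) (seq x k) k) * 1/suc k} (cauchy x)
      (λ k → rootApprox-nonNeg (suc r) (seq x k) k)
      (λ k → rootApprox-lower (suc r) (seq x k) k)
      (λ k → rootApprox-upper r (seq x k) k)
  }

-- x to the rational power p / q, for x ≥ 0 and q ≥ 1.
infixr 8 _^ℝ[_/_]
_^ℝ[_/_] : ℝ → ℕ → ℕ → ℝ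
x ^ℝ[ p / q ] = root q (x ^ℝ p)

-- ∑ m f = f 0 + … + f (m - 1).
∑ : ℕ → (ℕ → ℚ) → ℚ
∑ zero    f = 0ℚ
∑ (suc m) f = ∑ m f + f m

-- With K = k + 1, this is 1/(K+1) + 1/(K+2) + … + 1/(nK) for n ≥ 1: the lower
-- Riemann sum of ∫₁ⁿ dt/t for the partition into intervals of length 1/K.
lnApprox : ℕ → ℕ → ℚ
lnApprox n k = ∑ ((n ℕ.∸ 1) ℕ.* suc k) (λ i → 1/suc (suc k ℕ.+ i))

abstract
  ∑-mono : ∀ m {f g} → (∀ i → i ℕ.< m → f i ≤ g i) → ∑ m f ≤ ∑ m g
  ∑-mono zero    f≤g = ≤-refl
  ∑-mono (suc m) f≤g = +-mono-≤ (∑-mono m λ i i<m → f≤g i (ℕ.m<n⇒m<1+n i<m)) (f≤g m ℕ.≤-refl)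

  ∑-cong : ∀ m {f g} → (∀ i → f i ≡ g i) → ∑ m f ≡ ∑ m g
  ∑-cong zero    f≡g = refl
  ∑-cong (suc m) f≡g = cong₂ _+_ (∑-cong m f≡g) (f≡g m)

  ∑-const : ∀ m c → ∑ m (λ _ → c) ≡ fromℕℚ m * c
  ∑-const zero    c = sym (*-zeroˡ c)
  ∑-const (suc m) c = begin
    ∑ m (λ _ → c) + c      ≡⟨ cong₂ _+_ (∑-const m c) (sym (*-identityˡ c)) ⟩
    fromℕℚ m * c + 1ℚ * c  ≡⟨ *-distribʳ-+ c (fromℕℚ m) 1ℚ ⟨
    (fromℕℚ m + 1ℚ) * c    ≡⟨ cong (_* c) (fromℕℚ-suc m) ⟨
    fromℕℚ (suc m) * c     ∎
    where open ≡-Reasoning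

  ∑-+ : ∀ a b f → ∑ (a ℕ.+ b) f ≡ ∑ a f + ∑ b (λ i → f (a ℕ.+ i))
  ∑-+ a zero    f = trans (cong (λ m → ∑ m f) (ℕ.+-identityʳ a)) (sym (+-identityʳ (∑ a f)))
  ∑-+ a (suc b) f = begin
    ∑ (a ℕ.+ suc b) f                                    ≡⟨ cong (λ m → ∑ m f) (ℕ.+-suc a b) ⟩
    ∑ (a ℕ.+ b) f + f (a ℕ.+ b)                          ≡⟨ cong (_+ f (a ℕ.+ b)) (∑-+ a b f) ⟩
    ∑ a f + ∑ b (λ i → f (a ℕ.+ i)) + f (a ℕ.+ b)        ≡⟨ +-assoc (∑ a f) _ _ ⟩
    ∑ a f + (∑ b (λ i → f (a ℕ.+ i)) + f (a ℕ.+ b))      ∎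
    where open ≡-Reasoning

  ∑-* : ∀ a b f → ∑ (a ℕ.* b) f ≡ ∑ a (λ i → ∑ b (λ t → f (i ℕ.* b ℕ.+ t)))
  ∑-* zero    b f = refl
  ∑-* (suc a) b f = begin
    ∑ (b ℕ.+ a ℕ.* b) f                                   ≡⟨ cong (λ m → ∑ m f) (ℕ.+-comm b (a ℕ.* b)) ⟩
    ∑ (a ℕ.* b ℕ.+ b) f                                   ≡⟨ ∑-+ (a ℕ.* b) b f ⟩
    ∑ (a ℕ.* b) f + ∑ b (λ t → f (a ℕ.* b ℕ.+ t))         ≡⟨ cong (_+ ∑ b (λ t → f (a ℕ.* b ℕ.+ t))) (∑-* a b f) ⟩
    ∑ (suc a) (λ i → ∑ b (λ t → f (i ℕ.* b ℕ.+ t)))       ∎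
    where open ≡-Reasoning

  ∑-shift : ∀ m f → f 0 + ∑ m (f ∘ suc) ≡ ∑ (suc m) f
  ∑-shift m f = sym (trans (∑-+ 1 m f) (cong (_+ ∑ m (f ∘ suc)) (+-identityˡ (f 0))))

  1/suc-*-fromℕℚ : ∀ a k → fromℕℚ (suc k) * 1/suc (k ℕ.+ a ℕ.* suc k) ≡ 1/suc a
  1/suc-*-fromℕℚ a k = begin
    fromℕℚ (suc k) * 1/suc (k ℕ.+ a ℕ.* suc k)   ≡⟨ cong (_*_ (fromℕℚ (suc k))) (1/suc-* a k) ⟨
    fromℕℚ (suc k) * (1/suc a * 1/suc k)         ≡⟨ regroupˡ (fromℕℚ (suc k)) (1/suc a) (1/suc k) ⟩
    1/suc a * (fromℕℚ (suc k) * 1/suc k)         ≡⟨ cong (_*_ (1/suc a)) (1/suc-inverse k) ⟩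
    1/suc a * 1ℚ                                 ≡⟨ *-identityʳ (1/suc a) ⟩
    1/suc a                                      ∎
    where open ≡-Reasoning

  block-lower : ∀ a k → 1/suc (suc a) ≤ ∑ (suc k) (λ t → 1/suc (suc a ℕ.* suc k ℕ.+ t))
  block-lower a k = ≤-trans
    (≤-reflexive (trans (sym (1/suc-*-fromℕℚ (suc a) k)) (sym (∑-const (suc k) _))))
    (∑-mono (suc k) λ { t (s≤s t≤k) → 1/suc-antimono
      (ℕ.≤-trans (ℕ.+-monoʳ-≤ (suc a ℕ.* suc k) t≤k) (ℕ.≤-reflexive (ℕ.+-comm (suc a ℕ.* suc k) k))) })

  block-upper : ∀ a k → ∑ (suc k) (λ t → 1/suc (suc a ℕ.* suc k ℕ.+ t)) ≤ 1/suc a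
  block-upper a k = ≤-trans
    (∑-mono (suc k) λ t _ → 1/suc-antimono (ℕ.≤-trans (ℕ.n≤1+n _) (ℕ.m≤m+n (suc a ℕ.* suc k) t)))
    (≤-reflexive (trans (∑-const (suc k) _) (1/suc-*-fromℕℚ a k)))

  refine : ∀ m j k → ∑ (m ℕ.* (suc j ℕ.* suc k)) (λ i → 1/suc (suc j ℕ.* suc k ℕ.+ i)) ≡
                     ∑ (m ℕ.* suc j) (λ i → ∑ (suc k) (λ t → 1/suc (suc (j ℕ.+ i) ℕ.* suc k ℕ.+ t)))
  refine m j k = begin
    ∑ (m ℕ.* (suc j ℕ.* suc k)) F                                                    ≡⟨ cong (λ l → ∑ l F) (ℕ.*-assoc m (suc j) (suc k)) ⟨
    ∑ (m ℕ.* suc j ℕ.* suc k) F                                                      ≡⟨ ∑-* (m ℕ.* suc j) (suc k) F ⟩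
    ∑ (m ℕ.* suc j) (λ i → ∑ (suc k) (λ t → F (i ℕ.* suc k ℕ.+ t)))                  ≡⟨ ∑-cong (m ℕ.* suc j) (λ i → ∑-cong (suc k) (λ t → cong 1/suc (index i t))) ⟩
    ∑ (m ℕ.* suc j) (λ i → ∑ (suc k) (λ t → 1/suc (suc (j ℕ.+ i) ℕ.* suc k ℕ.+ t)))  ∎
    where
    open ≡-Reasoning
    F : ℕ → ℚ
    F i = 1/suc (suc j ℕ.* suc k ℕ.+ i)
    index : ∀ i t → suc j ℕ.* suc k ℕ.+ (i ℕ.* suc k ℕ.+ t) ≡ suc (j ℕ.+ i) ℕ.* suc k ℕ.+ t
    index i t = trans (sym (ℕ.+-assoc (suc j ℕ.* suc k) _ t))
      (cong (ℕ._+ t) (sym (ℕ.*-distribʳ-+ (suc k) (suc j) i)))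

  refine-lower : ∀ n j k → lnApprox n j ≤ lnApprox n (k ℕ.+ j ℕ.* suc k)
  refine-lower n j k = ≤-trans (∑-mono ((n ℕ.∸ 1) ℕ.* suc j) (λ i _ → block-lower (j ℕ.+ i) k))
    (≤-reflexive (sym (refine (n ℕ.∸ 1) j k)))

  refine-upper : ∀ n j k → lnApprox n (k ℕ.+ j ℕ.* suc k) ≤ lnApprox n j + 1/suc j
  refine-upper n j k = begin
    lnApprox n (k ℕ.+ j ℕ.* suc k)                  ≡⟨ refine (n ℕ.∸ 1) j k ⟩
    ∑ M (λ i → ∑ (suc k) (λ t → 1/suc (suc (j ℕ.+ i) ℕ.* suc k ℕ.+ t)))
                                                    ≤⟨ ∑-mono M (λ i _ → block-upper (j ℕ.+ i) k) ⟩
    ∑ M (λ i → 1/suc (j ℕ.+ i))                     ≤⟨ p≤p+q _ (0≤1/suc (j ℕ.+ M)) ⟩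
    ∑ (suc M) (λ i → 1/suc (j ℕ.+ i))               ≡⟨ ∑-shift M (λ i → 1/suc (j ℕ.+ i)) ⟨
    1/suc (j ℕ.+ 0) + ∑ M (λ i → 1/suc (j ℕ.+ suc i))
                                                    ≡⟨ cong₂ _+_ (cong 1/suc (ℕ.+-identityʳ j)) (∑-cong M (λ i → cong 1/suc (ℕ.+-suc j i))) ⟩
    1/suc j + lnApprox n j                          ≡⟨ +-comm (1/suc j) (lnApprox n j) ⟩
    lnApprox n j + 1/suc j                          ∎
    where
    open ≤-Reasoning
    M : ℕ
    M = (n ℕ.∸ 1) ℕ.* suc j

  lnApprox-close : ∀ n j k → lnApprox n j ≤ lnApprox n k + 1/suc k
  lnApprox-close n j k = begin
    lnApprox n j                      ≤⟨ refine-lower n j k ⟩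
    lnApprox n (k ℕ.+ j ℕ.* suc k)    ≡⟨ cong (λ l → lnApprox n (ℕ.pred l)) (ℕ.*-comm (suc j) (suc k)) ⟩
    lnApprox n (j ℕ.+ k ℕ.* suc j)    ≤⟨ refine-upper n k j ⟩
    lnApprox n k + 1/suc k            ∎
    where open ≤-Reasoning

  ln-cauchy : ∀ {s : ℕ → ℚ} → (∀ j k → s j ≤ s k + 1/suc k) → IsCauchy s
  ln-cauchy {s} close ε 0<ε with archimedean 0<ε
  ... | N , 1/N≤ε = N , λ j k N≤j N≤k → ∣-∣-≤
    (≤-trans (close j k) (+-monoʳ-≤ (s k) (≤-trans (1/suc-antimono N≤k) 1/N≤ε)))
    (≤-trans (close k j) (+-monoʳ-≤ (s j) (≤-trans (1/suc-antimono N≤j) 1/N≤ε)))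

-- ln n = ∫₁ⁿ dt/t, for n ≥ 1.
ln : ℕ → ℝ
ln n = record { seq = lnApprox n ; cauchy = ln-cauchy {lnApprox n} (lnApprox-close n) }

abstract
  ln-positive : ∀ {n} → 1 ℕ.< n → 0ℝ <ℝ ln n
  ln-positive {suc zero} (s≤s ())
  ln-positive {suc (suc m)} _ = 1/suc 1 , 0<1/suc 1 , 0 , λ k _ → begin
    0ℚ + 1/suc 1                         ≤⟨ +-monoˡ-≤ (1/suc 1) (0≤∑ (m ℕ.* 1)) ⟩
    ∑ (m ℕ.* 1) (λ i → 1/suc (2 ℕ.+ i)) + 1/suc 1
                                         ≡⟨ +-comm (∑ (m ℕ.* 1) (λ i → 1/suc (2 ℕ.+ i))) (1/suc 1) ⟩
    1/suc 1 + ∑ (m ℕ.* 1) (λ i → 1/suc (2 ℕ.+ i))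
                                         ≡⟨ ∑-shift (m ℕ.* 1) (λ i → 1/suc (1 ℕ.+ i)) ⟩
    lnApprox (2 ℕ.+ m) 0                 ≤⟨ refine-lower (2 ℕ.+ m) 0 k ⟩
    lnApprox (2 ℕ.+ m) (k ℕ.+ 0)         ≡⟨ cong (lnApprox (2 ℕ.+ m)) (ℕ.+-identityʳ k) ⟩
    lnApprox (2 ℕ.+ m) k                 ∎
    where
    open ≤-Reasoning
    0≤∑ : ∀ l → 0ℚ ≤ ∑ l (λ i → 1/suc (2 ℕ.+ i))
    0≤∑ zero    = ≤-refl
    0≤∑ (suc l) = +-nonNeg (0≤∑ l) (0≤1/suc (2 ℕ.+ l))

module Submission where

-- Place the vertices independently and uniformly at M positions and order them by
-- position.  A chain is a sequence of edges in which the last vertex of each edge is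
-- the first vertex of the next one.  Colour a vertex by the length of the longest chain
-- that starts at it: the first vertex of an edge then gets a larger colour than its
-- last vertex, so the colouring is proper, and r colours suffice if no chain has
-- r edges.
--
-- Call an edge short if its positions span less than about (1 - j/n) M/r, where
-- j = Θ(ln n).  An edge is short with probability at most M r⁻ⁿ 2⁻ʲ.  If no edge is
-- short, the i-th shared vertex of a chain of r edges lies in a window of length
-- (j/n) M, and by AM-GM such a chain occurs with probability O((j/n)ʳ⁻¹ r⁻ʳⁿ).  An edge
-- lies in at most r dʳ⁻¹ sequences of r consecutively intersecting edges, so the local
-- lemma, applied edge by edge, avoids all short edges and all chains of length r as
-- soon as dʳ (j/n)ʳ⁻¹ is small compared to rʳⁿ.

import Algebra.Definitions.RawSemiring as RawSemiring
import Data.Bool.Properties as Bool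
open import Data.Fin.Base using (Fin; zero; suc; toℕ; fromℕ<; combine)
open import Data.Fin.Properties using (toℕ<n; toℕ-fromℕ<; toℕ-injective; combine-injectiveʳ; combine-monoˡ-<)
import Data.Fin.Properties as Fin
open import Data.Fin.Subset using (Subset; inside; outside; _∈_; _∉_; _⊆_; _∩_; _─_; ⁅_⁆; Nonempty) renaming (∣_∣ to size)
open import Data.Fin.Subset.Properties using (nonempty?; x∈p∩q⁺; x∈p∩q⁻; _∈?_; p─q⊆p; p⊆q⇒∣p∣≤∣q∣; Empty-unique; ∣⊥∣≡0; ∩-comm; x∈⁅x⁆; x∈⁅y⁆⇒x≡y; ∣⁅x⁆∣≡1)
open import Data.List.Base using (List; []; _∷_; _++_; _ʳ++_; map; length; filter; concatMap; cartesianProductWith; upTo; allFin)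
open import Data.List.Extrema.Nat using (argmin; argmax; argmin-all; argmax-all; f[argmin]≤f[xs]; f[xs]≤f[argmax])
open import Data.List.Membership.Propositional using (find; lose) renaming (_∈_ to _∈ₗ_)
open import Data.List.Membership.Propositional.Properties using (∈-++⁺ʳ; ∈-allFin; ∈-filter⁺; ∈-filter⁻; ∈-map⁺; ∈-map⁻; ∈-upTo⁺; ∈-upTo⁻; ∈-concatMap⁺; ∈-concatMap⁻; ∈-cartesianProductWith⁺; ∈-cartesianProductWith⁻)
open import Data.List.Properties using (length-++; length-map; length-upTo; length-ʳ++; filter-none)
open import Data.List.Relation.Binary.Permutation.Propositional using (_↭_; prep; ↭-sym; ↭-trans; ↭-refl)
open import Data.List.Relation.Binary.Permutation.Propositional.Properties using (filter-↭; ↭-length; ∈-resp-↭; shift)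
open import Data.List.Relation.Unary.All as All using (All; []; _∷_; all?)
open import Data.List.Relation.Unary.All.Properties using (all-filter)
open import Data.List.Relation.Unary.AllPairs using ([]; _∷_)
open import Data.List.Relation.Unary.Any as Any using (Any; here; there; any?)
open import Data.List.Relation.Unary.Unique.Propositional using (Unique)
open import Data.Nat
open import Data.Nat.ListAction using (sum)
open import Data.Nat.Properties
open import Data.Nat.Solver using (module +-*-Solver)
open import Data.Product using (∃; ∃₂; ∃-syntax; _×_; _,_; proj₁; proj₂)
open import Data.Rational using (ℚ; 0ℚ; 1ℚ)
import Data.Rational as ℚ
import Data.Rational.Properties as ℚ
open import Data.Rational.Solver renaming (module +-*-Solver to ℚ-Solver)
open import Data.Sum.Base using (_⊎_; inj₁; inj₂; swap; [_,_]′)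
open import Data.Unit.Base using (⊤; tt)
open import Data.Vec.Base using (Vec; []; _∷_; lookup; here; there)
import Data.Vec.Properties as Vec
open import Function.Base using (_∘_; id)
open import Level using (0ℓ)
open import Relation.Binary.Definitions using (DecidableEquality)
open import Relation.Binary.PropositionalEquality
open import Relation.Nullary using (¬_; Dec; yes; no; contradiction; ¬?; _×-dec_; _→-dec_)
open import Relation.Nullary.Decidable using (map′)
open import Relation.Unary using (Pred; Decidable)
open import Defs using
  ( order; edges; unique; degree; EnsuresColorable; IsD; total; total-const; total≡0
  ; ℝ; 0ℝ; _<ℝ_; _≤ℝ_; _*ℝ_; _^ℝ_; _^ℝ[_/_]; fromℚ; fromℕ; inverse; ln; ln-positive; seq; recip
  ; fromℕℚ; 1/suc; fromℕℚ-suc; fromℕℚ-*; fromℕℚ-nonNeg; 1≤fromℕℚ-suc; 1/suc-inverse; 1/suc-antimono; 0<1/suc; 0≤1/suc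
  ; 0<1ℚ; *-pos; *-nonNeg; +-nonNeg; p≤p+q; ^-nonNeg; ^-pos; ^-mono; recip-inverse; recip-pos
  ; largest≤; largest≤-holds; rootNumerator; rootApprox-lower
  ; ∑; ∑-+; ∑-const; ∑-mono; 1/suc-*-fromℕℚ; lnApprox; refine-lower )

open +-*-Solver using (solve; _:=_; _:+_; _:*_; con)
open ℚ-Solver using () renaming (solve to solveℚ; _:*_ to _⊗_; _:=_ to _⊜_)
open RawSemiring ℚ.+-*-rawSemiring using () renaming (_^_ to _^ℚ_)

-- Probabilities are counts: an event is a function from placements to ℕ, its probability is its
-- `mass` divided by `M ^ m`, and every estimate is cleared of denominators. Such a function may
-- count witnesses, so that the union bound over them is part of its mass.
--
-- The obstacle is that edges may overlap arbitrarily, whereas the bound for a chain multiplies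
-- independent events. The order of the positions removes it: in a chain, consecutive edges share
-- only their joint and all other pairs are disjoint, so only lists with this pattern have to be
-- obstructions.
--
-- An inner edge of a chain keeps n - 2 unshared vertices. All edges are therefore estimated with
-- the exponent h = n - 2, which costs only the constant factor r^(2r).
--
-- The choice of j balances two effects: a larger j makes short edges rarer but widens the windows
-- for the joints. The chain condition alone already forces d ≤ n rⁿ, so 2ʲ ≥ n³ is enough for the
-- short edges once n is large. This is where the logarithm comes from, while the factor (j/n)ʳ⁻¹
-- for the r - 1 joints is the whole gain over a bound of order rⁿ.

private variable
  m M : ℕ

-- Powers of natural numbers

^-distribʳ-* : ∀ n x y → (x * y) ^ n ≡ x ^ n * y ^ n
^-distribʳ-* zero    x y = refl
^-distribʳ-* (suc n) x y = trans (cong (x * y *_) (^-distribʳ-* n x y))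
  (solve 4 (λ x y a b → x :* y :* (a :* b) := x :* a :* (y :* b)) refl x y (x ^ n) (y ^ n))

2xy≤x²+y² : ∀ x y → 2 * (x * y) ≤ x * x + y * y
2xy≤x²+y² x y with ≤-total x y
... | inj₁ x≤y with m≤n⇒∃[o]m+o≡n x≤y
...   | c , refl = ≤-trans (m≤m+n _ (c * c)) (≤-reflexive
  (solve 2 (λ x c → con 2 :* (x :* (x :+ c)) :+ c :* c := x :* x :+ (x :+ c) :* (x :+ c)) refl x c))
2xy≤x²+y² x y | inj₂ y≤x with m≤n⇒∃[o]m+o≡n y≤x
...   | c , refl = ≤-trans (m≤m+n _ (c * c)) (≤-reflexive
  (solve 2 (λ y c → con 2 :* ((y :+ c) :* y) :+ c :* c := (y :+ c) :* (y :+ c) :+ y :* y) refl y c))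

-- In the induction step the hypothesis is multiplied by `x`, and `2xy≤x²+y²` supplies the rest. The
-- term that one would subtract is added to both sides, so that everything stays in ℕ.
weighted-AM-GM : ∀ k x y → suc k * (x * y ^ k) ≤ x ^ suc k + k * y ^ suc k
weighted-AM-GM zero x y = ≤-reflexive (solve 1 (λ x → con 1 :* (x :* con 1) := x :* con 1 :+ con 0) refl x)
weighted-AM-GM (suc k) x y = +-cancelʳ-≤ (k * (x * (y * Y))) _ _ (begin
  suc (suc k) * (x * (y * Y)) + k * (x * (y * Y))
    ≡⟨ solve 4 (λ k x y Y → (con 2 :+ k) :* (x :* (y :* Y)) :+ k :* (x :* (y :* Y)) :=
                            (con 1 :+ k) :* Y :* (con 2 :* (x :* y))) refl k x y Y ⟩
  suc k * Y * (2 * (x * y))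
    ≤⟨ *-monoʳ-≤ (suc k * Y) (2xy≤x²+y² x y) ⟩
  suc k * Y * (x * x + y * y)
    ≡⟨ solve 4 (λ k x y Y → (con 1 :+ k) :* Y :* (x :* x :+ y :* y) :=
                            x :* ((con 1 :+ k) :* (x :* Y)) :+ (con 1 :+ k) :* (y :* (y :* Y))) refl k x y Y ⟩
  x * (suc k * (x * Y)) + suc k * (y * (y * Y))
    ≤⟨ +-monoˡ-≤ _ (*-monoʳ-≤ x (weighted-AM-GM k x y)) ⟩
  x * (x ^ suc k + k * (y * Y)) + suc k * (y * (y * Y))
    ≡⟨ solve 5 (λ k x y Y X → x :* (X :+ k :* (y :* Y)) :+ (con 1 :+ k) :* (y :* (y :* Y)) :=
                              x :* X :+ (con 1 :+ k) :* (y :* (y :* Y)) :+ k :* (x :* (y :* Y))) refl k x y Y (x ^ suc k) ⟩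
  x ^ suc (suc k) + suc k * y ^ suc (suc k) + k * (x * (y * Y)) ∎)
  where
  open ≤-Reasoning
  Y : ℕ
  Y = y ^ k

-- (S/K)ᴷ a ≤ ((a + S)/(K + 1))ᴷ⁺¹, cleared of denominators.
AM-GM-step : ∀ k S a → let K = suc k in suc K ^ suc K * (a * S ^ K) ≤ K ^ K * (a + S) ^ suc K
AM-GM-step k S a = *-cancelˡ-≤ K (+-cancelʳ-≤ (K * Y ^ suc K) _ _ (begin
  K * (suc K ^ suc K * (a * S ^ K)) + K * Y ^ suc K
    ≡⟨ cong (λ z → K * (suc K ^ suc K * (a * S ^ K)) + K * (Y * z)) (^-distribʳ-* K (suc K) S) ⟩
  K * (suc K ^ suc K * (a * S ^ K)) + K * (Y * (suc K ^ K * S ^ K))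
    ≡⟨ solve 5 (λ k S a p s → (con 1 :+ k) :* ((con 2 :+ k) :* p :* (a :* s)) :+ (con 1 :+ k) :* ((con 2 :+ k) :* S :* (p :* s)) :=
                              (con 2 :+ k) :* ((con 1 :+ k) :* (a :+ S) :* (p :* s))) refl k S a (suc K ^ K) (S ^ K) ⟩
  suc K * (X * (suc K ^ K * S ^ K))
    ≡⟨ cong (λ z → suc K * (X * z)) (^-distribʳ-* K (suc K) S) ⟨
  suc K * (X * Y ^ K)
    ≤⟨ weighted-AM-GM K X Y ⟩
  X ^ suc K + K * Y ^ suc K
    ≡⟨ cong (_+ K * Y ^ suc K) (^-distribʳ-* (suc K) K (a + S)) ⟩
  K ^ suc K * (a + S) ^ suc K + K * Y ^ suc K
    ≡⟨ cong (_+ K * Y ^ suc K) (*-assoc K (K ^ K) _) ⟩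
  K * (K ^ K * (a + S) ^ suc K) + K * Y ^ suc K ∎))
  where
  open ≤-Reasoning
  K X Y : ℕ
  K = suc k
  -- Divided by K (K + 1), these are the two means (a + S)/(K + 1) and S/K.
  X = K * (a + S)
  Y = suc K * S

bernoulli : ∀ m n → m ^ n * (m + n) ≤ m * suc m ^ n
bernoulli m zero = ≤-reflexive (solve 1 (λ m → con 1 :* (m :+ con 0) := m :* con 1) refl m)
bernoulli m (suc n) = begin
  m * m ^ n * (m + suc n)              ≤⟨ m≤m+n _ (m ^ n * n) ⟩
  m * m ^ n * (m + suc n) + m ^ n * n  ≡⟨ solve 3 (λ m n p → m :* p :* (m :+ (con 1 :+ n)) :+ p :* n := (con 1 :+ m) :* (p :* (m :+ n))) refl m n (m ^ n) ⟩
  suc m * (m ^ n * (m + n))            ≤⟨ *-monoʳ-≤ (suc m) (bernoulli m n) ⟩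
  suc m * (m * suc m ^ n)              ≡⟨ solve 2 (λ m p → (con 1 :+ m) :* (m :* p) := m :* ((con 1 :+ m) :* p)) refl m (suc m ^ n) ⟩
  m * (suc m * suc m ^ n)              ∎
  where open ≤-Reasoning

double-^ : ∀ m n → m ≤ suc n → 2 * m ^ suc n ≤ suc m ^ suc n
double-^ zero n _ = z≤n
double-^ m@(suc _) n m≤n = *-cancelˡ-≤ m (begin
  m * (2 * m ^ suc n)         ≡⟨ solve 2 (λ m p → m :* (con 2 :* p) := p :* (m :+ m)) refl m (m ^ suc n) ⟩
  m ^ suc n * (m + m)         ≤⟨ *-monoʳ-≤ (m ^ suc n) (+-monoʳ-≤ m m≤n) ⟩
  m ^ suc n * (m + suc n)     ≤⟨ bernoulli m (suc n) ⟩
  m * suc m ^ suc n           ∎)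
  where open ≤-Reasoning

-- By Bernoulli's inequality, lowering a base that is at most `n` by one at least halves its n-th
-- power; j such steps lead from n to n - j. This is the source of the factor 2⁻ʲ for short edges.
halve-^ : ∀ n j → .{{NonZero n}} → (n ∸ j) ^ n * 2 ^ j ≤ n ^ n
halve-^ n zero = ≤-reflexive (*-identityʳ _)
halve-^ n@(suc n′) (suc j) = ≤-trans (step (n ∸ j) refl) (halve-^ n j)
  where
  open ≤-Reasoning
  step : ∀ i → n ∸ j ≡ i → (n ∸ suc j) ^ n * 2 ^ suc j ≤ (n ∸ j) ^ n * 2 ^ j
  step zero e = begin
    (n ∸ suc j) ^ n * 2 ^ suc j  ≡⟨ cong (λ z → z ^ n * 2 ^ suc j) (m≤n⇒m∸n≡0 {n} {suc j} (m≤n⇒m≤1+n (m∸n≡0⇒m≤n {n} {j} e))) ⟩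
    0 ^ n * 2 ^ suc j            ≤⟨ z≤n ⟩
    (n ∸ j) ^ n * 2 ^ j          ∎
  step (suc i) e = begin
    (n ∸ suc j) ^ n * 2 ^ suc j  ≡⟨ cong (λ z → z ^ n * 2 ^ suc j) (trans (sym (pred[m∸n]≡m∸[1+n] n j)) (cong pred e)) ⟩
    i ^ n * (2 * 2 ^ j)          ≡⟨ solve 2 (λ a b → a :* (con 2 :* b) := con 2 :* a :* b) refl (i ^ n) (2 ^ j) ⟩
    2 * i ^ n * 2 ^ j            ≤⟨ *-monoˡ-≤ (2 ^ j) (double-^ i n′ (≤-trans (n≤1+n i) (≤-trans (≤-reflexive (sym e)) (m∸n≤m n j)))) ⟩
    suc i ^ n * 2 ^ j            ≡⟨ cong (λ z → z ^ n * 2 ^ j) e ⟨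
    (n ∸ j) ^ n * 2 ^ j          ∎

-- A reverse Bernoulli inequality, (1 + 1/T)ᵉ ≤ 1 + 2e/T: the second-order term `2 * e` of each step
-- is absorbed by one more T.
suc-^ : ∀ T e → 2 * e ≤ T → suc T ^ e * T ≤ T ^ e * (T + 2 * e)
suc-^ T zero _ = ≤-reflexive (solve 1 (λ T → con 1 :* T := con 1 :* (T :+ con 0)) refl T)
suc-^ T (suc e) 2e+2≤T = begin
  suc T * suc T ^ e * T                ≡⟨ *-assoc (suc T) (suc T ^ e) T ⟩
  suc T * (suc T ^ e * T)              ≤⟨ *-monoʳ-≤ (suc T) (suc-^ T e 2e≤T) ⟩
  suc T * (T ^ e * (T + 2 * e))        ≡⟨ solve 3 (λ T e p → (con 1 :+ T) :* (p :* (T :+ con 2 :* e)) := p :* (T :* (con 1 :+ T :+ con 2 :* e) :+ con 2 :* e)) refl T e (T ^ e) ⟩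
  T ^ e * (T * (1 + T + 2 * e) + 2 * e)  ≤⟨ *-monoʳ-≤ (T ^ e) (+-monoʳ-≤ _ 2e≤T) ⟩
  T ^ e * (T * (1 + T + 2 * e) + T)    ≡⟨ solve 3 (λ T e p → p :* (T :* (con 1 :+ T :+ con 2 :* e) :+ T) := T :* p :* (T :+ con 2 :* (con 1 :+ e))) refl T e (T ^ e) ⟩
  T * T ^ e * (T + 2 * suc e)          ∎
  where
  open ≤-Reasoning
  2e≤T : 2 * e ≤ T
  2e≤T = ≤-trans (*-monoʳ-≤ 2 (n≤1+n e)) 2e+2≤T

suc-^≤2*^ : ∀ T e → .{{NonZero T}} → 2 * e ≤ T → suc T ^ e ≤ 2 * T ^ e
suc-^≤2*^ T e 2e≤T = *-cancelʳ-≤ _ _ T (begin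
  suc T ^ e * T          ≤⟨ suc-^ T e 2e≤T ⟩
  T ^ e * (T + 2 * e)    ≤⟨ *-monoʳ-≤ (T ^ e) (+-monoʳ-≤ T 2e≤T) ⟩
  T ^ e * (T + T)        ≡⟨ solve 2 (λ T p → p :* (T :+ T) := con 2 :* p :* T) refl T (T ^ e) ⟩
  2 * T ^ e * T          ∎)
  where open ≤-Reasoning

-- Counting placements of the vertices

total-mono : ∀ {k} {f g : Fin k → ℕ} → (∀ i → f i ≤ g i) → total f ≤ total g
total-mono {zero}  h = z≤n
total-mono {suc k} h = +-mono-≤ (h zero) (total-mono (h ∘ suc))

total-cong : ∀ {k} {f g : Fin k → ℕ} → (∀ i → f i ≡ g i) → total f ≡ total g
total-cong {zero}  h = refl
total-cong {suc k} h = cong₂ _+_ (h zero) (total-cong (h ∘ suc))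

total-+ : ∀ {k} (f g : Fin k → ℕ) → total (λ i → f i + g i) ≡ total f + total g
total-+ {zero}  f g = refl
total-+ {suc k} f g = trans (cong (f zero + g zero +_) (total-+ (f ∘ suc) (g ∘ suc)))
  (solve 4 (λ a b c d → a :+ b :+ (c :+ d) := a :+ c :+ (b :+ d)) refl (f zero) (g zero) _ _)

total-*ʳ : ∀ {k} (f : Fin k → ℕ) c → total (λ i → f i * c) ≡ total f * c
total-*ʳ {zero}  f c = refl
total-*ʳ {suc k} f c = trans (cong (f zero * c +_) (total-*ʳ (f ∘ suc) c)) (sym (*-distribʳ-+ c (f zero) _))

total-positive : ∀ {k} (f : Fin k → ℕ) → 0 < total f → ∃ λ i → 0 < f i
total-positive {suc k} f 0<t with f zero in eq
... | suc _ = zero , ≤-trans (s≤s z≤n) (≤-reflexive (sym eq))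
... | zero  with total-positive (f ∘ suc) 0<t
...   | i , p = suc i , p


-- `M ^ m` times the expectation of `f` under independent uniform positions.
mass : (Vec (Fin M) m → ℕ) → ℕ
mass {m = zero}  f = f []
mass {m = suc m} f = total (λ a → mass (λ w → f (a ∷ w)))

mass-mono : {f g : Vec (Fin M) m → ℕ} → (∀ w → f w ≤ g w) → mass f ≤ mass g
mass-mono {m = zero}  h = h []
mass-mono {m = suc m} h = total-mono (λ a → mass-mono (λ w → h (a ∷ w)))

mass-cong : {f g : Vec (Fin M) m → ℕ} → (∀ w → f w ≡ g w) → mass f ≡ mass g
mass-cong h = ≤-antisym (mass-mono (≤-reflexive ∘ h)) (mass-mono (≤-reflexive ∘ sym ∘ h))

mass-+ : (f g : Vec (Fin M) m → ℕ) → mass (λ w → f w + g w) ≡ mass f + mass g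
mass-+ {m = zero}  f g = refl
mass-+ {M} {suc m} f g = trans (total-cong (λ a → mass-+ (λ w → f (a ∷ w)) (λ w → g (a ∷ w)))) (total-+ {M} _ _)

mass-*ˡ : ∀ c (f : Vec (Fin M) m → ℕ) → mass (λ w → c * f w) ≡ c * mass f
mass-*ˡ {m = zero}  c f = refl
mass-*ˡ {M} {suc m} c f = trans (total-cong (λ a → trans (mass-*ˡ c (λ w → f (a ∷ w))) (*-comm c _)))
  (trans (total-*ʳ {M} _ c) (*-comm _ c))

mass-const : ∀ c → mass {M} {m} (λ _ → c) ≡ c * M ^ m
mass-const {M} {zero}  c = sym (*-identityʳ c)
mass-const {M} {suc m} c = trans (total-cong {M} (λ _ → mass-const {M} {m} c)) (trans (total-const M _)
  (solve 3 (λ a b c → a :* (b :* c) := b :* (a :* c)) refl M c (M ^ m)))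

mass-sum : ∀ {A : Set} (f : A → Vec (Fin M) m → ℕ) xs →
           mass (λ w → sum (map (λ x → f x w) xs)) ≡ sum (map (λ x → mass (f x)) xs)
mass-sum {M} {m} f []       = mass-const {M} {m} 0
mass-sum f (x ∷ xs) = trans (mass-+ (f x) _) (cong (mass (f x) +_) (mass-sum f xs))

mass-positive : (f : Vec (Fin M) m → ℕ) → 0 < mass f → ∃ λ w → 0 < f w
mass-positive {m = zero}  f h = [] , h
mass-positive {m = suc m} f h with total-positive _ h
... | a , h′ with mass-positive (λ w → f (a ∷ w)) h′
...   | w , p = a ∷ w , p

DependsOn : (Fin m → Set) → (Vec (Fin M) m → ℕ) → Set
DependsOn P f = ∀ w w′ → (∀ v → P v → lookup w v ≡ lookup w′ v) → f w ≡ f w′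

DependsOn-weaken : ∀ {P Q : Fin m → Set} {f : Vec (Fin M) m → ℕ} → (∀ v → P v → Q v) → DependsOn P f → DependsOn Q f
DependsOn-weaken P⊆Q d w w′ h = d w w′ (λ v → h v ∘ P⊆Q v)

DependsOn-* : ∀ {P : Fin m → Set} {f g : Vec (Fin M) m → ℕ} → DependsOn P f → DependsOn P g → DependsOn P (λ w → f w * g w)
DependsOn-* d e w w′ h = cong₂ _*_ (d w w′ h) (e w w′ h)

DependsOn-tail : ∀ {P : Fin (suc m) → Set} {f : Vec (Fin M) (suc m) → ℕ} → DependsOn P f → ∀ a → DependsOn (P ∘ suc) (λ w → f (a ∷ w))
DependsOn-tail d a w w′ h = d (a ∷ w) (a ∷ w′) λ { zero _ → refl ; (suc v) p → h v p }

private
  independent-step : (f g : Vec (Fin (suc M)) (suc m) → ℕ) → (∀ a w → g (a ∷ w) ≡ g (zero ∷ w)) →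
    (∀ a → mass (λ w → f (a ∷ w) * g (a ∷ w)) * suc M ^ m ≡ mass (λ w → f (a ∷ w)) * mass (λ w → g (a ∷ w))) →
    mass (λ w → f w * g w) * suc M ^ suc m ≡ mass f * mass g
  independent-step {M} {m} f g same ih = begin
    total (λ a → mass (λ w → f (a ∷ w) * g (a ∷ w))) * (suc M * suc M ^ m)
      ≡⟨ solve 3 (λ a b c → a :* (b :* c) := a :* c :* b) refl (total F) (suc M) (suc M ^ m) ⟩
    total F * suc M ^ m * suc M
      ≡⟨ cong (_* suc M) (total-*ʳ F (suc M ^ m)) ⟨
    total (λ a → F a * suc M ^ m) * suc M
      ≡⟨ cong (_* suc M) (total-cong (λ a → trans (ih a) (cong (mass (λ w → f (a ∷ w)) *_) (mass-cong (same a))))) ⟩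
    total (λ a → mass (λ w → f (a ∷ w)) * G) * suc M
      ≡⟨ cong (_* suc M) (total-*ʳ (λ a → mass (λ w → f (a ∷ w))) G) ⟩
    mass f * G * suc M
      ≡⟨ trans (*-assoc (mass f) G (suc M)) (cong (mass f *_) (*-comm G (suc M))) ⟩
    mass f * (suc M * G)
      ≡⟨ cong (mass f *_) (total-const (suc M) G) ⟨
    mass f * total {suc M} (λ _ → G)
      ≡⟨ cong (mass f *_) (total-cong (λ a → mass-cong (same a))) ⟨
    mass f * mass g ∎
    where
    open ≡-Reasoning
    F : Fin (suc M) → ℕ
    F a = mass (λ w → f (a ∷ w) * g (a ∷ w))
    G : ℕ
    G = mass (λ w → g (zero ∷ w))

-- Each coordinate is ignored by one of the two factors; the slices of that factor have constant
-- mass, which leaves the sum over the coordinate.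
mass-independent : ∀ {P Q : Fin m → Set} (f g : Vec (Fin M) m → ℕ) → (∀ v → ¬ P v ⊎ ¬ Q v) →
                   DependsOn P f → DependsOn Q g → mass (λ w → f w * g w) * M ^ m ≡ mass f * mass g
mass-independent {zero} f g _ _ _ = *-identityʳ _
mass-independent {suc m} {zero} f g _ _ _ = refl
mass-independent {suc m} {suc M} {P} {Q} f g disjoint df dg with disjoint zero
... | inj₂ ¬q = independent-step f g
  (λ a w → dg (a ∷ w) (zero ∷ w) λ { zero q → contradiction q ¬q ; (suc v) _ → refl })
  (λ a → mass-independent (λ w → f (a ∷ w)) (λ w → g (a ∷ w)) (disjoint ∘ suc) (DependsOn-tail {f = f} df a) (DependsOn-tail {f = g} dg a))
... | inj₁ ¬p = trans (cong (_* suc M ^ suc m) (mass-cong (λ w → *-comm (f w) (g w)))) (trans (independent-step g f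
  (λ a w → df (a ∷ w) (zero ∷ w) λ { zero p → contradiction p ¬p ; (suc v) _ → refl })
  (λ a → mass-independent (λ w → g (a ∷ w)) (λ w → f (a ∷ w)) (swap ∘ disjoint ∘ suc) (DependsOn-tail {f = g} dg a) (DependsOn-tail {f = f} df a)))
  (*-comm (mass g) (mass f)))

-- Sets of vertices placed in an interval

𝟙 : ∀ {p} {P : Set p} → Dec P → ℕ
𝟙 (yes _) = 1
𝟙 (no  _) = 0

𝟙-mono : ∀ {p q} {P : Set p} {Q : Set q} (P? : Dec P) (Q? : Dec Q) → (P → Q) → 𝟙 P? ≤ 𝟙 Q?
𝟙-mono (yes p) (yes q) h = ≤-refl
𝟙-mono (yes p) (no ¬q) h = contradiction (h p) ¬q
𝟙-mono (no ¬p) _       h = z≤n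

𝟙-yes : ∀ {p} {P : Set p} (P? : Dec P) → P → 𝟙 P? ≡ 1
𝟙-yes (yes _) _ = refl
𝟙-yes (no ¬p) p = contradiction p ¬p

within : ℕ → ℕ → ℕ → ℕ
within lo hi a = 𝟙 (lo ≤? a ×-dec a <? hi)

total-within : ∀ M lo hi → total {M} (λ a → within lo hi (toℕ a)) ≤ hi ∸ lo
total-within zero    lo hi = z≤n
total-within (suc M) lo zero = ≤-trans (≤-reflexive (trans (total-cong none) (trans (total-const (suc M) 0) (*-zeroʳ M)))) z≤n
  where
  none : ∀ a → within lo 0 (toℕ {suc M} a) ≡ 0
  none a = n≤0⇒n≡0 (𝟙-mono (lo ≤? toℕ a ×-dec toℕ a <? 0) (1 ≤? 0) λ { (_ , ()) })
total-within (suc M) zero (suc hi) = +-mono-≤ (≤-reflexive (𝟙-yes (0 ≤? 0 ×-dec 0 <? suc hi) (z≤n , s≤s z≤n)))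
  (≤-trans (total-mono {M} λ a → 𝟙-mono (0 ≤? suc (toℕ a) ×-dec suc (toℕ a) <? suc hi) (0 ≤? toℕ a ×-dec toℕ a <? hi)
    λ (_ , lt) → z≤n , s≤s⁻¹ lt) (total-within M zero hi))
total-within (suc M) (suc lo) (suc hi) = +-mono-≤
  (𝟙-mono (suc lo ≤? 0 ×-dec 0 <? suc hi) (1 ≤? 0) λ { (() , _) })
  (≤-trans (total-mono {M} λ a → 𝟙-mono (suc lo ≤? suc (toℕ a) ×-dec suc (toℕ a) <? suc hi) (lo ≤? toℕ a ×-dec toℕ a <? hi)
    λ (le , lt) → s≤s⁻¹ le , s≤s⁻¹ lt) (total-within M lo hi))

block : Subset m → ℕ → ℕ → Vec (Fin M) m → ℕ
block []            lo hi []      = 1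
block (outside ∷ S) lo hi (a ∷ w) = block S lo hi w
block (inside ∷ S)  lo hi (a ∷ w) = within lo hi (toℕ a) * block S lo hi w

block-depends : (S : Subset m) → ∀ lo hi → DependsOn {M = M} (_∈ S) (block S lo hi)
block-depends [] lo hi [] [] h = refl
block-depends (outside ∷ S) lo hi (a ∷ w) (a′ ∷ w′) h = block-depends S lo hi w w′ (λ v v∈S → h (suc v) (there v∈S))
block-depends (inside ∷ S)  lo hi (a ∷ w) (a′ ∷ w′) h = cong₂ _*_ (cong (within lo hi ∘ toℕ) (h zero here))
  (block-depends S lo hi w w′ (λ v v∈S → h (suc v) (there v∈S)))

block≡1 : (S : Subset m) → ∀ lo hi (w : Vec (Fin M) m) →
          (∀ v → v ∈ S → lo ≤ toℕ (lookup w v) × toℕ (lookup w v) < hi) → block S lo hi w ≡ 1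
block≡1 [] lo hi [] h = refl
block≡1 (outside ∷ S) lo hi (a ∷ w) h = block≡1 S lo hi w (λ v v∈S → h (suc v) (there v∈S))
block≡1 (inside ∷ S)  lo hi (a ∷ w) h = cong₂ _*_ (𝟙-yes (lo ≤? toℕ a ×-dec toℕ a <? hi) (h zero here))
  (block≡1 S lo hi w (λ v v∈S → h (suc v) (there v∈S)))

mass-block : (S : Subset m) → ∀ lo hi → mass {M} (block S lo hi) * M ^ size S ≤ (hi ∸ lo) ^ size S * M ^ m
mass-block [] lo hi = ≤-refl
mass-block {suc m} {M} (outside ∷ S) lo hi = begin
  total {M} (λ _ → mass (block S lo hi)) * M ^ size S ≡⟨ cong (_* M ^ size S) (total-const M _) ⟩
  M * mass {M} (block S lo hi) * M ^ size S           ≡⟨ *-assoc M _ _ ⟩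
  M * (mass {M} (block S lo hi) * M ^ size S)         ≤⟨ *-monoʳ-≤ M (mass-block S lo hi) ⟩
  M * ((hi ∸ lo) ^ size S * M ^ m)                    ≡⟨ solve 3 (λ a b c → a :* (b :* c) := b :* (a :* c)) refl M ((hi ∸ lo) ^ size S) (M ^ m) ⟩
  (hi ∸ lo) ^ size S * (M * M ^ m)                    ∎
  where open ≤-Reasoning
mass-block {suc m} {M} (inside ∷ S) lo hi = begin
  total {M} (λ a → mass (λ w → within lo hi (toℕ a) * block S lo hi w)) * M ^ suc (size S)
    ≡⟨ cong (_* M ^ suc (size S)) (trans (total-cong {M} (λ a → mass-*ˡ (within lo hi (toℕ a)) (block S lo hi))) (total-*ʳ {M} _ _)) ⟩
  total {M} (λ a → within lo hi (toℕ a)) * mass {M} (block S lo hi) * (M * M ^ size S)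
    ≡⟨ solve 4 (λ t b m p → t :* b :* (m :* p) := t :* (m :* (b :* p))) refl (total {M} (λ a → within lo hi (toℕ a))) (mass {M} (block S lo hi)) M (M ^ size S) ⟩
  total {M} (λ a → within lo hi (toℕ a)) * (M * (mass {M} (block S lo hi) * M ^ size S))
    ≤⟨ *-mono-≤ (total-within M lo hi) (*-monoʳ-≤ M (mass-block S lo hi)) ⟩
  (hi ∸ lo) * (M * ((hi ∸ lo) ^ size S * M ^ m))
    ≡⟨ solve 4 (λ l p m q → l :* (m :* (p :* q)) := l :* p :* (m :* q)) refl (hi ∸ lo) ((hi ∸ lo) ^ size S) M (M ^ m) ⟩
  (hi ∸ lo) ^ suc (size S) * M ^ suc m ∎
  where open ≤-Reasoning

-- Surplus vertices contribute factors of at most 1. This gives edges with different numbers of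
-- unshared vertices the same exponent.
mass-block-≥ : .{{NonZero M}} → (S : Subset m) → ∀ {k lo hi} → k ≤ size S → hi ∸ lo ≤ M →
               mass {M} (block S lo hi) * M ^ k ≤ (hi ∸ lo) ^ k * M ^ m
mass-block-≥ {M} {m} S {k} {lo} {hi} k≤ len≤M with m≤n⇒∃[o]m+o≡n k≤
... | c , k+c≡ = *-cancelʳ-≤ _ _ (M ^ c) {{m^n≢0 M c}} (begin
  B * M ^ k * M ^ c                            ≡⟨ trans (*-assoc B _ _) (cong (B *_) (sym (^-distribˡ-+-* M k c))) ⟩
  B * M ^ (k + c)                              ≡⟨ cong (λ z → B * M ^ z) k+c≡ ⟩
  B * M ^ size S                               ≤⟨ mass-block S lo hi ⟩
  (hi ∸ lo) ^ size S * M ^ m                   ≡⟨ cong (λ z → (hi ∸ lo) ^ z * M ^ m) k+c≡ ⟨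
  (hi ∸ lo) ^ (k + c) * M ^ m                  ≡⟨ cong (_* M ^ m) (^-distribˡ-+-* (hi ∸ lo) k c) ⟩
  (hi ∸ lo) ^ k * (hi ∸ lo) ^ c * M ^ m        ≤⟨ *-monoˡ-≤ (M ^ m) (*-monoʳ-≤ ((hi ∸ lo) ^ k) (^-monoˡ-≤ c len≤M)) ⟩
  (hi ∸ lo) ^ k * M ^ c * M ^ m                ≡⟨ solve 3 (λ a b c → a :* b :* c := a :* c :* b) refl ((hi ∸ lo) ^ k) (M ^ c) (M ^ m) ⟩
  (hi ∸ lo) ^ k * M ^ m * M ^ c                ∎)
  where
  open ≤-Reasoning
  B : ℕ
  B = mass {M} (block S lo hi)

-- The local lemma

sum-*-≤ : ∀ {A : Set} (f g : A → ℕ) c k xs → (∀ x → x ∈ₗ xs → f x * c ≤ g x * k) → sum (map f xs) * c ≤ sum (map g xs) * k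
sum-*-≤ f g c k [] h = z≤n
sum-*-≤ f g c k (x ∷ xs) h = begin
  (f x + sum (map f xs)) * c        ≡⟨ *-distribʳ-+ c (f x) _ ⟩
  f x * c + sum (map f xs) * c      ≤⟨ +-mono-≤ (h x (here refl)) (sum-*-≤ f g c k xs (λ y p → h y (there p))) ⟩
  g x * k + sum (map g xs) * k      ≡⟨ *-distribʳ-+ k (g x) _ ⟨
  (g x + sum (map g xs)) * k        ∎
  where open ≤-Reasoning

*-sum-≤ : ∀ {A : Set} (g : A → ℕ) c b xs → (∀ x → x ∈ₗ xs → c * g x ≤ b) → c * sum (map g xs) ≤ length xs * b
*-sum-≤ g c b []       _ = ≤-reflexive (*-zeroʳ c)
*-sum-≤ g c b (x ∷ xs) p = ≤-trans (≤-reflexive (*-distribˡ-+ c (g x) _)) (+-mono-≤ (p x (here refl)) (*-sum-≤ g c b xs (λ y → p y ∘ there)))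

tuples : ∀ {A : Set} → ℕ → List A → List (List A)
tuples zero    xs = [] ∷ []
tuples (suc k) xs = cartesianProductWith _∷_ xs (tuples k xs)

∈-tuples⁺ : ∀ {A : Set} {xs : List A} ys → All (_∈ₗ xs) ys → ys ∈ₗ tuples (length ys) xs
∈-tuples⁺ []       []       = here refl
∈-tuples⁺ (y ∷ ys) (p ∷ ps) = ∈-cartesianProductWith⁺ _∷_ p (∈-tuples⁺ ys ps)

∈-tuples⁻ : ∀ {A : Set} {xs ys : List A} k → ys ∈ₗ tuples k xs → length ys ≡ k × All (_∈ₗ xs) ys
∈-tuples⁻ zero (here refl) = refl , []
∈-tuples⁻ {xs = xs} (suc k) p with ∈-cartesianProductWith⁻ _∷_ xs (tuples k xs) p
... | y , ys , y∈ , ys∈ , refl with ∈-tuples⁻ k ys∈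
...   | len , all = cong suc len , y∈ ∷ all

filter-split : ∀ {A : Set} {P : Pred A 0ℓ} (P? : Decidable P) xs → xs ↭ filter P? xs ++ filter (¬? ∘ P?) xs
filter-split P? [] = ↭-refl
filter-split P? (x ∷ xs) with P? x
... | yes _ = prep x (filter-split P? xs)
... | no  _ = ↭-trans (prep x (filter-split P? xs)) (↭-sym (shift x (filter P? xs) _))

length-filter-∷ : ∀ {A : Set} {P : Pred A 0ℓ} (P? : Decidable P) x xs → length (filter P? xs) ≤ length (filter P? (x ∷ xs))
length-filter-∷ P? x xs with P? x
... | yes _ = n≤1+n _
... | no  _ = ≤-refl

length-filter-⊎ : ∀ {A : Set} {P Q R : Pred A 0ℓ} (P? : Decidable P) (Q? : Decidable Q) (R? : Decidable R) →
  (∀ x → P x → Q x ⊎ R x) → ∀ xs → length (filter P? xs) ≤ length (filter Q? xs) + length (filter R? xs)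
length-filter-⊎ P? Q? R? h [] = z≤n
length-filter-⊎ P? Q? R? h (x ∷ xs) with P? x | Q? x | R? x | length-filter-⊎ P? Q? R? h xs
... | no _  | no _  | no _  | ih = ih
... | no _  | no _  | yes _ | ih = ≤-trans ih (+-monoʳ-≤ (length (filter Q? xs)) (n≤1+n _))
... | no _  | yes _ | no _  | ih = m≤n⇒m≤1+n ih
... | no _  | yes _ | yes _ | ih = m≤n⇒m≤1+n (≤-trans ih (+-monoʳ-≤ (length (filter Q? xs)) (n≤1+n _)))
... | yes p | yes _ | no _  | ih = s≤s ih
... | yes p | yes _ | yes _ | ih = s≤s (≤-trans ih (+-monoʳ-≤ (length (filter Q? xs)) (n≤1+n _)))
... | yes p | no _  | yes _ | ih = ≤-trans (s≤s ih) (≤-reflexive (sym (+-suc (length (filter Q? xs)) _)))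
... | yes p | no ¬q | no ¬r | ih = contradiction (h x p) [ ¬q , ¬r ]′


-- Neighbourhoods of edges

meets? : (f : Subset m) → Decidable (λ e → Nonempty (e ∩ f))
meets? f e = nonempty? (e ∩ f)

neighbours : Subset m → List (Subset m) → List (Subset m)
neighbours f = filter (meets? f)

touches? : (es : List (Subset m)) → Decidable (λ f → Any (λ e → Nonempty (f ∩ e)) es)
touches? es f = any? (λ e → nonempty? (f ∩ e)) es

length-touching : ∀ {d} (F es : List (Subset m)) → All (λ e → length (neighbours e F) ≤ d) es →
                  length (filter (touches? es) F) ≤ length es * d
length-touching F [] [] = ≤-reflexive (cong length (filter-none (touches? []) (All.tabulate {xs = F} λ _ ())))
length-touching F (e ∷ es) (p ∷ ps) = ≤-trans
  (length-filter-⊎ (touches? (e ∷ es)) (meets? e) (touches? es) (λ { f (here q) → inj₁ q ; f (there q) → inj₂ q }) F)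
  (+-mono-≤ p (length-touching F es ps))

-- The bound is required on all of `E` because an obstruction may contain the edge being added,
-- which does not lie in `G`. An edge may count among its own neighbours, which matches degrees
-- strictly below `d`.
Sparse : ℕ → List (Subset m) → List (Subset m) → Set
Sparse d E G = All (_∈ₗ E) G × (∀ f → f ∈ₗ E → length (neighbours f G) ≤ d)

Sparse-tail : ∀ {d E e} {G : List (Subset m)} → Sparse d E (e ∷ G) → Sparse d E G
Sparse-tail {e = e} {G} (_ ∷ G⊆E , deg) = G⊆E , λ f f∈ → ≤-trans (length-filter-∷ (meets? f) e G) (deg f f∈)

Sparse-↭ : ∀ {d E} {G G′ : List (Subset m)} → G ↭ G′ → Sparse d E G → Sparse d E G′
Sparse-↭ G↭G′ (G⊆E , deg) = All.tabulate (λ p → All.lookup G⊆E (∈-resp-↭ (↭-sym G↭G′) p)) ,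
  λ f f∈ → ≤-trans (≤-reflexive (↭-length (filter-↭ (meets? f) (↭-sym G↭G′)))) (deg f f∈)

-- An obstruction is a list of edges es together with an event b es that
-- depends on those edges only; only lists of length 1 and r matter.
module LocalLemma {m M : ℕ} {{M≢0 : NonZero M}} (r d : ℕ) {{r≢0 : NonZero r}} {{d≢0 : NonZero d}}
  (E : List (Subset m))
  (b : List (Subset m) → Vec (Fin M) m → ℕ)
  (local : ∀ es → DependsOn (λ v → Any (v ∈_) es) (b es))
  (obstructions : Subset m → List (Subset m) → List (List (Subset m)))
  (sound : ∀ e F es → es ∈ₗ obstructions e F → e ∈ₗ E → All (_∈ₗ E) F → length es ≤ r × All (_∈ₗ E) es)
  (complete : ∀ e F es w → length es ≡ 1 ⊎ length es ≡ r → All (_∈ₗ e ∷ F) es → e ∈ₗ es → 0 < b es w → es ∈ₗ obstructions e F)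
  (rare : ∀ e F → Sparse d E (e ∷ F) → 2 * (2 * (r * d)) * sum (map (λ es → mass (b es)) (obstructions e F)) ≤ M ^ m)
  where

  Good : List (Subset m) → Vec (Fin M) m → Set
  Good G w = ∀ es → length es ≡ 1 ⊎ length es ≡ r → All (_∈ₗ G) es → b es w ≡ 0

  good? : ∀ G w → Dec (Good G w)
  good? G w = map′
    (λ { (ones , rs) es (inj₁ len) all → All.lookup ones (subst (λ k → es ∈ₗ tuples k G) len (∈-tuples⁺ es all))
       ; (ones , rs) es (inj₂ len) all → All.lookup rs (subst (λ k → es ∈ₗ tuples k G) len (∈-tuples⁺ es all)) })
    (λ good → All.tabulate (λ {es} p → let len , all = ∈-tuples⁻ 1 p in good es (inj₁ len) all) ,
              All.tabulate (λ {es} p → let len , all = ∈-tuples⁻ r p in good es (inj₂ len) all))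
    (all? (λ es → b es w ≟ 0) (tuples 1 G) ×-dec all? (λ es → b es w ≟ 0) (tuples r G))

  good : List (Subset m) → Vec (Fin M) m → ℕ
  good G w = 𝟙 (good? G w)

  goods : List (Subset m) → ℕ
  goods G = mass (good G)

  -- An obstruction touches at most `r * d` edges; if each of them costs a fraction 1/Q of the good
  -- placements, half of these survive.
  Q : ℕ
  Q = 2 * (r * d)

  good-antitone : ∀ {F G} → (∀ {e} → e ∈ₗ F → e ∈ₗ G) → ∀ w → good G w ≤ good F w
  good-antitone {F} {G} F⊆G w = 𝟙-mono (good? G w) (good? F w) λ good es len all → good es len (All.map F⊆G all)

  goods-antitone : ∀ {F G} → (∀ {e} → e ∈ₗ F → e ∈ₗ G) → goods G ≤ goods F
  goods-antitone F⊆G = mass-mono (good-antitone F⊆G)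

  Good-∷ : ∀ e F w → sum (map (λ es → b es w) (obstructions e F)) ≡ 0 → Good F w → Good (e ∷ F) w
  Good-∷ e F w none good es len all with split all
    where
    split : ∀ {es} → All (_∈ₗ e ∷ F) es → All (_∈ₗ F) es ⊎ e ∈ₗ es
    split [] = inj₁ []
    split (here refl ∷ _) = inj₂ (here refl)
    split (there p ∷ ps) with split ps
    ... | inj₁ all = inj₁ (p ∷ all)
    ... | inj₂ e∈  = inj₂ (there e∈)
  ... | inj₁ es⊆F = good es len es⊆F
  ... | inj₂ e∈es with b es w in eq
  ...   | zero  = refl
  ...   | suc k = contradiction none (zero-sum (complete e F es w len all e∈es (≤-trans (s≤s z≤n) (≤-reflexive (sym eq)))))
    where
    zero-sum : ∀ {xs} → es ∈ₗ xs → sum (map (λ es → b es w) xs) ≢ 0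
    zero-sum (here refl) s rewrite eq = contradiction s λ ()
    zero-sum {x ∷ _} (there p) s = zero-sum p (m+n≡0⇒n≡0 (b x w) s)

  -- A placement spoiled by `e` realises an obstruction through `e`, whose event is there a positive
  -- integer, so the sum is at least 1.
  good-≤ : ∀ e F w → good F w ≤ good (e ∷ F) w + sum (map (λ es → b es w * good F w) (obstructions e F))
  good-≤ e F w with good? F w
  ... | no  _ = z≤n
  ... | yes g with good? (e ∷ F) w
  ...   | yes _ = s≤s z≤n
  ...   | no ¬g with sum (map (λ es → b es w) (obstructions e F)) in eq
  ...     | zero  = contradiction (Good-∷ e F w eq g) ¬g
  ...     | suc k = ≤-trans (s≤s (z≤n {k})) (≤-trans (≤-reflexive (sym eq)) (≤-reflexive (times-one (obstructions e F))))
    where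
    times-one : ∀ xs → sum (map (λ es → b es w) xs) ≡ sum (map (λ es → b es w * 1) xs)
    times-one []       = refl
    times-one (x ∷ xs) = cong₂ _+_ (sym (*-identityʳ (b x w))) (times-one xs)

  far : List (Subset m) → List (Subset m) → List (Subset m)
  far es = filter (¬? ∘ touches? es)

  far⊆ : ∀ es F {e} → e ∈ₗ far es F → e ∈ₗ F
  far⊆ es F p = proj₁ (∈-filter⁻ (¬? ∘ touches? es) {xs = F} p)

  good-far-depends : ∀ es F → DependsOn (λ v → Any (v ∈_) (far es F)) (good (far es F))
  good-far-depends es F w w′ h = ≤-antisym (go w w′ h) (go w′ w (λ v p → sym (h v p)))
    where
    go : ∀ w w′ → (∀ v → Any (v ∈_) (far es F) → lookup w v ≡ lookup w′ v) → good (far es F) w ≤ good (far es F) w′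
    go w w′ h = 𝟙-mono (good? (far es F) w) (good? (far es F) w′) λ good fs len all →
      trans (local fs w′ w (λ v p → sym (h v (in-far all p)))) (good fs len all)
      where
      in-far : ∀ {v fs} → All (_∈ₗ far es F) fs → Any (v ∈_) fs → Any (v ∈_) (far es F)
      in-far (p ∷ _)  (here v∈) = Any.map (λ { refl → v∈ }) p
      in-far (_ ∷ ps) (there q) = in-far ps q

  obstruction-far : ∀ es F → mass (λ w → b es w * good (far es F) w) * M ^ m ≡ mass (b es) * goods (far es F)
  obstruction-far es F = mass-independent (b es) (good (far es F)) disjoint (local es) (good-far-depends es F)
    where
    disjoint : ∀ v → ¬ Any (v ∈_) es ⊎ ¬ Any (v ∈_) (far es F)
    disjoint v with any? (v ∈?_) es
    ... | no ¬p = inj₁ ¬p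
    ... | yes p = inj₂ λ q → let f , f∈ , v∈f = find q in
      proj₂ (∈-filter⁻ (¬? ∘ touches? es) {xs = F} f∈) (Any.map (λ v∈e → v , x∈p∩q⁺ (v∈f , v∈e)) p)

  -- Adding e loses at most a fraction 1/Q of the good placements; written without
  -- subtraction.
  Claim : Subset m → List (Subset m) → Set
  Claim e F = Q * goods F ≤ Q * goods (e ∷ F) + goods F

  -- The linear form 1 - |X|/Q of (1 - 1/Q)^|X|: every single loss is measured against `goods F`,
  -- the largest of the counts involved.
  remove : ∀ ℓ → (∀ e G → length G < ℓ → Sparse d E (e ∷ G) → Claim e G) →
           ∀ X F → length (X ++ F) ≤ ℓ → Sparse d E (X ++ F) → Q * goods F ≤ Q * goods (X ++ F) + length X * goods F
  remove ℓ claim []      F len sparse = m≤m+n _ 0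
  remove ℓ claim (e ∷ X) F len sparse = begin
    Q * goods F                                             ≤⟨ remove ℓ claim X F (<⇒≤ len) (Sparse-tail sparse) ⟩
    Q * goods (X ++ F) + length X * goods F                 ≤⟨ +-monoˡ-≤ _ (claim e (X ++ F) len sparse) ⟩
    Q * goods (e ∷ X ++ F) + goods (X ++ F) + length X * goods F
      ≤⟨ +-monoˡ-≤ _ (+-monoʳ-≤ (Q * goods (e ∷ X ++ F)) (goods-antitone (∈-++⁺ʳ X))) ⟩
    Q * goods (e ∷ X ++ F) + goods F + length X * goods F   ≡⟨ +-assoc (Q * goods (e ∷ X ++ F)) _ _ ⟩
    Q * goods (e ∷ X ++ F) + suc (length X) * goods F       ∎
    where open ≤-Reasoning

  -- After a reordering of `F`, the edges touching `es` are those added to the far ones. There are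
  -- at most r d = Q/2 of them, so `remove` loses at most half.
  goods-far : ∀ ℓ → (∀ e G → length G < ℓ → Sparse d E (e ∷ G) → Claim e G) → ∀ F es → length F ≤ ℓ → Sparse d E F →
              length es ≤ r → All (_∈ₗ E) es → goods (far es F) ≤ 2 * goods F
  goods-far ℓ claim F es len sparse es≤r es⊆E = *-cancelˡ-≤ (r * d) {{m*n≢0 r d}} (+-cancelʳ-≤ (r * d * K) _ _ (begin
    r * d * K + r * d * K            ≡⟨ solve 2 (λ a k → a :* k :+ a :* k := con 2 :* a :* k) refl (r * d) K ⟩
    Q * K                            ≤⟨ remove ℓ claim near (far es F) (≤-trans (≤-reflexive (sym (↭-length split))) len) (Sparse-↭ split sparse) ⟩
    Q * goods (near ++ far es F) + length near * K
      ≤⟨ +-mono-≤ (*-monoʳ-≤ Q (goods-antitone (∈-resp-↭ split)))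
           (*-monoˡ-≤ K (≤-trans (length-touching F es (All.map (λ {f} → proj₂ sparse f) es⊆E)) (*-monoˡ-≤ d es≤r))) ⟩
    Q * goods F + r * d * K          ≡⟨ cong (_+ r * d * K) (solve 2 (λ a n → con 2 :* a :* n := a :* (con 2 :* n)) refl (r * d) (goods F)) ⟩
    r * d * (2 * goods F) + r * d * K ∎))
    where
    open ≤-Reasoning
    K : ℕ
    K = goods (far es F)
    near : List (Subset m)
    near = filter (touches? es) F
    split : F ↭ near ++ far es F
    split = filter-split (touches? es) F

  -- Forgetting the edges that touch `es` makes its event independent of goodness, and by
  -- `goods-far` this costs a factor 2, which `rare` provides for. The bound `ℓ` drives the
  -- induction because `goods-far` reorders the list.
  claim : ∀ ℓ e F → length F < ℓ → Sparse d E (e ∷ F) → Claim e F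
  claim (suc ℓ) e F (s≤s len) sparse@((e∈E ∷ F⊆E) , _) = *-cancelʳ-≤ _ _ (M ^ m) {{m^n≢0 M m}} (begin
    Q * goods F * Ω
      ≤⟨ *-monoˡ-≤ Ω (*-monoʳ-≤ Q union) ⟩
    Q * (goods (e ∷ F) + sum (map hit obs)) * Ω
      ≡⟨ solve 4 (λ q g s o → q :* (g :+ s) :* o := q :* g :* o :+ q :* (s :* o)) refl Q (goods (e ∷ F)) (sum (map hit obs)) Ω ⟩
    Q * goods (e ∷ F) * Ω + Q * (sum (map hit obs) * Ω)
      ≤⟨ +-monoʳ-≤ (Q * goods (e ∷ F) * Ω) (*-monoʳ-≤ Q (sum-*-≤ hit (λ es → mass (b es)) Ω (2 * goods F) obs bound)) ⟩
    Q * goods (e ∷ F) * Ω + Q * (B * (2 * goods F))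
      ≡⟨ cong (Q * goods (e ∷ F) * Ω +_) (solve 3 (λ q b g → q :* (b :* (con 2 :* g)) := con 2 :* q :* b :* g) refl Q B (goods F)) ⟩
    Q * goods (e ∷ F) * Ω + 2 * Q * B * goods F
      ≤⟨ +-monoʳ-≤ (Q * goods (e ∷ F) * Ω) (*-monoˡ-≤ (goods F) (rare e F sparse)) ⟩
    Q * goods (e ∷ F) * Ω + Ω * goods F
      ≡⟨ solve 4 (λ q g o f → q :* g :* o :+ o :* f := (q :* g :+ f) :* o) refl Q (goods (e ∷ F)) Ω (goods F) ⟩
    (Q * goods (e ∷ F) + goods F) * Ω ∎)
    where
    open ≤-Reasoning
    Ω B : ℕ
    Ω = M ^ m
    obs : List (List (Subset m))
    obs = obstructions e F
    B = sum (map (λ es → mass (b es)) obs)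
    hit : List (Subset m) → ℕ
    hit es = mass (λ w → b es w * good F w)
    union : goods F ≤ goods (e ∷ F) + sum (map hit obs)
    union = ≤-trans (mass-mono (good-≤ e F))
      (≤-reflexive (trans (mass-+ (good (e ∷ F)) _) (cong (goods (e ∷ F) +_) (mass-sum (λ es w → b es w * good F w) obs))))
    bound : ∀ es → es ∈ₗ obs → hit es * Ω ≤ mass (b es) * (2 * goods F)
    bound es p = ≤-trans (*-monoˡ-≤ Ω (mass-mono (λ w → *-monoʳ-≤ (b es w) (good-antitone (far⊆ es F) w))))
      (≤-trans (≤-reflexive (obstruction-far es F))
        (*-monoʳ-≤ (mass (b es)) (goods-far ℓ (claim ℓ) F es len (Sparse-tail sparse)
          (proj₁ (sound e F es p e∈E F⊆E)) (proj₂ (sound e F es p e∈E F⊆E)))))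

  goods-positive : ∀ F → Sparse d E F → 0 < goods F
  goods-positive [] _ = ≤-trans (m^n>0 M m) (≤-trans (≤-reflexive (sym (trans (mass-const {M} {m} 1) (*-identityˡ _))))
    (mass-mono {f = λ _ → 1} (λ w → ≤-reflexive (sym (𝟙-yes (good? [] w) empty)))))
    where
    empty : ∀ {w} → Good [] w
    empty [] (inj₂ 0≡r) _ = contradiction (sym 0≡r) (≢-nonZero⁻¹ r)
    empty (_ ∷ _) _ (() ∷ _)
  goods-positive (e ∷ F) sparse with goods (e ∷ F) in eq | goods-positive F (Sparse-tail sparse)
  ... | suc _ | _ = s≤s z≤n
  ... | zero  | 0<F = contradiction (begin-strict
    goods F                               <⟨ m<n+m (goods F) 0<F ⟩
    goods F + goods F                     ≡⟨ cong (goods F +_) (sym (+-identityʳ (goods F))) ⟩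
    2 * goods F                           ≤⟨ *-monoˡ-≤ (goods F) (*-monoʳ-≤ 2 (>-nonZero⁻¹ (r * d) {{m*n≢0 r d}})) ⟩
    Q * goods F                           ≤⟨ claim (suc (length F)) e F ≤-refl sparse ⟩
    Q * goods (e ∷ F) + goods F           ≡⟨ cong (λ z → Q * z + goods F) eq ⟩
    Q * 0 + goods F                       ≡⟨ cong (_+ goods F) (*-zeroʳ Q) ⟩
    goods F                               ∎) (<-irrefl refl)
    where open ≤-Reasoning

  good-exists : Sparse d E E → ∃ (Good E)
  good-exists sparse with mass-positive (good E) (goods-positive E sparse)
  ... | w , p with good? E w
  ...   | yes g = w , g

-- Chains of edges

total-≤ : ∀ {k} (f : Fin k → ℕ) c → (∀ i → f i ≤ c) → total f ≤ k * c
total-≤ {k} f c h = ≤-trans (total-mono h) (≤-reflexive (total-const k c))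

mass-total : ∀ {k} (f : Fin k → Vec (Fin M) m → ℕ) → mass (λ w → total (λ i → f i w)) ≡ total (λ i → mass (f i))
mass-total {M} {m} {zero} f = mass-const {M} {m} 0
mass-total {k = suc k} f = trans (mass-+ (f zero) _) (cong (mass (f zero) +_) (mass-total (f ∘ suc)))

x∈p─q⇒x∉q : ∀ {p q : Subset m} {x} → x ∈ p ─ q → x ∉ q
x∈p─q⇒x∉q {p = _ ∷ p} {inside ∷ q}  (there x∈) (there x∈q) = x∈p─q⇒x∉q {p = p} x∈ x∈q
x∈p─q⇒x∉q {p = _ ∷ p} {outside ∷ q} (there x∈) (there x∈q) = x∈p─q⇒x∉q {p = p} x∈ x∈q

size-─-∩ : (p q : Subset m) → size (p ─ q) + size (p ∩ q) ≡ size p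
size-─-∩ [] [] = refl
size-─-∩ (outside ∷ p) (outside ∷ q) = size-─-∩ p q
size-─-∩ (outside ∷ p) (inside ∷ q)  = size-─-∩ p q
size-─-∩ (inside ∷ p)  (outside ∷ q) = cong suc (size-─-∩ p q)
size-─-∩ (inside ∷ p)  (inside ∷ q)  = trans (+-suc (size (p ─ q)) _) (cong suc (size-─-∩ p q))

-- The intersection pattern of a chain. It does not involve the placement, and it makes the factors
-- multiplied in `fit` independent.
Path : List (Subset m) → Set
Path []            = ⊤
Path (e ∷ [])      = ⊤
Path (e ∷ f ∷ es)  = size (e ∩ f) ≡ 1 × All (λ g → ¬ Nonempty (e ∩ g)) es × Path (f ∷ es)

path? : (es : List (Subset m)) → Dec (Path es)
path? []           = yes tt
path? (e ∷ [])     = yes tt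
path? (e ∷ f ∷ es) = size (e ∩ f) ≟ 1 ×-dec all? (λ g → ¬? (nonempty? (e ∩ g))) es ×-dec path? (f ∷ es)

-- Counts the ways to place the shared vertices of consecutive edges at
-- positions x₁, x₂, … with x_i in the window [base + (i - 1) s, base + (i - 1) s + q)
-- so that D lies in [lo, x₁], the next edge in [x₁, x₂], and so on.  D is the
-- part of e that is not shared with the edge before it.
fit : (s q base lo : ℕ) (D e : Subset m) → List (Subset m) → Vec (Fin M) m → ℕ
fit {M = M} s q base lo D e [] w = block D lo M w
fit s q base lo D e (f ∷ es) w = total {q} λ y → let x = base + toℕ y in
  block (D ─ f) lo (suc x) w * block (e ∩ f) x (suc x) w * fit s q (base + s) x (f ─ e) f es w

fit-depends : ∀ s q base lo (D e : Subset m) es →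
              DependsOn {M = M} (λ v → v ∈ D ⊎ Any (v ∈_) es) (fit s q base lo D e es)
fit-depends s q base lo D e [] w w′ h = block-depends D lo _ w w′ (λ v v∈ → h v (inj₁ v∈))
fit-depends s q base lo D e (f ∷ es) w w′ h = total-cong {q} λ y → let x = base + toℕ y in cong₂ _*_ (cong₂ _*_
  (block-depends (D ─ f) lo (suc x) w w′ (λ v v∈ → h v (inj₁ (p─q⊆p D f v∈))))
  (block-depends (e ∩ f) x (suc x) w w′ (λ v v∈ → h v (inj₂ (here (proj₂ (x∈p∩q⁻ e f v∈)))))))
  (fit-depends s q (base + s) x (f ─ e) f es w w′
    λ { v (inj₁ v∈) → h v (inj₂ (here (p─q⊆p f e v∈))) ; v (inj₂ p) → h v (inj₂ (there p)) })

-- The interval ending at `x` and the one starting there both contain `x`, so each joint adds 1 to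
-- the total length: (x + 1 - lo) + (M + k - x) = M + K - lo. If lo > x + 1, the truncated
-- difference makes the left side 0.
gap-AM-GM : ∀ {M} k lo x → x ≤ M → let K = suc k in
  suc K ^ suc K * ((suc x ∸ lo) * (M + k ∸ x) ^ K) ≤ K ^ K * (M + K ∸ lo) ^ suc K
gap-AM-GM {M} k lo x x≤M with lo ≤? suc x
... | yes lo≤ = ≤-trans (AM-GM-step k (M + k ∸ x) (suc x ∸ lo)) (≤-reflexive (cong (λ z → suc k ^ suc k * z ^ suc (suc k)) (begin
  (suc x ∸ lo) + (M + k ∸ x)     ≡⟨ +-comm (suc x ∸ lo) _ ⟩
  (M + k ∸ x) + (suc x ∸ lo)     ≡⟨ +-∸-assoc (M + k ∸ x) lo≤ ⟨
  (M + k ∸ x) + suc x ∸ lo       ≡⟨ cong (_∸ lo) (+-suc (M + k ∸ x) x) ⟩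
  suc ((M + k ∸ x) + x) ∸ lo     ≡⟨ cong (λ z → suc z ∸ lo) (m∸n+n≡m (≤-trans x≤M (m≤m+n M k))) ⟩
  suc (M + k) ∸ lo               ≡⟨ cong (_∸ lo) (+-suc M k) ⟨
  M + suc k ∸ lo                 ∎)))
  where open ≡-Reasoning
... | no lo≰ = ≤-trans (≤-reflexive (trans (cong (λ z → suc (suc k) ^ suc (suc k) * (z * (M + k ∸ x) ^ suc k)) (m≤n⇒m∸n≡0 (<⇒≤ (≰⇒> lo≰))))
  (*-zeroʳ (suc (suc k) ^ suc (suc k))))) z≤n

-- Z is the mass of a product of independent events of masses A, P and R, and Ω the
-- total mass.
combine-masses : ∀ {Ω} h M k q a S U Z A P R → .{{NonZero Ω}} → let K = suc k in
  Z * Ω * Ω ≡ A * P * R → A * M ^ h ≤ a ^ h * Ω → P * M ^ 1 ≤ 1 * Ω →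
  R * M ^ (K * h + k) * (K ^ K) ^ h ≤ q ^ k * (S ^ K) ^ h * Ω →
  suc K ^ suc K * (a * S ^ K) ≤ K ^ K * U ^ suc K →
  Z * M ^ (suc K * h + K) * (suc K ^ suc K) ^ h ≤ q ^ k * (U ^ suc K) ^ h * Ω
combine-masses {Ω} h M k q a S U Z A P R eq hA hP hR am = *-cancelʳ-≤ _ _ (c * (Ω * Ω)) {{m*n≢0 c (Ω * Ω) {{m^n≢0 (K ^ K) h {{m^n≢0 K K}}}} {{m*n≢0 Ω Ω}}}} (begin
  Z * M ^ (suc K * h + K) * L ^ h * (c * (Ω * Ω))
    ≡⟨ cong (λ z → Z * z * L ^ h * (c * (Ω * Ω))) (trans (cong (M ^_) (solve 3 (λ h k e → h :+ e :+ (con 1 :+ k) := h :+ (con 1 :+ (e :+ k))) refl h k (K * h)))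
        (trans (^-distribˡ-+-* M h _) (cong (M ^ h *_) (^-distribˡ-+-* M 1 (K * h + k))))) ⟩
  Z * (M ^ h * (M ^ 1 * M ^ (K * h + k))) * L ^ h * (c * (Ω * Ω))
    ≡⟨ solve 7 (λ z mh m1 mk l c o → z :* (mh :* (m1 :* mk)) :* l :* (c :* (o :* o)) := (z :* o :* o) :* (mh :* m1 :* mk :* c :* l)) refl Z (M ^ h) (M ^ 1) (M ^ (K * h + k)) (L ^ h) c Ω ⟩
  (Z * Ω * Ω) * (M ^ h * M ^ 1 * M ^ (K * h + k) * c * L ^ h)
    ≡⟨ cong (_* (M ^ h * M ^ 1 * M ^ (K * h + k) * c * L ^ h)) eq ⟩
  (A * P * R) * (M ^ h * M ^ 1 * M ^ (K * h + k) * c * L ^ h)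
    ≡⟨ solve 8 (λ a p r mh m1 mk l c → (a :* p :* r) :* (mh :* m1 :* mk :* c :* l) := (a :* mh) :* (p :* m1) :* (r :* mk :* c) :* l) refl A P R (M ^ h) (M ^ 1) (M ^ (K * h + k)) (L ^ h) c ⟩
  (A * M ^ h) * (P * M ^ 1) * (R * M ^ (K * h + k) * c) * L ^ h
    ≤⟨ *-monoˡ-≤ (L ^ h) (*-mono-≤ (*-mono-≤ hA hP) hR) ⟩
  (a ^ h * Ω) * (1 * Ω) * (q ^ k * (S ^ K) ^ h * Ω) * L ^ h
    ≡⟨ solve 5 (λ a o q s l → (a :* o) :* (con 1 :* o) :* (q :* s :* o) :* l := l :* (a :* s) :* (q :* (o :* o :* o))) refl (a ^ h) Ω (q ^ k) ((S ^ K) ^ h) (L ^ h) ⟩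
  L ^ h * (a ^ h * (S ^ K) ^ h) * (q ^ k * (Ω * Ω * Ω))
    ≡⟨ cong (_* (q ^ k * (Ω * Ω * Ω))) (trans (cong (L ^ h *_) (sym (^-distribʳ-* h a (S ^ K)))) (sym (^-distribʳ-* h L (a * S ^ K)))) ⟩
  (L * (a * S ^ K)) ^ h * (q ^ k * (Ω * Ω * Ω))
    ≤⟨ *-monoˡ-≤ (q ^ k * (Ω * Ω * Ω)) (^-monoˡ-≤ h am) ⟩
  (K ^ K * U ^ suc K) ^ h * (q ^ k * (Ω * Ω * Ω))
    ≡⟨ cong (_* (q ^ k * (Ω * Ω * Ω))) (^-distribʳ-* h (K ^ K) (U ^ suc K)) ⟩
  c * (U ^ suc K) ^ h * (q ^ k * (Ω * Ω * Ω))
    ≡⟨ solve 4 (λ c u q o → c :* u :* (q :* (o :* o :* o)) := q :* u :* o :* (c :* (o :* o))) refl c ((U ^ suc K) ^ h) (q ^ k) Ω ⟩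
  q ^ k * (U ^ suc K) ^ h * Ω * (c * (Ω * Ω)) ∎)
  where
  open ≤-Reasoning
  K L c : ℕ
  K = suc k
  L = suc K ^ suc K
  c = (K ^ K) ^ h

-- The probability is at most (q/M)ᵏ ((M + k - lo)/(K M))^(K h). Induction along the chain: for a
-- fixed position `x` of the joint, the rest of the leading edge, the joint and the remaining chain
-- are independent. AM-GM makes the bound independent of `x`, so the sum over `x` only contributes
-- the factor `q`.
mass-fit : .{{_ : NonZero M}} → ∀ h s q base lo (D e : Subset m) es → D ⊆ e → suc h ≤ size D →
  All (λ f → size f ≡ suc (suc h)) es → Path (e ∷ es) → base + length es * s + q ≤ M + s →
  let k = length es ; K = suc k in
  mass {M} (fit s q base lo D e es) * M ^ (K * h + k) * (K ^ K) ^ h ≤ q ^ k * ((M + k ∸ lo) ^ K) ^ h * M ^ m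
mass-fit {M} {m} h s q base lo D e [] D⊆e h≤ _ _ _ = begin
  mass {M} (block D lo M) * M ^ (h + 0 + 0) * 1 ^ h  ≡⟨ cong₂ (λ z u → mass {M} (block D lo M) * M ^ z * u) (trans (+-identityʳ _) (+-identityʳ h)) (^-zeroˡ h) ⟩
  mass {M} (block D lo M) * M ^ h * 1                ≡⟨ *-identityʳ _ ⟩
  mass {M} (block D lo M) * M ^ h                    ≤⟨ mass-block-≥ D (≤-trans (n≤1+n h) h≤) (m∸n≤m M lo) ⟩
  (M ∸ lo) ^ h * M ^ m                               ≡⟨ cong (λ z → z ^ h * M ^ m) (sym (trans (*-identityʳ _) (cong (_∸ lo) (+-identityʳ M)))) ⟩
  ((M + 0 ∸ lo) ^ 1) ^ h * M ^ m                     ≡⟨ cong (_* M ^ m) (sym (*-identityˡ (((M + 0 ∸ lo) ^ 1) ^ h))) ⟩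
  1 * ((M + 0 ∸ lo) ^ 1) ^ h * M ^ m                 ∎
  where open ≤-Reasoning
mass-fit {M} {m} h s q base lo D e (f ∷ es) D⊆e h≤ (sf ∷ sizes) (e∩f≡1 , apart , path) window = begin
  mass {M} (fit s q base lo D e (f ∷ es)) * M ^ (suc K * h + K) * c
    ≡⟨ cong (λ z → z * M ^ (suc K * h + K) * c) (mass-total {M} {m} {q} _) ⟩
  total {q} Z * M ^ (suc K * h + K) * c
    ≡⟨ trans (cong (_* c) (sym (total-*ʳ Z _))) (sym (total-*ʳ (λ y → Z y * M ^ (suc K * h + K)) c)) ⟩
  total {q} (λ y → Z y * M ^ (suc K * h + K) * c)
    ≤⟨ total-≤ {q} _ _ term ⟩
  q * (q ^ k * ((M + K ∸ lo) ^ suc K) ^ h * M ^ m)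
    ≡⟨ solve 4 (λ q a b c → q :* (a :* b :* c) := q :* a :* b :* c) refl q (q ^ k) (((M + K ∸ lo) ^ suc K) ^ h) (M ^ m) ⟩
  q ^ K * ((M + K ∸ lo) ^ suc K) ^ h * M ^ m ∎
  where
  open ≤-Reasoning
  k K c : ℕ
  k = length es
  K = suc k
  c = (suc K ^ suc K) ^ h
  Z : Fin q → ℕ
  Z y = mass {M} (λ w → block (D ─ f) lo (suc (base + toℕ y)) w * block (e ∩ f) (base + toℕ y) (suc (base + toℕ y)) w * fit s q (base + s) (base + toℕ y) (f ─ e) f es w)
  -- `D` has already given up the joint with the preceding edge, and `f` takes at most one more
  -- vertex.
  size-D─f : h ≤ size (D ─ f)
  size-D─f = +-cancelʳ-≤ 1 h _ (begin
    h + 1                          ≡⟨ +-comm h 1 ⟩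
    suc h                          ≤⟨ h≤ ⟩
    size D                         ≡⟨ size-─-∩ D f ⟨
    size (D ─ f) + size (D ∩ f)    ≤⟨ +-monoʳ-≤ (size (D ─ f)) (p⊆q⇒∣p∣≤∣q∣ λ v∈ → let v∈D , v∈f = x∈p∩q⁻ D f v∈ in x∈p∩q⁺ (D⊆e v∈D , v∈f)) ⟩
    size (D ─ f) + size (e ∩ f)    ≡⟨ cong (size (D ─ f) +_) e∩f≡1 ⟩
    size (D ─ f) + 1               ∎)
  size-f─e : suc h ≤ size (f ─ e)
  size-f─e = +-cancelʳ-≤ 1 (suc h) _ (≤-reflexive (trans (+-comm (suc h) 1) (trans (sym sf) (trans (sym (size-─-∩ f e))
    (cong (size (f ─ e) +_) (trans (cong size (∩-comm f e)) e∩f≡1))))))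
  regroup : base + s + k * s + q ≡ base + K * s + q
  regroup = cong (_+ q) (+-assoc base s (k * s))
  base+q≤M : base + q ≤ M
  base+q≤M = +-cancelʳ-≤ s _ _ (≤-trans (≤-trans (≤-reflexive (solve 3 (λ b q s → b :+ q :+ s := b :+ s :+ q) refl base q s))
    (+-monoˡ-≤ q (+-monoʳ-≤ base (m≤m+n s (k * s))))) window)
  term : ∀ y → Z y * M ^ (suc K * h + K) * c ≤ q ^ k * ((M + K ∸ lo) ^ suc K) ^ h * M ^ m
  term y = combine-masses h M k q (suc x ∸ lo) (M + k ∸ x) (M + K ∸ lo) (Z y) (mass A) (mass P) (mass R) {{m^n≢0 M m}}
    (begin-equality
      Z y * M ^ m * M ^ m                              ≡⟨ cong (_* M ^ m) (mass-independent (λ w → A w * P w) R e-or-rest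
                                                            (DependsOn-* {f = A} {P} (DependsOn-weaken {f = A} (λ v → D⊆e ∘ p─q⊆p D f) (block-depends (D ─ f) lo (suc x)))
                                                                         (DependsOn-weaken {f = P} (λ v v∈ → proj₁ (x∈p∩q⁻ e f v∈)) (block-depends (e ∩ f) x (suc x))))
                                                            (fit-depends s q (base + s) x (f ─ e) f es)) ⟩
      mass (λ w → A w * P w) * mass R * M ^ m          ≡⟨ solve 3 (λ a b c → a :* b :* c := a :* c :* b) refl (mass (λ w → A w * P w)) (mass R) (M ^ m) ⟩
      mass (λ w → A w * P w) * M ^ m * mass R          ≡⟨ cong (_* mass R) (mass-independent A P off-or-on
                                                            (DependsOn-weaken {f = A} (λ v → x∈p─q⇒x∉q {p = D}) (block-depends (D ─ f) lo (suc x)))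
                                                            (DependsOn-weaken {f = P} (λ v v∈ → proj₂ (x∈p∩q⁻ e f v∈)) (block-depends (e ∩ f) x (suc x)))) ⟩
      mass A * mass P * mass R                         ∎)
    (mass-block-≥ (D ─ f) size-D─f (≤-trans (m∸n≤m (suc x) lo) x<M))
    (≤-trans (mass-block-≥ (e ∩ f) {lo = x} {suc x} (≤-reflexive (sym e∩f≡1)) (≤-trans (m∸n≤m (suc x) x) x<M))
      (≤-reflexive (cong (_* M ^ m) (trans (*-identityʳ _) (m+n∸n≡m 1 x)))))
    (mass-fit h s q (base + s) x (f ─ e) f es (p─q⊆p f e) size-f─e sizes path (≤-trans (≤-reflexive regroup) window))
    (gap-AM-GM k lo x (<⇒≤ x<M))
    where
    x : ℕ
    x = base + toℕ y
    x<M : x < M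
    x<M = <-≤-trans (+-monoʳ-< base (toℕ<n y)) base+q≤M
    A P R : Vec (Fin M) m → ℕ
    A = block (D ─ f) lo (suc x)
    P = block (e ∩ f) x (suc x)
    R = fit s q (base + s) x (f ─ e) f es
    off-or-on : ∀ v → ¬ v ∉ f ⊎ ¬ v ∈ f
    off-or-on v with v ∈? f
    ... | yes v∈f = inj₁ λ v∉f → v∉f v∈f
    ... | no  v∉f = inj₂ v∉f
    e-or-rest : ∀ v → ¬ v ∈ e ⊎ ¬ (v ∈ f ─ e ⊎ Any (v ∈_) es)
    e-or-rest v with v ∈? e
    ... | no  v∉e = inj₁ v∉e
    ... | yes v∈e = inj₂ λ { (inj₁ v∈) → x∈p─q⇒x∉q {p = f} v∈ v∈e ; (inj₂ p) → disjoint apart p }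
      where
      disjoint : ∀ {es} → All (λ g → ¬ Nonempty (e ∩ g)) es → ¬ Any (v ∈_) es
      disjoint (a ∷ _)  (here v∈g) = a (v , x∈p∩q⁺ (v∈e , v∈g))
      disjoint (_ ∷ as) (there p)  = disjoint as p

-- Counts of witnesses: for a single edge the starts of intervals of length `s` that contain it, for
-- longer lists the admissible positions of the joints. The colouring uses only whether the count
-- vanishes.
event : (s q : ℕ) → List (Subset m) → Vec (Fin M) m → ℕ
event s q []            w = 0
event {M = M} s q (e ∷ []) w = total {M} λ a → block e (toℕ a) (toℕ a + s) w
event s q (e ∷ f ∷ es)  w = 𝟙 (path? (e ∷ f ∷ es)) * fit s q s 0 e e (f ∷ es) w

event-local : ∀ s q (es : List (Subset m)) → DependsOn {M = M} (λ v → Any (v ∈_) es) (event s q es)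
event-local s q [] w w′ h = refl
event-local {M = M} s q (e ∷ []) w w′ h = total-cong {M} λ a → block-depends e (toℕ a) (toℕ a + s) w w′ (λ v v∈ → h v (here v∈))
event-local s q (e ∷ f ∷ es) w w′ h = cong (𝟙 (path? (e ∷ f ∷ es)) *_) (fit-depends s q s 0 e e (f ∷ es) w w′
  λ { v (inj₁ v∈) → h v (here v∈) ; v (inj₂ p) → h v (there p) })

mass-short : ∀ s q (e : Subset m) → mass {M} (event s q (e ∷ [])) * M ^ size e ≤ M * (s ^ size e * M ^ m)
mass-short {m} {M} s q e = begin
  mass {M} (event s q (e ∷ [])) * M ^ n        ≡⟨ cong (_* M ^ n) (mass-total {M} {m} {M} _) ⟩
  total {M} B * M ^ n                          ≡⟨ total-*ʳ B (M ^ n) ⟨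
  total {M} (λ a → B a * M ^ n)                ≤⟨ total-≤ {M} _ _ (λ a → ≤-trans (mass-block e (toℕ a) (toℕ a + s))
                                                    (≤-reflexive (cong (λ z → z ^ n * M ^ m) (m+n∸m≡n (toℕ a) s)))) ⟩
  M * (s ^ n * M ^ m)                          ∎
  where
  open ≤-Reasoning
  n : ℕ
  n = size e
  B : Fin M → ℕ
  B a = mass (block e (toℕ a) (toℕ a + s))

mass-𝟙* : ∀ {p} {P : Set p} (P? : Dec P) (f : Vec (Fin M) m → ℕ) c → (P → mass f ≤ c) → mass (λ w → 𝟙 P? * f w) ≤ c
mass-𝟙* (yes p) f c h = ≤-trans (mass-mono (λ w → ≤-reflexive (*-identityˡ (f w)))) (h p)
mass-𝟙* {M} {m} (no _) f c h = ≤-trans (≤-reflexive (mass-const {M} {m} 0)) z≤n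

size≡suc⇒Nonempty : ∀ {k} (p : Subset m) → size p ≡ suc k → Nonempty p
size≡suc⇒Nonempty {m} p eq with nonempty? p
... | yes ne = ne
... | no  em = contradiction (trans (sym eq) (trans (cong size (Empty-unique em)) (∣⊥∣≡0 m))) λ ()

-- Enumeration of the chains through an edge

walks : List (Subset m) → ℕ → Subset m → List (List (Subset m))
walks G zero    f = [] ∷ []
walks G (suc k) f = concatMap (λ g → map (g ∷_) (walks G k g)) (neighbours f G)

-- `e` is the edge with index `i`, counted from 0. The walk `l` leaves `e` backwards, hence the
-- reversing append.
chainsAt : ℕ → Subset m → List (Subset m) → ℕ → List (List (Subset m))
chainsAt r e G i = cartesianProductWith (λ l rest → l ʳ++ (e ∷ rest)) (walks G i e) (walks G (r ∸ suc i) e)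

chainsThrough : ℕ → Subset m → List (Subset m) → List (List (Subset m))
chainsThrough r e G = concatMap (chainsAt r e G) (upTo r)

length-concatMap : ∀ {A B : Set} (f : A → List B) c xs → (∀ x → x ∈ₗ xs → length (f x) ≤ c) → length (concatMap f xs) ≤ length xs * c
length-concatMap f c []       h = z≤n
length-concatMap f c (x ∷ xs) h = ≤-trans (≤-reflexive (length-++ (f x)))
  (+-mono-≤ (h x (here refl)) (length-concatMap f c xs (λ y p → h y (there p))))

length-cartesianProductWith : ∀ {A B C : Set} (f : A → B → C) xs ys → length (cartesianProductWith f xs ys) ≡ length xs * length ys
length-cartesianProductWith f []       ys = refl
length-cartesianProductWith f (x ∷ xs) ys = trans (length-++ (map (f x) ys)) (cong₂ _+_ (length-map (f x) ys) (length-cartesianProductWith f xs ys))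

length-walks : ∀ {d E} {G : List (Subset m)} → Sparse d E G → ∀ k f → f ∈ₗ E → length (walks G k f) ≤ d ^ k
length-walks sparse zero f f∈E = ≤-refl
length-walks {d = d} {G = G} sparse@(G⊆E , deg) (suc k) f f∈E = ≤-trans
  (length-concatMap _ (d ^ k) (neighbours f G) λ g g∈ → ≤-trans (≤-reflexive (length-map (g ∷_) (walks G k g)))
    (length-walks sparse k g (All.lookup G⊆E (proj₁ (∈-filter⁻ (meets? f) {xs = G} g∈)))))
  (*-monoˡ-≤ (d ^ k) (deg f f∈E))

length-chainsThrough : ∀ {d E} {G : List (Subset m)} → Sparse d E G → ∀ r e → e ∈ₗ E → length (chainsThrough (suc r) e G) ≤ suc r * d ^ r
length-chainsThrough {d = d} {G = G} sparse r e e∈E = ≤-trans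
  (length-concatMap (chainsAt (suc r) e G) (d ^ r) (upTo (suc r)) λ i i∈ → begin
    length (chainsAt (suc r) e G i)                                    ≡⟨ length-cartesianProductWith _ (walks G i e) _ ⟩
    length (walks G i e) * length (walks G (r ∸ i) e)                  ≤⟨ *-mono-≤ (length-walks sparse i e e∈E) (length-walks sparse (r ∸ i) e e∈E) ⟩
    d ^ i * d ^ (r ∸ i)                                                ≡⟨ ^-distribˡ-+-* d i (r ∸ i) ⟨
    d ^ (i + (r ∸ i))                                                  ≡⟨ cong (d ^_) (m+[n∸m]≡n (s≤s⁻¹ (∈-upTo⁻ i∈))) ⟩
    d ^ r                                                              ∎)
  (≤-reflexive (cong (_* d ^ r) (length-upTo (suc r))))
  where open ≤-Reasoning

walks-sound : ∀ (G : List (Subset m)) k f {l} → l ∈ₗ walks G k f → length l ≡ k × All (_∈ₗ G) l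
walks-sound G zero f (here refl) = refl , []
walks-sound G (suc k) f p with find (∈-concatMap⁻ (λ g → map (g ∷_) (walks G k g)) {xs = neighbours f G} p)
... | g , g∈ , q with ∈-map⁻ (g ∷_) q
...   | l , l∈ , refl with walks-sound G k g l∈
...     | len , all = cong suc len , proj₁ (∈-filter⁻ (meets? f) {xs = G} g∈) ∷ all

All-ʳ++ : ∀ {A : Set} {P : A → Set} xs {ys} → All P xs → All P ys → All P (xs ʳ++ ys)
All-ʳ++ []       []       qs = qs
All-ʳ++ (x ∷ xs) (p ∷ ps) qs = All-ʳ++ xs ps (p ∷ qs)

chainsThrough-sound : ∀ r e (G : List (Subset m)) {es} → e ∈ₗ G → es ∈ₗ chainsThrough r e G → length es ≡ r × All (_∈ₗ G) es
chainsThrough-sound r e G {es} e∈G p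
  with find (∈-concatMap⁻ (chainsAt r e G) {xs = upTo r} p)
... | i , i∈ , q with ∈-cartesianProductWith⁻ (λ l rest → l ʳ++ (e ∷ rest)) (walks G i e) (walks G (r ∸ suc i) e) q
...   | l , rest , l∈ , rest∈ , refl with walks-sound G i e l∈ | walks-sound G (r ∸ suc i) e rest∈
...     | lenˡ , allˡ | lenʳ , allʳ =
  trans (length-ʳ++ l) (trans (cong₂ (λ a b → a + suc b) lenˡ lenʳ) (trans (+-suc i _) (m+[n∸m]≡n (∈-upTo⁻ i∈)))) ,
  All-ʳ++ l allˡ (e∈G ∷ allʳ)

Path-meets : ∀ {e f} {es : List (Subset m)} → Path (e ∷ f ∷ es) → Nonempty (e ∩ f)
Path-meets {e = e} {f} (one , _) = size≡suc⇒Nonempty (e ∩ f) one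

∈-walks⁺ : ∀ {G : List (Subset m)} {k g l} f → g ∈ₗ G → Nonempty (g ∩ f) → l ∈ₗ walks G k g → g ∷ l ∈ₗ walks G (suc k) f
∈-walks⁺ {G = G} {k} {g} f g∈G meets l∈ = ∈-concatMap⁺ (λ g → map (g ∷_) (walks G k g))
  (lose (∈-filter⁺ (meets? f) g∈G meets) (∈-map⁺ (g ∷_) l∈))

Path-walk : ∀ {G : List (Subset m)} f es → Path (f ∷ es) → All (_∈ₗ G) es → es ∈ₗ walks G (length es) f
Path-walk f []       _ [] = here refl
Path-walk f (g ∷ es) path@(_ , _ , path′) (g∈G ∷ all) =
  ∈-walks⁺ {k = length es} f g∈G (subst Nonempty (∩-comm f g) (Path-meets {es = es} path)) (Path-walk g es path′ all)

-- The part already passed is kept reversed in `acc`, so that it is always a walk out of the current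
-- edge; it is complete when `e` is reached.
split-at : ∀ {G : List (Subset m)} {e} acc f rest → acc ∈ₗ walks G (length acc) f → Path (f ∷ rest) → All (_∈ₗ G) (f ∷ rest) → e ∈ₗ f ∷ rest →
  ∃₂ λ l l′ → acc ʳ++ (f ∷ rest) ≡ l ʳ++ (e ∷ l′) × l ∈ₗ walks G (length l) e × l′ ∈ₗ walks G (length l′) e
split-at acc f rest acc∈ path (_ ∷ all) (here refl) = acc , rest , refl , acc∈ , Path-walk f rest path all
split-at acc f (g ∷ rest) acc∈ path@(_ , _ , path′) (f∈G ∷ all) (there e∈) =
  split-at (f ∷ acc) g rest (∈-walks⁺ {k = length acc} g f∈G (Path-meets {es = rest} path) acc∈) path′ all e∈

∈-chainsThrough⁺ : ∀ {G : List (Subset m)} {e} es → Path es → All (_∈ₗ G) es → e ∈ₗ es → es ∈ₗ chainsThrough (length es) e G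
∈-chainsThrough⁺ {G = G} {e} (f ∷ rest) path all e∈ with split-at [] f rest (here refl) path all e∈
... | l , l′ , eq , l∈ , l′∈ = subst (_∈ₗ chainsThrough (suc (length rest)) e G) (sym eq)
  (∈-concatMap⁺ (chainsAt (suc (length rest)) e G) {xs = upTo (suc (length rest))}
    (lose (∈-upTo⁺ (≤-trans (s≤s (m≤m+n (length l) (length l′))) (≤-reflexive (sym len))))
      (∈-cartesianProductWith⁺ (λ l rest → l ʳ++ (e ∷ rest)) l∈ (subst (λ k → l′ ∈ₗ walks G k e) (sym rest≡) l′∈))))
  where
  len : suc (length rest) ≡ suc (length l + length l′)
  len = trans (cong length eq) (trans (length-ʳ++ l) (+-suc (length l) (length l′)))
  rest≡ : length rest ∸ length l ≡ length l′
  rest≡ = trans (cong (_∸ length l) (suc-injective len)) (m+n∸m≡n (length l) (length l′))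

obstructions : ℕ → Subset m → List (Subset m) → List (List (Subset m))
obstructions r e F = (e ∷ []) ∷ chainsThrough r e (e ∷ F)

obstructions-sound : ∀ {r} → 1 ≤ r → ∀ {E : List (Subset m)} e F es → es ∈ₗ obstructions r e F → e ∈ₗ E → All (_∈ₗ E) F →
                     length es ≤ r × All (_∈ₗ E) es
obstructions-sound 1≤r e F es (here refl) e∈E F⊆E = 1≤r , e∈E ∷ []
obstructions-sound {r = r} 1≤r e F es (there p) e∈E F⊆E with chainsThrough-sound r e (e ∷ F) (here refl) p
... | len , all = ≤-reflexive len , All.map (λ { (here refl) → e∈E ; (there q) → All.lookup F⊆E q }) all

obstructions-complete : ∀ {M} s q r → 2 ≤ r → ∀ e (F : List (Subset m)) es (w : Vec (Fin M) m) → length es ≡ 1 ⊎ length es ≡ r →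
                        All (_∈ₗ e ∷ F) es → e ∈ₗ es → 0 < event s q es w → es ∈ₗ obstructions r e F
obstructions-complete s q r 2≤r e F (f ∷ []) w _ all (here refl) _ = here refl
obstructions-complete s q r 2≤r e F (f ∷ g ∷ es) w (inj₂ refl) all e∈ pos with path? (f ∷ g ∷ es)
... | yes path = there (∈-chainsThrough⁺ (f ∷ g ∷ es) path all e∈)
... | no _     = contradiction pos λ ()
obstructions-complete s q r 2≤r e F (f ∷ []) w _ all (there ()) _

-- Probabilities of the obstructions

module Rarity (k h j d : ℕ) .{{_ : NonZero d}} where

  -- The number N = r T of positions is a multiple of r n, so that s is exactly
  -- (1 - j/n) N/r for j ≤ n; the factor t = 2 r makes ((T + 1)/T)ʳʰ at most 2.
  r n t T N s q : ℕ
  r = suc (suc k)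
  n = suc (suc h)
  t = 2 * r
  T = n * t
  N = r * T
  s = (n ∸ j) * t
  q = N ∸ r * s

  private instance
    t≢0 : NonZero t
    t≢0 = m*n≢0 2 r
    T≢0 : NonZero T
    T≢0 = m*n≢0 n t

  N≢0 : NonZero N
  N≢0 = m*n≢0 r T

  q≤ : q ≤ r * t * j
  q≤ = m≤n+o⇒m∸n≤o N (r * s) (begin
    r * (n * t)                      ≤⟨ *-monoʳ-≤ r (*-monoˡ-≤ t (≤-trans (m≤n+m∸n n j) (≤-reflexive (+-comm j (n ∸ j))))) ⟩
    r * ((n ∸ j + j) * t)            ≡⟨ solve 4 (λ r a j t → r :* ((a :+ j) :* t) := r :* (a :* t) :+ r :* t :* j) refl r (n ∸ j) j t ⟩
    r * s + r * t * j                ∎)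
    where open ≤-Reasoning

  r*s≤N : r * s ≤ N
  r*s≤N = *-monoʳ-≤ r (*-monoˡ-≤ t (m∸n≤m n j))

  -- There are N = 2 r² n starts for the interval, and s/N = (n ∸ j)/(r n) brings in `halve-^`; the
  -- constant is 8 r d N = 16 r³ n d.
  short-rare : 16 * r ^ 3 * n * d ≤ r ^ n * 2 ^ j → ∀ (e : Subset m) → size e ≡ n → 8 * (r * d) * mass {N} (event s q (e ∷ [])) ≤ N ^ m
  short-rare {m} hyp e size≡ = *-cancelʳ-≤ _ _ (2 ^ j * N ^ n) {{m*n≢0 (2 ^ j) (N ^ n) {{m^n≢0 2 j}} {{m^n≢0 N n {{N≢0}}}}}} (begin
    8 * (r * d) * Z * (2 ^ j * N ^ n)
      ≡⟨ solve 4 (λ a z c p → a :* z :* (c :* p) := a :* c :* (z :* p)) refl (8 * (r * d)) Z (2 ^ j) (N ^ n) ⟩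
    8 * (r * d) * 2 ^ j * (Z * N ^ n)
      ≤⟨ *-monoʳ-≤ (8 * (r * d) * 2 ^ j) (subst (λ a → Z * N ^ a ≤ N * (s ^ a * Ω)) size≡ (mass-short s q e)) ⟩
    8 * (r * d) * 2 ^ j * (N * (s ^ n * Ω))
      ≡⟨ cong (λ z → 8 * (r * d) * 2 ^ j * (N * (z * Ω))) (^-distribʳ-* n (n ∸ j) t) ⟩
    8 * (r * d) * 2 ^ j * (N * ((n ∸ j) ^ n * t ^ n * Ω))
      ≡⟨ solve 7 (λ r d c n a b o → con 8 :* (r :* d) :* c :* (r :* (n :* (con 2 :* r)) :* (a :* b :* o)) :=
                   con 16 :* (r :* (r :* (r :* con 1))) :* n :* d :* ((a :* c) :* (b :* o))) refl r d (2 ^ j) n ((n ∸ j) ^ n) (t ^ n) Ω ⟩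
    16 * r ^ 3 * n * d * ((n ∸ j) ^ n * 2 ^ j * (t ^ n * Ω))
      ≤⟨ *-mono-≤ hyp (*-monoˡ-≤ (t ^ n * Ω) (halve-^ n j)) ⟩
    r ^ n * 2 ^ j * (n ^ n * (t ^ n * Ω))
      ≡⟨ solve 5 (λ a c b e o → a :* c :* (b :* (e :* o)) := o :* (c :* (a :* (b :* e)))) refl (r ^ n) (2 ^ j) (n ^ n) (t ^ n) Ω ⟩
    Ω * (2 ^ j * (r ^ n * (n ^ n * t ^ n)))
      ≡⟨ cong (λ z → Ω * (2 ^ j * z)) (trans (cong (r ^ n *_) (sym (^-distribʳ-* n n t))) (sym (^-distribʳ-* n r T))) ⟩
    Ω * (2 ^ j * N ^ n) ∎)
    where
    open ≤-Reasoning
    Z Ω : ℕ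
    Z = mass {N} (event s q (e ∷ []))
    Ω = N ^ m

  -- `mass-fit` with q/N ≤ j/n. The closed ends of the intervals enlarge N to at most r (T + 1), and
  -- (1 + 1/T)^(r h) ≤ 2 accounts for the factor 2.
  fit-mass : ∀ (e f : Subset m) es → All (λ g → size g ≡ n) (e ∷ f ∷ es) → length es ≡ k → Path (e ∷ f ∷ es) →
             mass {N} (fit s q s 0 e e (f ∷ es)) * (r ^ (r * h) * n ^ suc k) ≤ 2 * j ^ suc k * N ^ m
  fit-mass {m} e f es (se ∷ sizes) refl path = *-cancelʳ-≤ _ _ Y {{Y≢0}} (begin
    Z * (r ^ (r * h) * n ^ k′) * Y
      ≡⟨ solve 6 (λ z a b c d e → z :* (a :* b) :* (c :* (d :* e)) := z :* ((a :* d) :* (c :* b)) :* e) refl Z (r ^ (r * h)) (n ^ k′) ((r * t) ^ k′) (T ^ (r * h)) R ⟩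
    Z * ((r ^ (r * h) * T ^ (r * h)) * ((r * t) ^ k′ * n ^ k′)) * R
      ≡⟨ cong₂ (λ a b → Z * (a * b) * R) (sym (^-distribʳ-* (r * h) r T)) (trans (sym (^-distribʳ-* k′ (r * t) n)) (cong (_^ k′) rtn≡N)) ⟩
    Z * (N ^ (r * h) * N ^ k′) * R
      ≡⟨ cong (λ z → Z * z * R) (sym (^-distribˡ-+-* N (r * h) k′)) ⟩
    Z * N ^ (r * h + k′) * R
      ≤⟨ mass-fit {{N≢0}} h s q s 0 e e (f ∷ es) id (≤-trans (n≤1+n (suc h)) (≤-reflexive (sym se))) sizes path window ⟩
    q ^ k′ * ((N + k′) ^ r) ^ h * Ω
      ≤⟨ *-monoˡ-≤ Ω (*-mono-≤ (^-monoˡ-≤ k′ q≤) (^-monoˡ-≤ h (^-monoˡ-≤ r N+k≤))) ⟩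
    (r * t * j) ^ k′ * ((r * suc T) ^ r) ^ h * Ω
      ≡⟨ cong₂ (λ a b → a * b * Ω) (^-distribʳ-* k′ (r * t) j) (trans (cong (_^ h) (^-distribʳ-* r r (suc T))) (^-distribʳ-* h (r ^ r) (suc T ^ r))) ⟩
    (r * t) ^ k′ * j ^ k′ * (R * (suc T ^ r) ^ h) * Ω
      ≤⟨ *-monoˡ-≤ Ω (*-monoʳ-≤ ((r * t) ^ k′ * j ^ k′) (*-monoʳ-≤ R (≤-trans (≤-reflexive (^-*-assoc (suc T) r h)) (suc-^≤2*^ T (r * h) 2rh≤T)))) ⟩
    (r * t) ^ k′ * j ^ k′ * (R * (2 * T ^ (r * h))) * Ω
      ≡⟨ solve 5 (λ a b c d o → a :* b :* (c :* (con 2 :* d)) :* o := con 2 :* b :* o :* (a :* (d :* c))) refl ((r * t) ^ k′) (j ^ k′) R (T ^ (r * h)) Ω ⟩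
    2 * j ^ k′ * Ω * Y ∎)
    where
    open ≤-Reasoning
    k′ Z Ω R Y : ℕ
    k′ = suc k
    Z = mass {N} (fit s q s 0 e e (f ∷ es))
    Ω = N ^ m
    R = (r ^ r) ^ h
    Y = (r * t) ^ k′ * (T ^ (r * h) * R)
    Y≢0 : NonZero Y
    Y≢0 = m*n≢0 _ _ {{m^n≢0 (r * t) k′ {{m*n≢0 r t}}}} {{m*n≢0 _ _ {{m^n≢0 T (r * h)}} {{m^n≢0 (r ^ r) h {{m^n≢0 r r}}}}}}
    rtn≡N : r * t * n ≡ N
    rtn≡N = trans (*-assoc r t n) (cong (r *_) (*-comm t n))
    window : s + length (f ∷ es) * s + q ≤ N + s
    window = ≤-trans (≤-reflexive (m+[n∸m]≡n r*s≤N)) (m≤m+n N s)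
    N+k≤ : N + k′ ≤ r * suc T
    N+k≤ = ≤-trans (+-monoʳ-≤ N (n≤1+n k′)) (≤-reflexive (trans (+-comm N r) (sym (*-suc r T))))
    2rh≤T : 2 * (r * h) ≤ T
    2rh≤T = ≤-trans (≤-reflexive (solve 2 (λ r h → con 2 :* (r :* h) := h :* (con 2 :* r)) refl r h)) (*-monoˡ-≤ t (m≤n+m h 2))

  chain-rare : 16 * r ^ 2 * d ^ r * j ^ suc k ≤ r ^ (r * h) * n ^ suc k →
               ∀ (es : List (Subset m)) → All (λ g → size g ≡ n) es → length es ≡ r →
               8 * r ^ 2 * d ^ r * mass {N} (event s q es) ≤ N ^ m
  chain-rare {m} hyp (e ∷ f ∷ es) sizes len = *-cancelʳ-≤ _ _ Y {{m*n≢0 _ _ {{m^n≢0 r (r * h)}} {{m^n≢0 n (suc k)}}}} (begin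
    8 * r ^ 2 * d ^ r * Z * Y
      ≡⟨ *-assoc (8 * r ^ 2 * d ^ r) Z Y ⟩
    8 * r ^ 2 * d ^ r * (Z * Y)
      ≤⟨ *-monoʳ-≤ (8 * r ^ 2 * d ^ r) ZY≤ ⟩
    8 * r ^ 2 * d ^ r * (2 * j ^ suc k * Ω)
      ≡⟨ solve 4 (λ a b c o → con 8 :* a :* b :* (con 2 :* c :* o) := o :* (con 16 :* a :* b :* c)) refl (r ^ 2) (d ^ r) (j ^ suc k) Ω ⟩
    Ω * (16 * r ^ 2 * d ^ r * j ^ suc k)
      ≤⟨ *-monoʳ-≤ Ω hyp ⟩
    Ω * Y ∎)
    where
    open ≤-Reasoning
    Y Z Ω : ℕ
    Y = r ^ (r * h) * n ^ suc k
    Z = mass {N} (event s q (e ∷ f ∷ es))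
    Ω = N ^ m
    ZY≤ : Z * Y ≤ 2 * j ^ suc k * Ω
    ZY≤ = begin
      Z * Y             ≡⟨ trans (*-comm Z Y) (sym (mass-*ˡ Y (event s q (e ∷ f ∷ es)))) ⟩
      mass (λ w → Y * (𝟙 (path? (e ∷ f ∷ es)) * F w))
        ≡⟨ mass-cong (λ w → solve 3 (λ y p f → y :* (p :* f) := p :* (f :* y)) refl Y (𝟙 (path? (e ∷ f ∷ es))) (F w)) ⟩
      mass (λ w → 𝟙 (path? (e ∷ f ∷ es)) * (F w * Y))
        ≤⟨ mass-𝟙* (path? (e ∷ f ∷ es)) (λ w → F w * Y) (2 * j ^ suc k * Ω) (λ path → ≤-trans
             (≤-reflexive (trans (mass-cong (λ w → *-comm (F w) Y)) (trans (mass-*ˡ Y F) (*-comm Y (mass F)))))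
             (fit-mass e f es sizes (suc-injective (suc-injective len)) path)) ⟩
      2 * j ^ suc k * Ω ∎
      where
      F : Vec (Fin N) m → ℕ
      F = fit s q s 0 e e (f ∷ es)

  -- The local lemma allows a total probability of 1/(4 r d). Half of it goes to the short edge; the
  -- other half is shared by at most c = r dʳ⁻¹ chains, each of probability at most 1/(8 r² dʳ) =
  -- 1/(8 r d c).
  obstructions-rare : 16 * r ^ 3 * n * d ≤ r ^ n * 2 ^ j → 16 * r ^ 2 * d ^ r * j ^ suc k ≤ r ^ (r * h) * n ^ suc k →
    ∀ {E : List (Subset m)} → All (λ g → size g ≡ n) E → ∀ e F → Sparse d E (e ∷ F) →
    2 * (2 * (r * d)) * sum (map (λ es → mass {N} (event s q es)) (obstructions r e F)) ≤ N ^ m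
  obstructions-rare {m} hyp₁ hyp₂ {E} sizes e F sparse@((e∈E ∷ F⊆E) , _) = *-cancelˡ-≤ 2 (begin
    2 * (2 * (2 * (r * d)) * (A + B))
      ≡⟨ solve 3 (λ rd a b → con 2 :* (con 2 :* (con 2 :* rd) :* (a :+ b)) := con 8 :* rd :* a :+ con 8 :* rd :* b) refl (r * d) A B ⟩
    8 * (r * d) * A + 8 * (r * d) * B
      ≤⟨ +-mono-≤ (short-rare hyp₁ e (All.lookup sizes e∈E)) B≤ ⟩
    Ω + Ω ≡⟨ cong (Ω +_) (sym (+-identityʳ Ω)) ⟩
    2 * Ω ∎)
    where
    open ≤-Reasoning
    chains : List (List (Subset m))
    chains = chainsThrough r e (e ∷ F)
    A B Ω c : ℕ
    A = mass {N} (event s q (e ∷ []))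
    B = sum (map (λ es → mass {N} (event s q es)) chains)
    Ω = N ^ m
    c = r * d ^ suc k
    each : ∀ es → es ∈ₗ chains → 8 * r ^ 2 * d ^ r * mass {N} (event s q es) ≤ Ω
    each es p with chainsThrough-sound r e (e ∷ F) (here refl) p
    ... | len , all = chain-rare hyp₂ es (All.map (λ g∈ → All.lookup sizes (All.lookup (e∈E ∷ F⊆E) g∈)) all) len
    B≤ : 8 * (r * d) * B ≤ Ω
    B≤ = *-cancelʳ-≤ _ _ c {{m*n≢0 r (d ^ suc k) {{_}} {{m^n≢0 d (suc k)}}}} (begin
      8 * (r * d) * B * c
        ≡⟨ solve 4 (λ r d p b → con 8 :* (r :* d) :* b :* (r :* p) := con 8 :* (r :* (r :* con 1)) :* (d :* p) :* b) refl r d (d ^ suc k) B ⟩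
      8 * r ^ 2 * d ^ r * B
        ≤⟨ *-sum-≤ (λ es → mass {N} (event s q es)) (8 * r ^ 2 * d ^ r) Ω chains each ⟩
      length chains * Ω
        ≤⟨ *-monoˡ-≤ Ω (length-chainsThrough sparse (suc k) e e∈E) ⟩
      c * Ω ≡⟨ *-comm c Ω ⟩
      Ω * c ∎)

-- The colouring

largest≤-≤ : ∀ {P : ℕ → Set} (P? : ∀ j → Dec (P j)) b → largest≤ P? b ≤ b
largest≤-≤ P? zero = z≤n
largest≤-≤ P? (suc b) with P? (suc b)
... | yes _ = ≤-refl
... | no  _ = m≤n⇒m≤1+n (largest≤-≤ P? b)

largest≤-maximal : ∀ {P : ℕ → Set} (P? : ∀ j → Dec (P j)) {j} b → j ≤ b → P j → j ≤ largest≤ P? b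
largest≤-maximal P? zero j≤b _ = j≤b
largest≤-maximal P? (suc b) j≤b p with P? (suc b)
... | yes _ = j≤b
... | no ¬p with m≤n⇒m<n∨m≡n j≤b
...   | inj₁ (s≤s j≤) = largest≤-maximal P? b j≤ p
...   | inj₂ refl = contradiction p ¬p

term≤total : ∀ {k} (f : Fin k → ℕ) i → f i ≤ total f
term≤total f zero    = m≤m+n _ _
term≤total f (suc i) = ≤-trans (term≤total (f ∘ suc) i) (m≤n+m _ (f zero))

module ChainColouring {m M : ℕ} (w : Vec (Fin M) m) (E : List (Subset m)) where

  position : Fin m → ℕ
  position v = toℕ (lookup w v)

  -- Position, with ties broken by index.
  key : Fin m → ℕ
  key v = toℕ (combine (lookup w v) v)

  key-injective : ∀ {u v} → key u ≡ key v → u ≡ v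
  key-injective {u} {v} eq = combine-injectiveʳ (lookup w u) u (lookup w v) v (toℕ-injective eq)

  key⇒position : ∀ {u v} → key u ≤ key v → position u ≤ position v
  key⇒position {u} {v} le = ≮⇒≥ λ lt → <⇒≱ (combine-monoˡ-< v u lt) le

  First Last : Subset m → Fin m → Set
  First e a = a ∈ e × (∀ v → v ∈ e → key a ≤ key v)
  Last  e b = b ∈ e × (∀ v → v ∈ e → key v ≤ key b)

  first? : ∀ e a → Dec (First e a)
  first? e a = a ∈? e ×-dec Fin.all? (λ v → v ∈? e →-dec key a ≤? key v)

  last? : ∀ e b → Dec (Last e b)
  last? e b = b ∈? e ×-dec Fin.all? (λ v → v ∈? e →-dec key v ≤? key b)

  ∃First : ∀ e → Nonempty e → ∃ (First e)
  ∃First e (v , v∈e) = argmin key v vs , argmin-all key {P = _∈ e} v∈e (all-filter (_∈? e) (allFin m)) ,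
    λ u u∈e → All.lookup (f[argmin]≤f[xs] v vs) (∈-filter⁺ (_∈? e) (∈-allFin u) u∈e)
    where
    vs : List (Fin m)
    vs = filter (_∈? e) (allFin m)

  ∃Last : ∀ e → Nonempty e → ∃ (Last e)
  ∃Last e (v , v∈e) = argmax key v vs , argmax-all key {P = _∈ e} v∈e (all-filter (_∈? e) (allFin m)) ,
    λ u u∈e → All.lookup (f[xs]≤f[argmax] v vs) (∈-filter⁺ (_∈? e) (∈-allFin u) u∈e)
    where
    vs : List (Fin m)
    vs = filter (_∈? e) (allFin m)

  First<Last : ∀ {h e a b} → size e ≡ suc (suc h) → First e a → Last e b → key a < key b
  First<Last {h} {e} {a} {b} size≡ (a∈ , min) (b∈ , max) = ≤∧≢⇒< (min b b∈) λ eq → contradiction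
    (≤-trans (≤-reflexive (sym size≡)) (≤-trans
      (p⊆q⇒∣p∣≤∣q∣ {q = ⁅ a ⁆} λ {v} v∈ → subst (_∈ ⁅ a ⁆) (key-injective (≤-antisym (min v v∈) (≤-trans (max v v∈) (≤-reflexive (sym eq))))) (x∈⁅x⁆ a))
      (≤-reflexive (∣⁅x⁆∣≡1 a))))
    λ { (s≤s ()) }

  Chain : Fin m → List (Subset m) → Set
  Chain a []       = ⊤
  Chain a (e ∷ es) = First e a × ∃ λ b → Last e b × Chain b es

  chain-lower : ∀ {a} es → Chain a es → ∀ {g v} → g ∈ₗ es → v ∈ g → key a ≤ key v
  chain-lower (e ∷ es) ((_ , min) , _) (here refl) v∈ = min _ v∈
  chain-lower (e ∷ es) ((_ , min) , b , (b∈ , _) , chain) (there g∈) v∈ = ≤-trans (min b b∈) (chain-lower es chain g∈ v∈)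

  -- The joint `b` has the largest key in `e` and the smallest in `f`, so by injectivity of keys
  -- nothing else is shared. Later edges lie at or above the last vertex of `f`, which is strictly
  -- above `b` because `f` has two vertices.
  chain-Path : ∀ {h a} es → All (λ g → size g ≡ suc (suc h)) es → Chain a es → Path es
  chain-Path [] _ _ = tt
  chain-Path (e ∷ []) _ _ = tt
  chain-Path (e ∷ f ∷ es) (_ ∷ sizes@(sf ∷ _)) (_ , b , (b∈e , max) , chain@(firstf@(b∈f , min) , c , lastf , rest)) =
    ≤-antisym
      (≤-trans (p⊆q⇒∣p∣≤∣q∣ {q = ⁅ b ⁆} λ {v} v∈ → let v∈e , v∈f = x∈p∩q⁻ e f v∈ in
        subst (_∈ ⁅ b ⁆) (key-injective (≤-antisym (min v v∈f) (max v v∈e))) (x∈⁅x⁆ b)) (≤-reflexive (∣⁅x⁆∣≡1 b)))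
      (≤-trans (≤-reflexive (sym (∣⁅x⁆∣≡1 b))) (p⊆q⇒∣p∣≤∣q∣ {p = ⁅ b ⁆} λ v∈ →
        subst (_∈ e ∩ f) (sym (x∈⁅y⁆⇒x≡y b v∈)) (x∈p∩q⁺ (b∈e , b∈f)))) ,
    All.tabulate (λ {g} g∈ (v , v∈) → let v∈e , v∈g = x∈p∩q⁻ e g v∈ in
      <⇒≱ (<-≤-trans (First<Last sf firstf lastf) (chain-lower es rest g∈ v∈g)) (max v v∈e)) ,
    chain-Path (f ∷ es) sizes chain

  Reach : ℕ → Fin m → Set
  Reach zero    a = ⊤
  Reach (suc k) a = Any (λ e → First e a × ∃ λ b → Last e b × Reach k b) E

  reach? : ∀ k a → Dec (Reach k a)
  reach? zero    a = yes tt
  reach? (suc k) a = any? (λ e → first? e a ×-dec Fin.any? (λ b → last? e b ×-dec reach? k b)) E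

  Reach⇒Chain : ∀ k a → Reach k a → ∃ λ es → length es ≡ k × All (_∈ₗ E) es × Chain a es
  Reach⇒Chain zero    a _ = [] , refl , [] , tt
  Reach⇒Chain (suc k) a reach with find reach
  ... | e , e∈ , first , b , last , reach′ with Reach⇒Chain k b reach′
  ...   | es , len , es⊆E , chain = e ∷ es , cong suc len , e∈ ∷ es⊆E , first , b , last , chain

  module _ (s q : ℕ) (no-short : ∀ e → e ∈ₗ E → event s q (e ∷ []) w ≡ 0) where

    span : ∀ {e a b} → e ∈ₗ E → First e a → Last e b → position a + s ≤ position b
    span {e} {a} {b} e∈ (_ , min) (_ , max) = ≮⇒≥ λ lt → contradiction
      (trans (sym (block≡1 e (position a) (position a + s) w λ v v∈ →
                key⇒position (min v v∈) , ≤-<-trans (key⇒position (max v v∈)) lt))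
        (total≡0 _ (≤-reflexive (no-short e e∈)) (lookup w a)))
      λ ()

    chain-upper : ∀ {a} es → All (_∈ₗ E) es → Chain a es → position a + length es * s < M
    chain-upper {a} [] _ _ = subst (_< M) (sym (+-identityʳ _)) (toℕ<n (lookup w a))
    chain-upper {a} (e ∷ es) (e∈ ∷ es⊆E) (first , b , last , chain) = ≤-<-trans
      (≤-trans (≤-reflexive (sym (+-assoc (position a) s _))) (+-monoˡ-≤ _ (span e∈ first last)))
      (chain-upper es es⊆E chain)

    -- The actual position of each joint selects a positive summand: `span` keeps it at or above
    -- `base`, and the room of `s` needed by every remaining edge keeps it below `base + q`.
    chain-fit : ∀ base lo D e es {a} → All (_∈ₗ E) (e ∷ es) → Chain a (e ∷ es) → D ⊆ e → lo ≤ position a →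
                base ≤ position a + s → M ≤ base + length es * s + q → 0 < fit s q base lo D e es w
    chain-fit base lo D e [] _ ((_ , min) , _) D⊆e lo≤a _ _ = ≤-reflexive (sym (block≡1 D lo M w λ v v∈ →
      ≤-trans lo≤a (key⇒position (min v (D⊆e v∈))) , toℕ<n (lookup w v)))
    chain-fit base lo D e (f ∷ es) {a} (e∈ ∷ all) (first@(_ , min) , b , last@(_ , max) , chain@((_ , min′) , _)) D⊆e lo≤a base≤ M≤ =
      <-≤-trans (positive x x≡) (term≤total {q} _ (fromℕ< y<q))
      where
      y<q : position b ∸ base < q
      y<q = +-cancelˡ-< base _ _ (subst (_< base + q) (sym (m+[n∸m]≡n (≤-trans base≤ (span e∈ first last))))
        (+-cancelʳ-< (length (f ∷ es) * s) _ _ (<-≤-trans (chain-upper (f ∷ es) all chain) (≤-trans M≤ (≤-reflexive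
          (trans (+-assoc base _ q) (trans (cong (base +_) (+-comm _ q)) (sym (+-assoc base q _)))))))))
      x : ℕ
      x = base + toℕ (fromℕ< y<q)
      x≡ : x ≡ position b
      x≡ = trans (cong (base +_) (toℕ-fromℕ< y<q)) (m+[n∸m]≡n (≤-trans base≤ (span e∈ first last)))
      positive : ∀ x → x ≡ position b → 0 < block (D ─ f) lo (suc x) w * block (e ∩ f) x (suc x) w * fit s q (base + s) x (f ─ e) f es w
      positive x refl = subst (0 <_) (sym (trans (cong₂ (λ y z → y * z * fit s q (base + s) x (f ─ e) f es w)
        (block≡1 (D ─ f) lo (suc x) w λ v v∈ → let v∈e = D⊆e (p─q⊆p D f v∈) in
          ≤-trans lo≤a (key⇒position (min v v∈e)) , s≤s (key⇒position (max v v∈e)))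
        (block≡1 (e ∩ f) x (suc x) w λ v v∈ → let v∈e , v∈f = x∈p∩q⁻ e f v∈ in
          key⇒position (min′ v v∈f) , s≤s (key⇒position (max v v∈e))))
        (+-identityʳ _)))
        (chain-fit (base + s) x (f ─ e) f es all chain (p─q⊆p f e) ≤-refl
          (+-monoˡ-≤ s (≤-trans base≤ (span e∈ first last)))
          (≤-trans M≤ (≤-reflexive (cong (_+ q) (sym (+-assoc base s _))))))

    module _ (k h : ℕ) (sizes : All (λ e → size e ≡ suc (suc h)) E) (M≤ : M ≤ suc (suc k) * s + q)
      (no-chain : ∀ es → length es ≡ suc (suc k) → All (_∈ₗ E) es → event s q es w ≡ 0) where

      ¬Reach : ∀ a → ¬ Reach (suc (suc k)) a
      ¬Reach a reach with Reach⇒Chain (suc (suc k)) a reach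
      ... | e ∷ f ∷ es , len , es⊆E , chain = contradiction (no-chain (e ∷ f ∷ es) len es⊆E) (>⇒≢ (<-≤-trans
        (chain-fit s 0 e e (f ∷ es) es⊆E chain id z≤n (m≤n+m s _)
          (≤-trans M≤ (≤-reflexive (cong (λ l → l * s + q) (sym len)))))
        (≤-reflexive (sym (trans (cong (_* fit s q s 0 e e (f ∷ es) w) (𝟙-yes (path? (e ∷ f ∷ es))
          (chain-Path (e ∷ f ∷ es) (All.map (All.lookup sizes) es⊆E) chain))) (+-identityʳ _))))))

      colour : Fin m → ℕ
      colour v = largest≤ (λ i → reach? i v) (suc k)

      colour-reached : ∀ v → Reach (colour v) v
      colour-reached v with colour v | largest≤-holds (λ i → reach? i v) (suc k)
      ... | _ | inj₁ refl = tt
      ... | _ | inj₂ p    = p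

      -- The cap `suc k` in `colour` is harmless: if `b` had that colour, prefixing `e` would give a
      -- chain of r edges.
      colour-decreases : ∀ {e a b} → e ∈ₗ E → First e a → Last e b → colour b < colour a
      colour-decreases {e} {a} {b} e∈ first last = largest≤-maximal (λ i → reach? i a) (suc k)
        (≤∧≢⇒< (largest≤-≤ (λ i → reach? i b) (suc k)) λ eq → ¬Reach a (subst (λ i → Reach (suc i) a) eq reach))
        reach
        where
        reach : Reach (suc (colour b)) a
        reach = lose e∈ (first , b , last , colour-reached b)

      proper : ∃ λ (c : Fin m → Fin (suc (suc k))) → All (λ e → ∃₂ λ u v → u ∈ e × v ∈ e × c u ≢ c v) E
      proper = (λ v → fromℕ< (s≤s (largest≤-≤ (λ i → reach? i v) (suc k)))) , All.tabulate λ {e} e∈ →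
        let ne = size≡suc⇒Nonempty e (All.lookup sizes e∈)
            a , first = ∃First e ne
            b , last  = ∃Last e ne
        in a , b , proj₁ first , proj₁ last , λ eq → <⇒≢ (colour-decreases e∈ first last)
          (trans (sym (toℕ-fromℕ< _)) (trans (cong toℕ (sym eq)) (toℕ-fromℕ< _)))

-- From the two numerical conditions to colourability

length-filter-≡ : ∀ {A : Set} (_≟_ : DecidableEquality A) y {xs} → Unique xs → length (filter (_≟ y) xs) ≤ 1
length-filter-≡ _≟_ y [] = z≤n
length-filter-≡ _≟_ y {x ∷ xs} (x∉ ∷ u) with x ≟ y
... | yes refl = s≤s (≤-reflexive (cong length (filter-none (_≟ y) (All.map (λ x≢ eq → x≢ (sym eq)) x∉))))
... | no  _    = length-filter-≡ _≟_ y u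

length-neighbours : ∀ H f → length (neighbours f (edges H)) ≤ suc (degree H f)
length-neighbours H f = ≤-trans
  (length-filter-⊎ (meets? f) (λ e → e ≟ˢ f) (λ e → ¬? (e ≟ˢ f) ×-dec nonempty? (e ∩ f)) same-or-other (edges H))
  (+-monoˡ-≤ (degree H f) (length-filter-≡ _≟ˢ_ f (unique H)))
  where
  _≟ˢ_ : DecidableEquality (Subset (order H))
  _≟ˢ_ = Vec.≡-dec Bool._≟_
  same-or-other : ∀ e → Nonempty (e ∩ f) → e ≡ f ⊎ e ≢ f × Nonempty (e ∩ f)
  same-or-other e meets with e ≟ˢ f
  ... | yes e≡f = inj₁ e≡f
  ... | no  e≢f = inj₂ (e≢f , meets)

ensuresColorable : ∀ k h j d .{{_ : NonZero d}} → let r = suc (suc k) ; n = suc (suc h) in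
  16 * r ^ 3 * n * d ≤ r ^ n * 2 ^ j → 16 * r ^ 2 * d ^ r * j ^ suc k ≤ r ^ (r * h) * n ^ suc k → EnsuresColorable n r d
ensuresColorable k h j d@(suc _) hyp₁ hyp₂ H sizes degrees =
  proper s q (λ e e∈ → w-good (e ∷ []) (inj₁ refl) (e∈ ∷ [])) k h sizes (m≤n+m∸n N (r * s)) (λ es len → w-good es (inj₂ len))
  where
  open Rarity k h j d
  open LocalLemma {{N≢0}} r d (edges H) (event s q) (event-local s q) (obstructions r)
    (obstructions-sound (s≤s z≤n)) (obstructions-complete s q r (s≤s (s≤s z≤n))) (obstructions-rare hyp₁ hyp₂ sizes)
  sparse : Sparse d (edges H) (edges H)
  sparse = All.tabulate id , λ f f∈ → ≤-trans (length-neighbours H f) (All.lookup degrees f∈)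
  w = proj₁ (good-exists sparse)
  w-good : Good (edges H) w
  w-good = proj₂ (good-exists sparse)
  open ChainColouring w (edges H)

-- The size of D(n,r)

suc≤2^ : ∀ n → suc n ≤ 2 ^ n
suc≤2^ zero    = ≤-refl
suc≤2^ (suc n) = +-mono-≤ (m^n>0 2 n) (≤-trans (suc≤2^ n) (m≤m+n _ 0))

log₂ : ∀ n → .{{NonZero n}} → ∃[ f ] 2 ^ f ≤ n × n < 2 ^ suc f
log₂ 1 = 0 , s≤s z≤n , s≤s (s≤s z≤n)
log₂ (suc n@(suc _)) with log₂ n
... | f , le , lt with suc n <? 2 ^ suc f
...   | yes lt′ = f , m≤n⇒m≤1+n le , lt′
...   | no ¬lt  = suc f , ≮⇒≥ ¬lt , ≤-<-trans lt (^-monoʳ-< 2 (s≤s (s≤s z≤n)) (n<1+n (suc f)))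

-- r^(2r) is the quotient of r^(r n) and r^(r h), `16 * r ^ 2` comes from the chain condition,
-- `2 ^ r` from d + 1 ≤ 2 d and `6 ^ suc k` from j = 6 f.
constant : ℕ → ℕ
constant k = let r = suc (suc k) in r ^ (2 * r) * (16 * r ^ 2) * (2 ^ r * 6 ^ suc k)

module Threshold (k h f : ℕ) .{{_ : NonZero f}} (2^f≤n : 2 ^ f ≤ suc (suc h)) (n<2^ : suc (suc h) < 2 ^ suc f)
  (large : 16 * suc (suc k) ^ 3 ≤ h) where

  -- Here f is the integer part of log₂ n, so that 2ʲ ≥ n³.
  r n j : ℕ
  r = suc (suc k)
  n = suc (suc h)
  j = 6 * f

  open ≤-Reasoning

  -- The chain condition of `ensuresColorable`; by `Fits⇒short` it implies the condition on short
  -- edges.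
  Fits : ℕ → Set
  Fits d = 16 * r ^ 2 * d ^ r * j ^ suc k ≤ r ^ (r * h) * n ^ suc k

  h≤n : h ≤ n
  h≤n = m≤n+m h 2

  -- A crude bound that drops all factors involving `j`; the power of n lost here is regained from
  -- 2ʲ ≥ n³.
  Fits⇒≤ : ∀ d → Fits d → d ≤ n * r ^ n
  Fits⇒≤ d fits = ≮⇒≥ λ lt → contradiction (begin-strict
    r ^ (r * h) * n ^ suc k        ≤⟨ *-mono-≤ (^-monoʳ-≤ r (≤-trans (*-monoʳ-≤ r h≤n) (≤-reflexive (*-comm r n)))) (^-monoʳ-≤ n (n≤1+n (suc k))) ⟩
    r ^ (n * r) * n ^ r            ≡⟨ *-comm _ (n ^ r) ⟩
    n ^ r * r ^ (n * r)            ≡⟨ cong (n ^ r *_) (^-*-assoc r n r) ⟨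
    n ^ r * (r ^ n) ^ r            ≡⟨ ^-distribʳ-* r n (r ^ n) ⟨
    (n * r ^ n) ^ r                <⟨ ^-monoˡ-< r lt ⟩
    d ^ r                          ≤⟨ m≤n*m (d ^ r) (16 * r ^ 2) {{m*n≢0 16 (r ^ 2)}} ⟩
    16 * r ^ 2 * d ^ r             ≤⟨ m≤m*n (16 * r ^ 2 * d ^ r) (j ^ suc k) {{m^n≢0 j (suc k) {{m*n≢0 6 f}}}} ⟩
    16 * r ^ 2 * d ^ r * j ^ suc k ≤⟨ fits ⟩
    r ^ (r * h) * n ^ suc k        ∎) (<-irrefl refl)

  n≤2^2f : n ≤ 2 ^ (2 * f)
  n≤2^2f = ≤-trans (<⇒≤ n<2^) (^-monoʳ-≤ 2 (begin
    suc f    ≤⟨ +-monoˡ-≤ f (>-nonZero⁻¹ f) ⟩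
    f + f    ≡⟨ cong (f +_) (+-identityʳ f) ⟨
    2 * f    ∎))

  Fits⇒short : ∀ d → Fits d → 16 * r ^ 3 * n * d ≤ r ^ n * 2 ^ j
  Fits⇒short d fits = begin
    16 * r ^ 3 * n * d        ≤⟨ *-mono-≤ (*-monoˡ-≤ n (≤-trans large h≤n)) (Fits⇒≤ d fits) ⟩
    n * n * (n * r ^ n)       ≡⟨ solve 2 (λ n p → n :* n :* (n :* p) := p :* (n :* (n :* (n :* con 1)))) refl n (r ^ n) ⟩
    r ^ n * n ^ 3             ≤⟨ *-monoʳ-≤ (r ^ n) (^-monoˡ-≤ 3 n≤2^2f) ⟩
    r ^ n * (2 ^ (2 * f)) ^ 3 ≡⟨ cong (r ^ n *_) (trans (^-*-assoc 2 (2 * f) 3) (cong (2 ^_) (solve 1 (λ f → con 2 :* f :* con 3 := con 6 :* f) refl f))) ⟩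
    r ^ n * 2 ^ j             ∎

  16r^2≤h : 16 * r ^ 2 ≤ h
  16r^2≤h = ≤-trans (*-monoʳ-≤ 16 (^-monoʳ-≤ r (n≤1+n 2))) large

  h≤r^h : h ≤ r ^ h
  h≤r^h = ≤-trans (n≤1+n h) (≤-trans (suc≤2^ h) (^-monoˡ-≤ h (s≤s (s≤s z≤n))))

  Fits-1 : Fits 1
  Fits-1 = begin
    16 * r ^ 2 * 1 ^ r * j ^ suc k              ≡⟨ cong (λ z → 16 * r ^ 2 * z * j ^ suc k) (^-zeroˡ r) ⟩
    16 * r ^ 2 * 1 * j ^ suc k                  ≤⟨ *-monoˡ-≤ (j ^ suc k) (≤-trans (≤-reflexive (*-identityʳ _)) (≤-trans 16r^2≤h h≤r^h)) ⟩
    r ^ h * j ^ suc k                           ≤⟨ *-monoʳ-≤ (r ^ h) (^-monoˡ-≤ (suc k) (*-mono-≤ 6≤r^h (≤-trans (n≤1+n f) (≤-trans (suc≤2^ f) 2^f≤n)))) ⟩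
    r ^ h * (r ^ h * n) ^ suc k                 ≡⟨ cong (r ^ h *_) (^-distribʳ-* (suc k) (r ^ h) n) ⟩
    r ^ h * ((r ^ h) ^ suc k * n ^ suc k)       ≡⟨ *-assoc (r ^ h) _ _ ⟨
    (r ^ h) ^ r * n ^ suc k                     ≡⟨ cong (_* n ^ suc k) (trans (^-*-assoc r h r) (cong (r ^_) (*-comm h r))) ⟩
    r ^ (r * h) * n ^ suc k                     ∎
    where
    6≤r^h : 6 ≤ r ^ h
    6≤r^h = ≤-trans (m≤m+n 6 10) (≤-trans (m≤m*n 16 (r ^ 2)) (≤-trans 16r^2≤h h≤r^h))

  -- By maximality of `d`, `Fits (suc d)` fails, and this failure is the lower bound on d + 1.
  -- `Fits-1` yields d ≥ 1, so that d + 1 may be replaced by 2 d.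
  D-bound : ∀ d → IsD n r d → n ^ suc k * (r ^ n) ^ r ≤ constant k * (d ^ r * f ^ suc k)
  D-bound d (_ , maximal) = begin
    n ^ suc k * (r ^ n) ^ r
      ≡⟨ cong (n ^ suc k *_) (trans (^-*-assoc r n r) (trans (cong (r ^_) (trans (*-comm n r) (trans (*-distribˡ-+ r 2 h) (cong (_+ r * h) (*-comm r 2))))) (^-distribˡ-+-* r (2 * r) (r * h)))) ⟩
    n ^ suc k * (r ^ (2 * r) * r ^ (r * h))
      ≡⟨ solve 3 (λ a b c → a :* (b :* c) := b :* (c :* a)) refl (n ^ suc k) (r ^ (2 * r)) (r ^ (r * h)) ⟩
    r ^ (2 * r) * (r ^ (r * h) * n ^ suc k)
      ≤⟨ *-monoʳ-≤ (r ^ (2 * r)) (<⇒≤ (≰⇒> ¬fits)) ⟩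
    r ^ (2 * r) * (16 * r ^ 2 * suc d ^ r * j ^ suc k)
      ≤⟨ *-monoʳ-≤ (r ^ (2 * r)) (*-monoˡ-≤ (j ^ suc k) (*-monoʳ-≤ (16 * r ^ 2) (^-monoˡ-≤ r 1+d≤2d))) ⟩
    r ^ (2 * r) * (16 * r ^ 2 * (2 * d) ^ r * (6 * f) ^ suc k)
      ≡⟨ cong₂ (λ a b → r ^ (2 * r) * (16 * r ^ 2 * a * b)) (^-distribʳ-* r 2 d) (^-distribʳ-* (suc k) 6 f) ⟩
    r ^ (2 * r) * (16 * r ^ 2 * (2 ^ r * d ^ r) * (6 ^ suc k * f ^ suc k))
      ≡⟨ solve 6 (λ a b c d e f → a :* (b :* (c :* d) :* (e :* f)) := a :* b :* (c :* e) :* (d :* f)) refl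
           (r ^ (2 * r)) (16 * r ^ 2) (2 ^ r) (d ^ r) (6 ^ suc k) (f ^ suc k) ⟩
    constant k * (d ^ r * f ^ suc k) ∎
    where
    ensures : ∀ d → .{{NonZero d}} → Fits d → EnsuresColorable n r d
    ensures d fits = ensuresColorable k h j d (Fits⇒short d fits) fits
    ¬fits : ¬ Fits (suc d)
    ¬fits fits = <-irrefl refl (maximal (suc d) (ensures (suc d) fits))
    1+d≤2d : suc d ≤ 2 * d
    1+d≤2d = ≤-trans (+-monoˡ-≤ d (maximal 1 (ensures 1 Fits-1))) (≤-reflexive (cong (d +_) (sym (+-identityʳ d))))

D-lower : ∀ k n d → let r = suc (suc k) in 2 + 16 * r ^ 3 ≤ n → IsD n r d →
  ∃[ f ] NonZero f × 2 ^ f ≤ n × n ^ suc k * (r ^ n) ^ r ≤ constant k * (d ^ r * f ^ suc k)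
D-lower k (suc (suc h)) d (s≤s (s≤s large)) isD with log₂ (suc (suc h))
... | zero , _ , s≤s (s≤s ())
... | f@(suc _) , 2^f≤n , n<2^ = f , _ , 2^f≤n , Threshold.D-bound k h f 2^f≤n n<2^ large d isD

-- Real estimates

fromℕℚ-mono : ∀ {m n} → m ≤ n → fromℕℚ m ℚ.≤ fromℕℚ n
fromℕℚ-mono {n = n} z≤n = fromℕℚ-nonNeg n
fromℕℚ-mono (s≤s {m} {n} m≤n) = subst₂ ℚ._≤_ (sym (fromℕℚ-suc m)) (sym (fromℕℚ-suc n)) (ℚ.+-monoˡ-≤ 1ℚ (fromℕℚ-mono m≤n))

fromℕℚ-^ : ∀ a p → fromℕℚ (a ^ p) ≡ fromℕℚ a ^ℚ p
fromℕℚ-^ a zero    = refl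
fromℕℚ-^ a (suc p) = trans (fromℕℚ-* a (a ^ p)) (cong (fromℕℚ a ℚ.*_) (fromℕℚ-^ a p))

fromℕℚ-pos : ∀ n → .{{NonZero n}} → 0ℚ ℚ.< fromℕℚ n
fromℕℚ-pos (suc n) = ℚ.<-≤-trans 0<1ℚ (1≤fromℕℚ-suc n)

^ℚ-distribʳ-* : ∀ p x y → (x ℚ.* y) ^ℚ p ≡ x ^ℚ p ℚ.* y ^ℚ p
^ℚ-distribʳ-* zero    x y = refl
^ℚ-distribʳ-* (suc p) x y = trans (cong (x ℚ.* y ℚ.*_) (^ℚ-distribʳ-* p x y))
  (solveℚ 4 (λ x y a b → x ⊗ y ⊗ (a ⊗ b) ⊜ x ⊗ a ⊗ (y ⊗ b)) refl x y (x ^ℚ p) (y ^ℚ p))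

^ℚ-cancel-≤ : ∀ {p q} n → 0ℚ ℚ.≤ q → p ^ℚ suc n ℚ.≤ q ^ℚ suc n → p ℚ.≤ q
^ℚ-cancel-≤ {p} {q} n 0≤q le with p ℚ.≤? q
... | yes p≤q = p≤q
... | no  p≰q = contradiction (ℚ.<-≤-trans q^<p^ le) (ℚ.<-irrefl refl)
  where
  q<p : q ℚ.< p
  q<p = ℚ.≰⇒> p≰q
  q^<p^ : q ^ℚ suc n ℚ.< p ^ℚ suc n
  q^<p^ = ℚ.≤-<-trans
    (ℚ.*-monoˡ-≤-nonNeg q {{ℚ.nonNegative 0≤q}} (^-mono n 0≤q (ℚ.<⇒≤ q<p)))
    (ℚ.*-monoˡ-<-pos (p ^ℚ n) {{ℚ.positive (^-pos n (ℚ.≤-<-trans 0≤q q<p))}} q<p)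

∑-nonNeg : ∀ m f → (∀ i → 0ℚ ℚ.≤ f i) → 0ℚ ℚ.≤ ∑ m f
∑-nonNeg zero    f 0≤f = ℚ.≤-refl
∑-nonNeg (suc m) f 0≤f = +-nonNeg (∑-nonNeg m f 0≤f) (0≤f m)

-- The dyadic block 1/(p+2) + … + 1/(2p+2) with p + 1 = 2^f is at least 1/2.
harmonic-lower : ∀ f → ∃[ p ] suc p ≡ 2 ^ f × fromℕℚ f ℚ.* 1/suc 1 ℚ.≤ ∑ p (1/suc ∘ suc)
harmonic-lower zero = 0 , refl , ℚ.≤-reflexive (ℚ.*-zeroˡ (1/suc 1))
harmonic-lower (suc f) with harmonic-lower f
... | p , 1+p≡ , ih = p + suc p , cong₂ _+_ 1+p≡ (trans 1+p≡ (sym (+-identityʳ _))) , (begin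
  fromℕℚ (suc f) ℚ.* 1/suc 1                        ≡⟨ cong (ℚ._* 1/suc 1) (fromℕℚ-suc f) ⟩
  (fromℕℚ f ℚ.+ 1ℚ) ℚ.* 1/suc 1                     ≡⟨ trans (ℚ.*-distribʳ-+ (1/suc 1) (fromℕℚ f) 1ℚ) (cong (fromℕℚ f ℚ.* 1/suc 1 ℚ.+_) (ℚ.*-identityˡ (1/suc 1))) ⟩
  fromℕℚ f ℚ.* 1/suc 1 ℚ.+ 1/suc 1                  ≤⟨ ℚ.+-mono-≤ ih half ⟩
  ∑ p (1/suc ∘ suc) ℚ.+ ∑ (suc p) (λ i → 1/suc (suc (p + i)))
                                                    ≡⟨ ∑-+ p (suc p) (1/suc ∘ suc) ⟨
  ∑ (p + suc p) (1/suc ∘ suc)                       ∎)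
  where
  open ℚ.≤-Reasoning
  half : 1/suc 1 ℚ.≤ ∑ (suc p) (λ i → 1/suc (suc (p + i)))
  half = begin
    1/suc 1                                         ≡⟨ 1/suc-*-fromℕℚ 1 p ⟨
    fromℕℚ (suc p) ℚ.* 1/suc (p + 1 * suc p)        ≡⟨ ∑-const (suc p) _ ⟨
    ∑ (suc p) (λ _ → 1/suc (p + 1 * suc p))         ≤⟨ ∑-mono (suc p) (λ { i (s≤s i≤p) → 1/suc-antimono
                                                         (≤-trans (s≤s (+-monoʳ-≤ p i≤p)) (≤-reflexive (trans (sym (+-suc p p)) (cong (p +_) (sym (+-identityʳ (suc p))))))) }) ⟩
    ∑ (suc p) (λ i → 1/suc (suc (p + i)))           ∎

∑-extend : ∀ {m n} f → (∀ i → 0ℚ ℚ.≤ f i) → m ≤ n → ∑ m f ℚ.≤ ∑ n f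
∑-extend {m} f 0≤f m≤n with m≤n⇒∃[o]m+o≡n m≤n
... | o , refl = ℚ.≤-trans (p≤p+q (∑ m f) (∑-nonNeg o (λ i → f (m + i)) (λ i → 0≤f (m + i)))) (ℚ.≤-reflexive (sym (∑-+ m o f)))

-- At index 0 the Riemann sum is 1/2 + ... + 1/n, and refinement only increases a lower sum. The
-- bound thus holds for every approximation of ln n and not only in the limit.
lnApprox-lower : ∀ f n k → 2 ^ f ≤ n → fromℕℚ f ℚ.* 1/suc 1 ℚ.≤ lnApprox n k
lnApprox-lower f n k 2^f≤n with harmonic-lower f
... | p , 1+p≡ , le = begin
  fromℕℚ f ℚ.* 1/suc 1             ≤⟨ le ⟩
  ∑ p (1/suc ∘ suc)                ≤⟨ ∑-extend (1/suc ∘ suc) (λ i → 0≤1/suc (suc i)) (≤-trans (∸-monoˡ-≤ 1 (≤-trans (≤-reflexive 1+p≡) 2^f≤n)) (≤-reflexive (sym (*-identityʳ (n ∸ 1))))) ⟩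
  lnApprox n 0                     ≤⟨ refine-lower n 0 k ⟩
  lnApprox n (k + 0)               ≡⟨ cong (lnApprox n) (+-identityʳ k) ⟩
  lnApprox n k                     ∎
  where open ℚ.≤-Reasoning

seq-^ℝ : ∀ x p i → seq (x ^ℝ p) i ≡ seq x i ^ℚ p
seq-^ℝ x zero    i = refl
seq-^ℝ x (suc p) i = cong (seq x i ℚ.*_) (seq-^ℝ x p i)

quotient-bound : ∀ f n L → .{{NonZero f}} → fromℕℚ f ℚ.* 1/suc 1 ℚ.≤ L →
                 0ℚ ℚ.≤ fromℕℚ n ℚ.* recip L × fromℕℚ n ℚ.* recip L ℚ.* fromℕℚ f ℚ.≤ fromℕℚ (2 * n)
quotient-bound f n L f/2≤L = 0≤X , (begin
  X ℚ.* fromℕℚ f                              ≡⟨ cong (X ℚ.*_) f≡ ⟩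
  X ℚ.* (fromℕℚ 2 ℚ.* u)                      ≤⟨ ℚ.*-monoˡ-≤-nonNeg X {{ℚ.nonNegative 0≤X}} (ℚ.*-monoˡ-≤-nonNeg (fromℕℚ 2) f/2≤L) ⟩
  X ℚ.* (fromℕℚ 2 ℚ.* L)                      ≡⟨ solveℚ 4 (λ n i t l → n ⊗ i ⊗ (t ⊗ l) ⊜ t ⊗ n ⊗ (l ⊗ i)) refl (fromℕℚ n) (recip L) (fromℕℚ 2) L ⟩
  fromℕℚ 2 ℚ.* fromℕℚ n ℚ.* (L ℚ.* recip L)   ≡⟨ cong₂ ℚ._*_ (sym (fromℕℚ-* 2 n)) (recip-inverse 0<L) ⟩
  fromℕℚ (2 * n) ℚ.* 1ℚ                       ≡⟨ ℚ.*-identityʳ _ ⟩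
  fromℕℚ (2 * n)                              ∎)
  where
  open ℚ.≤-Reasoning
  u X : ℚ
  u = fromℕℚ f ℚ.* 1/suc 1
  X = fromℕℚ n ℚ.* recip L
  0<L : 0ℚ ℚ.< L
  0<L = ℚ.<-≤-trans (*-pos (fromℕℚ-pos f) (0<1/suc 1)) f/2≤L
  0≤X : 0ℚ ℚ.≤ X
  0≤X = *-nonNeg (fromℕℚ-nonNeg n) (recip-pos 0<L)
  f≡ : fromℕℚ f ≡ fromℕℚ 2 ℚ.* u
  f≡ = sym (trans (solveℚ 3 (λ t f h → t ⊗ (f ⊗ h) ⊜ f ⊗ (t ⊗ h)) refl (fromℕℚ 2) (fromℕℚ f) (1/suc 1))
    (trans (cong (fromℕℚ f ℚ.*_) (1/suc-inverse 1)) (ℚ.*-identityʳ _)))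

fromℕℚ-monomial : ∀ a p b q → fromℕℚ (a ^ p * b ^ q) ≡ fromℕℚ a ^ℚ p ℚ.* fromℕℚ b ^ℚ q
fromℕℚ-monomial a p b q = trans (fromℕℚ-* (a ^ p) (b ^ q)) (cong₂ ℚ._*_ (fromℕℚ-^ a p) (fromℕℚ-^ b q))

fromℕℚ-monomial-≤ : ∀ a p b q a′ p′ b′ q′ → a ^ p * b ^ q ≤ a′ ^ p′ * b′ ^ q′ →
  fromℕℚ a ^ℚ p ℚ.* fromℕℚ b ^ℚ q ℚ.≤ fromℕℚ a′ ^ℚ p′ ℚ.* fromℕℚ b′ ^ℚ q′
fromℕℚ-monomial-≤ a p b q a′ p′ b′ q′ le = subst₂ ℚ._≤_ (fromℕℚ-monomial a p b q) (fromℕℚ-monomial a′ p′ b′ q′) (fromℕℚ-mono le)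

-- The comparison is made between (r + 1)-st powers multiplied by Fᵏ, since (X F)ᵏ ≤ Tᵏ eliminates
-- `X`. A lower approximation `y` of the root suffices; y = 0 covers a grid search that finds
-- nothing.
root-bound : ∀ k r c κ D R F T X y → 0ℚ ℚ.< F → 0ℚ ℚ.≤ X → 0ℚ ℚ.≤ R → 0ℚ ℚ.≤ κ ℚ.* D → 0ℚ ℚ.≤ c → 0ℚ ℚ.≤ D → κ ℚ.* c ≡ 1ℚ →
  X ℚ.* F ℚ.≤ T → T ^ℚ k ℚ.* R ^ℚ suc r ℚ.≤ (κ ℚ.* D) ^ℚ suc r ℚ.* F ^ℚ k →
  y ≡ 0ℚ ⊎ y ^ℚ suc r ℚ.≤ X ^ℚ k → c ℚ.* y ℚ.* R ℚ.≤ D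
root-bound k r c κ D R F T X y 0<F 0≤X 0≤R 0≤κD 0≤c 0≤D κc≡1 XF≤T hyp (inj₁ refl) = ℚ.≤-trans
  (ℚ.≤-reflexive (trans (cong (ℚ._* R) (ℚ.*-zeroʳ c)) (ℚ.*-zeroˡ R))) 0≤D
root-bound k r c κ D R F T X y 0<F 0≤X 0≤R 0≤κD 0≤c 0≤D κc≡1 XF≤T hyp (inj₂ y^≤) = begin
  c ℚ.* y ℚ.* R              ≡⟨ ℚ.*-assoc c y R ⟩
  c ℚ.* (y ℚ.* R)            ≤⟨ ℚ.*-monoˡ-≤-nonNeg c {{ℚ.nonNegative 0≤c}} yR≤ ⟩
  c ℚ.* (κ ℚ.* D)            ≡⟨ solveℚ 3 (λ c κ d → c ⊗ (κ ⊗ d) ⊜ κ ⊗ c ⊗ d) refl c κ D ⟩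
  κ ℚ.* c ℚ.* D              ≡⟨ cong (ℚ._* D) κc≡1 ⟩
  1ℚ ℚ.* D                   ≡⟨ ℚ.*-identityˡ D ⟩
  D                          ∎
  where
  open ℚ.≤-Reasoning
  powers : (y ℚ.* R) ^ℚ suc r ℚ.* F ^ℚ k ℚ.≤ (κ ℚ.* D) ^ℚ suc r ℚ.* F ^ℚ k
  powers = begin
    (y ℚ.* R) ^ℚ suc r ℚ.* F ^ℚ k             ≡⟨ cong (ℚ._* F ^ℚ k) (^ℚ-distribʳ-* (suc r) y R) ⟩
    y ^ℚ suc r ℚ.* R ^ℚ suc r ℚ.* F ^ℚ k      ≡⟨ ℚ.*-assoc (y ^ℚ suc r) _ _ ⟩
    y ^ℚ suc r ℚ.* (R ^ℚ suc r ℚ.* F ^ℚ k)    ≤⟨ ℚ.*-monoʳ-≤-nonNeg (R ^ℚ suc r ℚ.* F ^ℚ k) {{ℚ.nonNegative (*-nonNeg (^-nonNeg (suc r) 0≤R) (^-nonNeg k (ℚ.<⇒≤ 0<F)))}} y^≤ ⟩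
    X ^ℚ k ℚ.* (R ^ℚ suc r ℚ.* F ^ℚ k)        ≡⟨ solveℚ 3 (λ x r f → x ⊗ (r ⊗ f) ⊜ x ⊗ f ⊗ r) refl (X ^ℚ k) (R ^ℚ suc r) (F ^ℚ k) ⟩
    X ^ℚ k ℚ.* F ^ℚ k ℚ.* R ^ℚ suc r          ≡⟨ cong (ℚ._* R ^ℚ suc r) (^ℚ-distribʳ-* k X F) ⟨
    (X ℚ.* F) ^ℚ k ℚ.* R ^ℚ suc r             ≤⟨ ℚ.*-monoʳ-≤-nonNeg (R ^ℚ suc r) {{ℚ.nonNegative (^-nonNeg (suc r) 0≤R)}}
                                                   (^-mono k (*-nonNeg 0≤X (ℚ.<⇒≤ 0<F)) XF≤T) ⟩
    T ^ℚ k ℚ.* R ^ℚ suc r                     ≤⟨ hyp ⟩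
    (κ ℚ.* D) ^ℚ suc r ℚ.* F ^ℚ k             ∎
  yR≤ : y ℚ.* R ℚ.≤ κ ℚ.* D
  yR≤ = ^ℚ-cancel-≤ r 0≤κD (ℚ.*-cancelʳ-≤-pos (F ^ℚ k) {{ℚ.positive (^-pos k 0<F)}} powers)

-- suc κ ≤ (suc κ)^(r + 1) moves the constant 2ᵏ K inside the power without extracting a root of it.
scale-bound : ∀ k r n f R d K κ → n ^ k * R ^ suc r ≤ K * (d ^ suc r * f ^ k) → 2 ^ k * K ≤ κ →
              (2 * n) ^ k * R ^ suc r ≤ (suc κ * d) ^ suc r * f ^ k
scale-bound k r n f R d K κ hyp κ≥ = begin
  (2 * n) ^ k * R ^ suc r                     ≡⟨ trans (cong (_* R ^ suc r) (^-distribʳ-* k 2 n)) (*-assoc (2 ^ k) _ _) ⟩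
  2 ^ k * (n ^ k * R ^ suc r)                 ≤⟨ *-monoʳ-≤ (2 ^ k) hyp ⟩
  2 ^ k * (K * (d ^ suc r * f ^ k))           ≡⟨ trans (sym (*-assoc (2 ^ k) K _)) (sym (*-assoc (2 ^ k * K) (d ^ suc r) _)) ⟩
  2 ^ k * K * d ^ suc r * f ^ k               ≤⟨ *-monoˡ-≤ (f ^ k) (*-monoˡ-≤ (d ^ suc r) (≤-trans κ≥ (≤-trans (n≤1+n κ) (m≤m*n (suc κ) (suc κ ^ r) {{m^n≢0 (suc κ) r}})))) ⟩
  suc κ ^ suc r * d ^ suc r * f ^ k           ≡⟨ cong (_* f ^ k) (^-distribʳ-* (suc r) (suc κ) d) ⟨
  (suc κ * d) ^ suc r * f ^ k                 ∎
  where open ≤-Reasoning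

power-bound : ∀ k r n f R d κ X y → .{{NonZero f}} → 0ℚ ℚ.≤ X → X ℚ.* fromℕℚ f ℚ.≤ fromℕℚ (2 * n) →
  (2 * n) ^ k * R ^ suc r ≤ (suc κ * d) ^ suc r * f ^ k →
  y ≡ 0ℚ ⊎ y ^ℚ suc r ℚ.≤ X ^ℚ k → 1/suc κ ℚ.* y ℚ.* fromℕℚ R ℚ.≤ fromℕℚ d
power-bound k r n f R d κ X y 0≤X Xf≤ hyp = root-bound k r (1/suc κ) (fromℕℚ (suc κ)) (fromℕℚ d) (fromℕℚ R) (fromℕℚ f) (fromℕℚ (2 * n)) X y
  (fromℕℚ-pos f) 0≤X (fromℕℚ-nonNeg R) (*-nonNeg {fromℕℚ (suc κ)} {fromℕℚ d} (fromℕℚ-nonNeg (suc κ)) (fromℕℚ-nonNeg d)) (0≤1/suc κ) (fromℕℚ-nonNeg d) (1/suc-inverse κ) Xf≤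
  (subst (λ z → fromℕℚ (2 * n) ^ℚ k ℚ.* fromℕℚ R ^ℚ suc r ℚ.≤ z ^ℚ suc r ℚ.* fromℕℚ f ^ℚ k) (fromℕℚ-* (suc κ) d)
    (fromℕℚ-monomial-≤ (2 * n) k R (suc r) (suc κ * d) (suc r) f k hyp))

-- The inequality already holds for each rational approximation, hence the starting index 0 and a
-- slack `ε` that is only added.
termwise : ∀ p r n f R d κ (x : ℝ) → .{{NonZero f}} → (∀ i → 0ℚ ℚ.≤ seq x i) → (∀ i → seq x i ℚ.* fromℕℚ f ℚ.≤ fromℕℚ (2 * n)) →
  (2 * n) ^ p * R ^ suc r ≤ (suc κ * d) ^ suc r * f ^ p →
  fromℚ (1/suc κ) *ℝ x ^ℝ[ p / suc r ] *ℝ fromℕ R ≤ℝ fromℕ d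
termwise p r n f R d κ x 0≤x x≤ hyp ε 0<ε = 0 , λ i _ → ℚ.≤-trans
  (power-bound p r n f R d κ (seq x i) (y i) (0≤x i) (x≤ i) hyp
    (subst (λ a → y i ≡ 0ℚ ⊎ y i ^ℚ suc r ℚ.≤ a) (seq-^ℝ x p i) (rootApprox-lower (suc r) (seq (x ^ℝ p) i) i)))
  (p≤p+q (fromℕℚ d) (ℚ.<⇒≤ 0<ε))
  where
  y : ℕ → ℚ
  y i = fromℕℚ (rootNumerator (suc r) (seq (x ^ℝ p) i) i) ℚ.* 1/suc i

0<fromℚ : ∀ {q} → 0ℚ ℚ.< q → 0ℝ <ℝ fromℚ q
0<fromℚ {q} 0<q = q , 0<q , 0 , λ _ _ → ℚ.≤-reflexive (ℚ.+-identityˡ q)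

lower-bound : ∀ p r K κ n d (1<n : 1 < n) → 2 ^ p * K ≤ κ →
  (∃[ f ] NonZero f × 2 ^ f ≤ n × n ^ p * (suc r ^ n) ^ suc r ≤ K * (d ^ suc r * f ^ p)) →
  fromℚ (1/suc κ) *ℝ (fromℕ n *ℝ inverse (ln n) (ln-positive 1<n)) ^ℝ[ p / suc r ] *ℝ fromℕ (suc r ^ n) ≤ℝ fromℕ d
lower-bound p r K κ n d 1<n κ≥ (f , f≢0 , 2^f≤n , bound) =
  termwise p r n f (suc r ^ n) d κ (fromℕ n *ℝ inverse (ln n) (ln-positive 1<n)) {{f≢0}}
    (λ i → proj₁ (quotient i)) (λ i → proj₂ (quotient i))
    (scale-bound p r n f (suc r ^ n) d K κ bound κ≥)
  where
  quotient : ∀ i → 0ℚ ℚ.≤ fromℕℚ n ℚ.* recip (lnApprox n i) × fromℕℚ n ℚ.* recip (lnApprox n i) ℚ.* fromℕℚ f ℚ.≤ fromℕℚ (2 * n)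
  quotient i = quotient-bound f n (lnApprox n i) {{f≢0}} (lnApprox-lower f n i 2^f≤n)

-- Kept general in p, so that the exponent r ∸ 1 of the theorem is never
-- normalised inside a real number.
real-lower-bound : ∀ p r K n₀ κ → 2 ^ p * K ≤ κ →
  (∀ n d → n₀ ≤ n → IsD n (suc r) d → ∃[ f ] NonZero f × 2 ^ f ≤ n × n ^ p * (suc r ^ n) ^ suc r ≤ K * (d ^ suc r * f ^ p)) →
  ∃[ C ] 0ℝ <ℝ C × (∃[ n₀ ] ((n d : ℕ) (1<n : 1 < n) → n₀ ≤ n → IsD n (suc r) d →
  C *ℝ (fromℕ n *ℝ inverse (ln n) (ln-positive 1<n)) ^ℝ[ p / suc r ] *ℝ fromℕ (suc r ^ n) ≤ℝ fromℕ d))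
real-lower-bound p r K n₀ κ κ≥ bound = fromℚ (1/suc κ) , 0<fromℚ (0<1/suc κ) , n₀ ,
  λ n d 1<n n₀≤n isD → lower-bound p r K κ n d 1<n κ≥ (bound n d n₀≤n isD)

theorem3 : (r : ℕ) → 2 ≤ r →
    ∃[ C ] 0ℝ <ℝ C × (∃[ n₀ ] ((n d : ℕ) (1<n : 1 < n) → n₀ ≤ n → IsD n r d →
    C *ℝ (fromℕ n *ℝ inverse (ln n) (ln-positive 1<n)) ^ℝ[ r ∸ 1 / r ] *ℝ fromℕ (r ^ n) ≤ℝ fromℕ d))
theorem3 (suc zero) (s≤s ())
-- `≤-refl` fixes κ = 2^(r-1) * `constant k`, so C = 1/(κ + 1); the threshold 2 + 16 r³ is the
-- largeness hypothesis on h = n - 2.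
theorem3 (suc (suc k)) _ = real-lower-bound (suc (suc k) ∸ 1) (suc k) (constant k) (2 + 16 * suc (suc k) ^ 3) _ ≤-refl (D-lower k)
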